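{- Let $\theta=e^{\pi i/6}$ and let $$A=\begin{pmatrix}0&0&0&0&0&0\\0&0&3&6&6&9\\0&3&9&1&7&6\\0&6&4&10&1&7\\0&6&10&7&4&1\\0&9&6&4&10&3\end{pmatrix}$$ with entries in $\mathbb{Z}/12\mathbb{Z}$ and rows and columns indexed by $0,\dots,5$. Let $H$ be the $6\times6$ complex matrix with entries $H_{rs}=\theta^{A_{rs}}$. Let $P$ be the $6\times6$ permutation matrix whose left multiplication exchanges rows $4$ and $5$ and fixes rows $0,1,2,3$, and set $K=PH^{\mathsf T}$; equivalently, $K_{rs}=\theta^{B_{rs}}$ with $$B=\begin{pmatrix}0&0&0&0&0&0\\0&0&3&6&6&9\\0&3&9&4&10&6\\0&6&1&10&7&4\\0&9&6&7&1&3\\0&6&7&1&4&10\end{pmatrix}.$$ Let $h_0,\dots,h_5$ and $k_0,\dots,k_5$ be the columns of $H$ and $K$, respectively, and let $\Phi_{35}$ be the $6\times 6$ array of vectors with $(i,j)$ entry $\frac{1}{\sqrt6}(h_i\odot k_j)\in\mathbb{C}^6$, $0\le i,j\le5$. Then $\Phi_{35}$ is a quantum Latin square of order $6$ and its cardinality is $35$.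
   Context: For $x,y\in\mathbb{C}^n$, $x\odot y=(x_0y_0,\dots,x_{n-1}y_{n-1})^{\mathsf T}$ is the entrywise (Schur) product. A quantum Latin square of order $n$, denoted $\mathrm{QLS}(n)$, is an $n\times n$ array $(\phi_{ij})_{0\le i,j\le n-1}$ of unit vectors in $\mathbb{C}^n$ such that every row and every column forms an orthonormal basis of $\mathbb{C}^n$. Two unit vectors $u,v$ are phase equivalent, $u\sim v$, if $u=e^{i\alpha}v$ for some $\alpha\in\mathbb{R}$. The cardinality of a quantum Latin square is the number of distinct phase-equivalence classes among its $n^2$ entries. -}

module Defs where

open import Algebra.Bundles using (RawRing)
open import Data.Bool.Base using (if_then_else_)
open import Data.Empty using (⊥-elim)
open import Data.Fin using (Fin; #_; toℕ)
open import Data.Fin.Permutation using (Permutation′; _⟨$⟩ʳ_) renaming (transpose to transposition)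
import Data.Fin.Properties as Fin
open import Data.Integer.Base as ℤ using (+_)
import Data.Integer.Properties as ℤ
open import Data.Integer.Tactic.RingSolver using () renaming (solve-∀ to ℤ-solve-∀)
open import Data.Nat.Base as ℕ using (ℕ; zero; suc)
import Data.Nat.Properties as ℕ
open import Data.Product.Base using (Σ-syntax; ∃-syntax; _×_; _,_; proj₁; proj₂)
open import Data.Rational.Base
open import Data.Rational.Properties
import Data.Rational.Unnormalised.Base as ℚᵘ
import Data.Rational.Unnormalised.Properties as ℚᵘ
open import Data.Sum.Base using (_⊎_; inj₁; inj₂; [_,_]′)
open import Data.Vec.Functional using (Vector; []; _∷_; transpose)
open import Function.Definitions using (Congruent; Bijective)
open import Level using (0ℓ)
open import Relation.Binary.PropositionalEquality
open import Relation.Nullary.Decidable using (yes; no; does; dec⇒maybe)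
open import Relation.Nullary.Negation using (¬_)
open import Tactic.RingSolver using (solve-∀)
open import Tactic.RingSolver.Core.AlmostCommutativeRing
  using (AlmostCommutativeRing; fromCommutativeRing)

ℚ-ring : AlmostCommutativeRing 0ℓ 0ℓ
ℚ-ring = fromCommutativeRing +-*-commutativeRing (λ x → dec⇒maybe (0ℚ ≟ x))

fromℕ : ℕ → ℚ
fromℕ n = + n / 1

suc⁻¹ : ℕ → ℚ
suc⁻¹ k = + 1 / suc k

fromℕ-suc : ∀ k → fromℕ (suc k) ≡ fromℕ k + 1ℚ
fromℕ-suc k = toℚᵘ-injective (begin
  toℚᵘ (fromℕ (suc k))        ≈⟨ toℚᵘ-fromℚᵘ (+ suc k ℚᵘ./ 1) ⟩
  + suc k ℚᵘ./ 1               ≈⟨ ℚᵘ.*≡* (eq (+ k)) ⟩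
  (+ k ℚᵘ./ 1) ℚᵘ.+ (+ 1 ℚᵘ./ 1) ≈⟨ ℚᵘ.+-congˡ _ (ℚᵘ.≃-sym (toℚᵘ-fromℚᵘ (+ k ℚᵘ./ 1))) ⟩
  toℚᵘ (fromℕ k) ℚᵘ.+ toℚᵘ 1ℚ  ≈⟨ ℚᵘ.≃-sym (toℚᵘ-homo-+ (fromℕ k) 1ℚ) ⟩
  toℚᵘ (fromℕ k + 1ℚ)         ∎)
  where
  open ℚᵘ.≃-Reasoning
  eq : ∀ x → (+ 1 ℤ.+ x) ℤ.* + 1 ≡ (x ℤ.* + 1 ℤ.+ + 1 ℤ.* + 1) ℤ.* + 1
  eq = ℤ-solve-∀

suc⁻¹-inverse : ∀ k → suc⁻¹ k * fromℕ (suc k) ≡ 1ℚ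
suc⁻¹-inverse k = toℚᵘ-injective (begin
  toℚᵘ (suc⁻¹ k * fromℕ (suc k))            ≈⟨ toℚᵘ-homo-* (suc⁻¹ k) (fromℕ (suc k)) ⟩
  toℚᵘ (suc⁻¹ k) ℚᵘ.* toℚᵘ (fromℕ (suc k))  ≈⟨ ℚᵘ.*-cong (toℚᵘ-fromℚᵘ (+ 1 ℚᵘ./ suc k)) (toℚᵘ-fromℚᵘ (+ suc k ℚᵘ./ 1)) ⟩
  (+ 1 ℚᵘ./ suc k) ℚᵘ.* (+ suc k ℚᵘ./ 1) ≈⟨ ℚᵘ.*≡* (eq (+ suc k)) ⟩
  ℚᵘ.1ℚᵘ ∎)
  where
  open ℚᵘ.≃-Reasoning
  eq : ∀ x → (+ 1 ℤ.* x) ℤ.* + 1 ≡ + 1 ℤ.* (x ℤ.* + 1)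
  eq = ℤ-solve-∀

/-split : ∀ a k → + a / suc k ≡ fromℕ a * suc⁻¹ k
/-split a k = toℚᵘ-injective (begin
  toℚᵘ (+ a / suc k)              ≈⟨ toℚᵘ-fromℚᵘ (+ a ℚᵘ./ suc k) ⟩
  + a ℚᵘ./ suc k                  ≈⟨ ℚᵘ.*≡* (eq (+ a) (+ suc k)) ⟩
  (+ a ℚᵘ./ 1) ℚᵘ.* (+ 1 ℚᵘ./ suc k) ≈⟨ ℚᵘ.≃-sym (ℚᵘ.*-cong (toℚᵘ-fromℚᵘ (+ a ℚᵘ./ 1)) (toℚᵘ-fromℚᵘ (+ 1 ℚᵘ./ suc k))) ⟩
  toℚᵘ (fromℕ a) ℚᵘ.* toℚᵘ (suc⁻¹ k)  ≈⟨ ℚᵘ.≃-sym (toℚᵘ-homo-* (fromℕ a) (suc⁻¹ k)) ⟩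
  toℚᵘ (fromℕ a * suc⁻¹ k)            ∎)
  where
  open ℚᵘ.≃-Reasoning
  eq : ∀ x y → x ℤ.* (+ 1 ℤ.* y) ≡ (x ℤ.* + 1) ℤ.* y
  eq = ℤ-solve-∀

------------------------------------------------------------------------

*-monoˡ : ∀ {c p q} → 0ℚ ≤ c → p ≤ q → c * p ≤ c * q
*-monoˡ {c} 0≤c = *-monoˡ-≤-nonNeg c {{nonNegative 0≤c}}

*-monoʳ : ∀ {c p q} → 0ℚ ≤ c → p ≤ q → p * c ≤ q * c
*-monoʳ {c} 0≤c = *-monoʳ-≤-nonNeg c {{nonNegative 0≤c}}

*-mono : ∀ {p q p′ q′} → 0ℚ ≤ p′ → 0ℚ ≤ q → p ≤ q → p′ ≤ q′ → p * p′ ≤ q * q′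
*-mono 0≤p′ 0≤q p≤q p′≤q′ = ≤-trans (*-monoʳ 0≤p′ p≤q) (*-monoˡ 0≤q p′≤q′)

*-mono-<ˡ : ∀ {c p q} → 0ℚ < c → p < q → c * p < c * q
*-mono-<ˡ {c} 0<c = *-monoʳ-<-pos c {{positive 0<c}}

*-nonNeg : ∀ {p q} → 0ℚ ≤ p → 0ℚ ≤ q → 0ℚ ≤ p * q
*-nonNeg {p} {q} 0≤p 0≤q = subst (_≤ p * q) (*-zeroʳ p) (*-monoˡ 0≤p 0≤q)

*-pos : ∀ {p q} → 0ℚ < p → 0ℚ < q → 0ℚ < p * q
*-pos {p} {q} 0<p 0<q = subst (_< p * q) (*-zeroʳ p) (*-mono-<ˡ 0<p 0<q)

+-nonNeg : ∀ {p q} → 0ℚ ≤ p → 0ℚ ≤ q → 0ℚ ≤ p + q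
+-nonNeg = +-mono-≤

p≤p+q : ∀ {p q} → 0ℚ ≤ q → p ≤ p + q
p≤p+q {p} {q} 0≤q = subst (_≤ p + q) (+-identityʳ p) (+-monoʳ-≤ p 0≤q)

p≤q+p : ∀ {p q} → 0ℚ ≤ q → p ≤ q + p
p≤q+p {p} {q} 0≤q = subst (p ≤_) (+-comm p q) (p≤p+q 0≤q)

suc⁻¹-pos : ∀ k → 0ℚ < suc⁻¹ k
suc⁻¹-pos k = positive⁻¹ (suc⁻¹ k) {{normalize-pos 1 (suc k)}}

fromℕ-nonNeg : ∀ n → 0ℚ ≤ fromℕ n
fromℕ-nonNeg n = nonNegative⁻¹ (fromℕ n) {{normalize-nonNeg n 1}}

fromℕ-pos : ∀ n → 0ℚ < fromℕ (suc n)
fromℕ-pos n = positive⁻¹ (fromℕ (suc n)) {{normalize-pos (suc n) 1}}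

fromℕ-mono : ∀ {m n} → m ℕ.≤ n → fromℕ m ≤ fromℕ n
fromℕ-mono {m} {n} m≤n = toℚᵘ-cancel-≤ (begin
  toℚᵘ (fromℕ m) ≃⟨ toℚᵘ-fromℚᵘ (+ m ℚᵘ./ 1) ⟩
  + m ℚᵘ./ 1     ≤⟨ ℚᵘ.*≤* (ℤ.*-monoʳ-≤-nonNeg (+ 1) (ℤ.+≤+ m≤n)) ⟩
  + n ℚᵘ./ 1     ≃⟨ ℚᵘ.≃-sym (toℚᵘ-fromℚᵘ (+ n ℚᵘ./ 1)) ⟩
  toℚᵘ (fromℕ n) ∎)
  where open ℚᵘ.≤-Reasoning

archimedean : ∀ q → ∃[ n ] q ≤ fromℕ n
archimedean q@record{} = n , toℚᵘ-cancel-≤ (begin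
  toℚᵘ q         ≤⟨ ℚᵘ.*≤* (bound (↥ q)) ⟩
  + n ℚᵘ./ 1     ≃⟨ ℚᵘ.≃-sym (toℚᵘ-fromℚᵘ (+ n ℚᵘ./ 1)) ⟩
  toℚᵘ (fromℕ n) ∎)
  where
  open ℚᵘ.≤-Reasoning
  n = ℤ.∣ ↥ q ∣
  bound : ∀ a → a ℤ.* + 1 ℤ.≤ + ℤ.∣ a ∣ ℤ.* ↧ q
  bound (+ a)    = ℤ.*-monoˡ-≤-nonNeg (+ a) {+ 1} {↧ q} (ℤ.+≤+ (ℕ.s≤s ℕ.z≤n))
  bound ℤ.-[1+ a ] = ℤ.-≤+

posInverse : ∀ {p} → 0ℚ < p → ∃[ q ] (0ℚ < q × p * q ≡ 1ℚ)
posInverse {p} 0<p = (1/ p) {{p≢0}} , positive⁻¹ _ {{1/pos⇒pos p {{positive 0<p}}}} , *-inverseʳ p {{p≢0}}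
  where
  p≢0 : NonZero p
  p≢0 = >-nonZero 0<p

-- For every ε > 0 and c there is n with c < (n + 1) ε
archimedean-< : ∀ {ε} → 0ℚ < ε → ∀ c → ∃[ n ] c < fromℕ (suc n) * ε
archimedean-< {ε} 0<ε c with posInverse 0<ε
... | q , 0<q , εq≡1 with archimedean (c * q)
...   | n , cq≤n = n , (begin-strict
  c                   ≡⟨ *-identityʳ c ⟨
  c * 1ℚ              ≡⟨ cong (c *_) εq≡1 ⟨
  c * (ε * q)         ≡⟨ eq c ε q ⟩
  (c * q) * ε         ≤⟨ *-monoʳ (<⇒≤ 0<ε) cq≤n ⟩
  fromℕ n * ε         ≡⟨ *-comm (fromℕ n) ε ⟩
  ε * fromℕ n         <⟨ *-mono-<ˡ 0<ε n<sn ⟩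
  ε * fromℕ (suc n)   ≡⟨ *-comm ε _ ⟩
  fromℕ (suc n) * ε   ∎)
  where
  open ≤-Reasoning
  eq : ∀ a b d → a * (b * d) ≡ (a * d) * b
  eq = solve-∀ ℚ-ring
  n<sn : fromℕ n < fromℕ (suc n)
  n<sn = subst₂ _<_ (+-identityʳ (fromℕ n)) (sym (fromℕ-suc n)) (+-monoʳ-< (fromℕ n) (positive⁻¹ 1ℚ))

∣-∣-sym : ∀ p q → ∣ p - q ∣ ≡ ∣ q - p ∣
∣-∣-sym p q = trans (sym (∣-p∣≡∣p∣ (p - q))) (cong ∣_∣ (eq p q))
  where
  eq : ∀ a b → - (a - b) ≡ b - a
  eq = solve-∀ ℚ-ring

∣-∣-< : ∀ {p q ε} → p - q < ε → q - p < ε → ∣ p - q ∣ < ε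
∣-∣-< {p} {q} {ε} p-q<ε q-p<ε = pick (∣p∣≡p∨∣p∣≡-p (p - q))
  where
  eq : ∀ a b → - (a - b) ≡ b - a
  eq = solve-∀ ℚ-ring
  pick : ∣ p - q ∣ ≡ p - q ⊎ ∣ p - q ∣ ≡ - (p - q) → ∣ p - q ∣ < ε
  pick (inj₁ e) = subst (_< ε) (sym e) p-q<ε
  pick (inj₂ e) = subst (_< ε) (sym (trans e (eq p q))) q-p<ε

------------------------------------------------------------------------

record IsCauchy (x : ℕ → ℚ) : Set where
  constructor mkCauchy
  field
    close : ∀ ε → 0ℚ < ε → ∃[ N ] ∀ m n → N ℕ.≤ m → N ℕ.≤ n → ∣ x m - x n ∣ < ε
open IsCauchy

module _ {b x y z : ℕ → ℚ} (N₀ : ℕ) {C : ℚ} (0<C : 0ℚ < C)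
  (dom : ∀ m n → N₀ ℕ.≤ m → m ℕ.≤ n →
         ∣ b m - b n ∣ ≤ C * (∣ x m - x n ∣ + ∣ y m - y n ∣ + ∣ z m - z n ∣)) where

  dominated : IsCauchy x → IsCauchy y → IsCauchy z → IsCauchy b
  dominated (mkCauchy cx) (mkCauchy cy) (mkCauchy cz) = mkCauchy λ ε 0<ε →
    N ε 0<ε , λ m n N≤m N≤n → split ε 0<ε m n N≤m N≤n (ℕ.≤-total m n)
    where
    module _ (ε : ℚ) (0<ε : 0ℚ < ε) where
      D = proj₁ (posInverse 0<C)
      0<D = proj₁ (proj₂ (posInverse 0<C))
      δ = + 1 / 3 * (D * ε)
      0<δ : 0ℚ < δ
      0<δ = *-pos (positive⁻¹ (+ 1 / 3)) (*-pos 0<D 0<ε)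
      N₁ = proj₁ (cx δ 0<δ)
      N₂ = proj₁ (cy δ 0<δ)
      N₃ = proj₁ (cz δ 0<δ)
      N = N₀ ℕ.⊔ (N₁ ℕ.⊔ (N₂ ℕ.⊔ N₃))
      N₀≤N = ℕ.m≤m⊔n N₀ (N₁ ℕ.⊔ (N₂ ℕ.⊔ N₃))
      N₁≤N = ℕ.≤-trans (ℕ.m≤m⊔n N₁ (N₂ ℕ.⊔ N₃)) (ℕ.m≤n⊔m N₀ _)
      N₂₃≤N = ℕ.≤-trans (ℕ.m≤n⊔m N₁ (N₂ ℕ.⊔ N₃)) (ℕ.m≤n⊔m N₀ _)
      N₂≤N = ℕ.≤-trans (ℕ.m≤m⊔n N₂ N₃) N₂₃≤N
      N₃≤N = ℕ.≤-trans (ℕ.m≤n⊔m N₂ N₃) N₂₃≤N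
      eq : ∀ c d e → c * (+ 1 / 3 * (d * e) + + 1 / 3 * (d * e) + + 1 / 3 * (d * e)) ≡ (c * d) * e
      eq = solve-∀ ℚ-ring
      Cδ≡ε : C * (δ + δ + δ) ≡ ε
      Cδ≡ε = trans (eq C D ε) (trans (cong (_* ε) (proj₂ (proj₂ (posInverse 0<C)))) (*-identityˡ ε))
      open ≤-Reasoning
      go : ∀ m n → N ℕ.≤ m → m ℕ.≤ n → ∣ b m - b n ∣ < ε
      go m n N≤m m≤n = begin-strict
        ∣ b m - b n ∣ ≤⟨ dom m n (ℕ.≤-trans N₀≤N N≤m) m≤n ⟩
        C * (∣ x m - x n ∣ + ∣ y m - y n ∣ + ∣ z m - z n ∣)
          <⟨ *-mono-<ˡ 0<C (+-mono-< (+-mono-<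
               (proj₂ (cx δ 0<δ) m n (ℕ.≤-trans N₁≤N N≤m) (ℕ.≤-trans N₁≤N N≤n))
               (proj₂ (cy δ 0<δ) m n (ℕ.≤-trans N₂≤N N≤m) (ℕ.≤-trans N₂≤N N≤n)))
               (proj₂ (cz δ 0<δ) m n (ℕ.≤-trans N₃≤N N≤m) (ℕ.≤-trans N₃≤N N≤n))) ⟩
        C * (δ + δ + δ) ≡⟨ Cδ≡ε ⟩
        ε ∎
        where N≤n = ℕ.≤-trans N≤m m≤n
      split : ∀ m n → N ℕ.≤ m → N ℕ.≤ n → m ℕ.≤ n ⊎ n ℕ.≤ m → ∣ b m - b n ∣ < ε
      split m n N≤m N≤n (inj₁ m≤n) = go m n N≤m m≤n
      split m n N≤m N≤n (inj₂ n≤m) = subst (_< ε) (∣-∣-sym (b n) (b m)) (go n m N≤n n≤m)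

abstract
  const-cauchy : ∀ q → IsCauchy (λ _ → q)
  const-cauchy q = mkCauchy λ ε 0<ε → 0 , λ _ _ _ _ → subst (_< ε) (sym (cong ∣_∣ (+-inverseʳ q))) 0<ε

bounded : ∀ {x} → IsCauchy x → ∃[ B ] 0ℚ ≤ B × (∃[ N ] ∀ n → N ℕ.≤ n → ∣ x n ∣ ≤ B)
bounded {x} cx = ∣ x N ∣ + 1ℚ , +-nonNeg (0≤∣p∣ (x N)) (nonNegative⁻¹ 1ℚ) , N , λ n N≤n → begin
  ∣ x n ∣                     ≡⟨ cong ∣_∣ (eq (x n) (x N)) ⟩
  ∣ x N + (x n - x N) ∣       ≤⟨ ∣p+q∣≤∣p∣+∣q∣ (x N) (x n - x N) ⟩
  ∣ x N ∣ + ∣ x n - x N ∣     ≤⟨ +-monoʳ-≤ ∣ x N ∣ (<⇒≤ (x-close n N N≤n ℕ.≤-refl)) ⟩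
  ∣ x N ∣ + 1ℚ                ∎
  where
  open ≤-Reasoning
  N = proj₁ (close cx 1ℚ (positive⁻¹ 1ℚ))
  x-close = proj₂ (close cx 1ℚ (positive⁻¹ 1ℚ))
  eq : ∀ a b → a ≡ b + (a - b)
  eq = solve-∀ ℚ-ring

abstract
  +-cauchy : ∀ {x y} → IsCauchy x → IsCauchy y → IsCauchy (λ n → x n + y n)
  +-cauchy {x} {y} cx cy = dominated 0 (positive⁻¹ 1ℚ) (λ m n _ _ → dom m n) cx cy (const-cauchy 0ℚ)
    where
    open ≤-Reasoning
    eq : ∀ a b c d → (a + b) - (c + d) ≡ (a - c) + (b - d)
    eq = solve-∀ ℚ-ring
    eq′ : ∀ u v → 1ℚ * (u + v + 0ℚ) ≡ u + v
    eq′ = solve-∀ ℚ-ring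
    dom : ∀ m n → ∣ (x m + y m) - (x n + y n) ∣ ≤ 1ℚ * (∣ x m - x n ∣ + ∣ y m - y n ∣ + 0ℚ)
    dom m n = begin
      ∣ (x m + y m) - (x n + y n) ∣   ≡⟨ cong ∣_∣ (eq (x m) (y m) (x n) (y n)) ⟩
      ∣ (x m - x n) + (y m - y n) ∣   ≤⟨ ∣p+q∣≤∣p∣+∣q∣ (x m - x n) (y m - y n) ⟩
      ∣ x m - x n ∣ + ∣ y m - y n ∣   ≡⟨ eq′ ∣ x m - x n ∣ ∣ y m - y n ∣ ⟨
      1ℚ * (∣ x m - x n ∣ + ∣ y m - y n ∣ + 0ℚ) ∎

  neg-cauchy : ∀ {x} → IsCauchy x → IsCauchy (λ n → - x n)
  neg-cauchy {x} cx = mkCauchy λ ε 0<ε → proj₁ (close cx ε 0<ε) , λ m n N≤m N≤n → subst (_< ε)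
      (sym (trans (cong ∣_∣ (eq (x m) (x n))) (∣-p∣≡∣p∣ (x m - x n))))
      (proj₂ (close cx ε 0<ε) m n N≤m N≤n)
    where
    eq : ∀ a b → - a - - b ≡ - (a - b)
    eq = solve-∀ ℚ-ring

  *-cauchy : ∀ {x y} → IsCauchy x → IsCauchy y → IsCauchy (λ n → x n * y n)
  *-cauchy {x} {y} cx cy = dominated {z = λ _ → 0ℚ} (N ℕ.⊔ N′) {C} 0<C dom cx cy (const-cauchy 0ℚ)
    where
    B B′ C : ℚ
    B  = proj₁ (bounded cx)
    B′ = proj₁ (bounded cy)
    C  = B + B′ + 1ℚ
    0≤B : 0ℚ ≤ B
    0≤B = proj₁ (proj₂ (bounded cx))
    0≤B′ : 0ℚ ≤ B′
    0≤B′ = proj₁ (proj₂ (bounded cy))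
    N N′ : ℕ
    N  = proj₁ (proj₂ (proj₂ (bounded cx)))
    N′ = proj₁ (proj₂ (proj₂ (bounded cy)))
    x≤B : ∀ n → N ℕ.≤ n → ∣ x n ∣ ≤ B
    x≤B = proj₂ (proj₂ (proj₂ (bounded cx)))
    y≤B′ : ∀ n → N′ ℕ.≤ n → ∣ y n ∣ ≤ B′
    y≤B′ = proj₂ (proj₂ (proj₂ (bounded cy)))
    open ≤-Reasoning
    0<C : 0ℚ < C
    0<C = +-mono-≤-< (+-nonNeg 0≤B 0≤B′) (positive⁻¹ 1ℚ)
    B≤C : B ≤ C
    B≤C = ≤-trans (p≤p+q 0≤B′) (p≤p+q (nonNegative⁻¹ 1ℚ))
    B′≤C : B′ ≤ C
    B′≤C = ≤-trans (p≤q+p 0≤B) (p≤p+q (nonNegative⁻¹ 1ℚ))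
    eq : ∀ a b c d → a * b - c * d ≡ a * (b - d) + (a - c) * d
    eq = solve-∀ ℚ-ring
    eq′ : ∀ c u v → c * v + u * c ≡ c * (u + v + 0ℚ)
    eq′ = solve-∀ ℚ-ring
    dom : ∀ m n → N ℕ.⊔ N′ ℕ.≤ m → m ℕ.≤ n →
          ∣ x m * y m - x n * y n ∣ ≤ C * (∣ x m - x n ∣ + ∣ y m - y n ∣ + ∣ 0ℚ - 0ℚ ∣)
    dom m n N≤m m≤n = begin
      ∣ x m * y m - x n * y n ∣
        ≡⟨ cong ∣_∣ (eq (x m) (y m) (x n) (y n)) ⟩
      ∣ x m * (y m - y n) + (x m - x n) * y n ∣
        ≤⟨ ∣p+q∣≤∣p∣+∣q∣ (x m * (y m - y n)) ((x m - x n) * y n) ⟩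
      ∣ x m * (y m - y n) ∣ + ∣ (x m - x n) * y n ∣
        ≡⟨ cong₂ _+_ (∣p*q∣≡∣p∣*∣q∣ (x m) (y m - y n)) (∣p*q∣≡∣p∣*∣q∣ (x m - x n) (y n)) ⟩
      ∣ x m ∣ * ∣ y m - y n ∣ + ∣ x m - x n ∣ * ∣ y n ∣
        ≤⟨ +-mono-≤
             (*-monoʳ (0≤∣p∣ (y m - y n)) (≤-trans (x≤B m (ℕ.≤-trans (ℕ.m≤m⊔n N N′) N≤m)) B≤C))
             (*-monoˡ (0≤∣p∣ (x m - x n))
               (≤-trans (y≤B′ n (ℕ.≤-trans (ℕ.m≤n⊔m N N′) (ℕ.≤-trans N≤m m≤n))) B′≤C)) ⟩
      C * ∣ y m - y n ∣ + ∣ x m - x n ∣ * C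
        ≡⟨ eq′ C ∣ x m - x n ∣ ∣ y m - y n ∣ ⟩
      C * (∣ x m - x n ∣ + ∣ y m - y n ∣ + 0ℚ) ∎

-- Real numbers are Cauchy sequences of rationals, identified up to _≈ᴿ_.
record ℝ : Set where
  constructor mkℝ
  field
    seq    : ℕ → ℚ
    cauchy : IsCauchy seq
open ℝ public

fromℚ : ℚ → ℝ
fromℚ q = mkℝ (λ _ → q) (const-cauchy q)

infixl 6 _+ᴿ_
infixl 7 _*ᴿ_
infix  8 -ᴿ_
infix  4 _≈ᴿ_ _<ᴿ_

record _≈ᴿ_ (x y : ℝ) : Set where
  constructor mk≈
  field
    close : ∀ ε → 0ℚ < ε → ∃[ N ] ∀ n → N ℕ.≤ n → ∣ seq x n - seq y n ∣ < ε

record _<ᴿ_ (x y : ℝ) : Set where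
  constructor mk<
  field
    gap     : ℚ
    gap-pos : 0ℚ < gap
    from    : ℕ
    apart   : ∀ n → from ℕ.≤ n → gap ≤ seq y n - seq x n

_+ᴿ_ : ℝ → ℝ → ℝ
x +ᴿ y = mkℝ (λ n → seq x n + seq y n) (+-cauchy (cauchy x) (cauchy y))

-ᴿ_ : ℝ → ℝ
-ᴿ x = mkℝ (λ n → - seq x n) (neg-cauchy (cauchy x))

_*ᴿ_ : ℝ → ℝ → ℝ
x *ᴿ y = mkℝ (λ n → seq x n * seq y n) (*-cauchy (cauchy x) (cauchy y))

0ᴿ 1ᴿ : ℝ
0ᴿ = fromℚ 0ℚ
1ᴿ = fromℚ 1ℚ

ℝ-rawRing : RawRing 0ℓ 0ℓ
ℝ-rawRing = record
  { Carrier = ℝ ; _≈_ = _≈ᴿ_ ; _+_ = _+ᴿ_ ; _*_ = _*ᴿ_ ; -_ = -ᴿ_ ; 0# = 0ᴿ ; 1# = 1ᴿ }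

abstract
  recip-cauchy : ∀ {x y ε} → 0ℚ < ε → (∀ n → ε ≤ x n) → (∀ n → 0ℚ < y n) →
                 (∀ n → x n * y n ≡ 1ℚ) → IsCauchy x → IsCauchy y
  recip-cauchy {x} {y} {ε} 0<ε ε≤x 0<y xy≡1 cx =
    dominated {y = λ _ → 0ℚ} {z = λ _ → 0ℚ} 0 {D * D} (*-pos 0<D 0<D) (λ m n _ _ → dom m n)
      cx (const-cauchy 0ℚ) (const-cauchy 0ℚ)
    where
    D : ℚ
    D = proj₁ (posInverse 0<ε)
    0<D : 0ℚ < D
    0<D = proj₁ (proj₂ (posInverse 0<ε))
    εD≡1 : ε * D ≡ 1ℚ
    εD≡1 = proj₂ (proj₂ (posInverse 0<ε))
    open ≤-Reasoning
    swap : ∀ a b c → a * b * c ≡ a * c * b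
    swap = solve-∀ ℚ-ring
    y≤D : ∀ n → y n ≤ D
    y≤D n = begin
      y n            ≡⟨ *-identityˡ (y n) ⟨
      1ℚ * y n       ≡⟨ cong (_* y n) εD≡1 ⟨
      ε * D * y n    ≤⟨ *-monoʳ (<⇒≤ (0<y n)) (*-monoʳ (<⇒≤ 0<D) (ε≤x n)) ⟩
      x n * D * y n  ≡⟨ swap (x n) D (y n) ⟩
      x n * y n * D  ≡⟨ cong (_* D) (xy≡1 n) ⟩
      1ℚ * D         ≡⟨ *-identityˡ D ⟩
      D              ∎
    eq : ∀ a b a′ b′ → b * (a′ * b′) - b′ * (a * b) ≡ - (a - a′) * (b * b′)
    eq = solve-∀ ℚ-ring
    y-diff : ∀ m n → y m - y n ≡ - (x m - x n) * (y m * y n)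
    y-diff m n = begin-equality
      y m - y n                                  ≡⟨ cong₂ _-_ (*-identityʳ (y m)) (*-identityʳ (y n)) ⟨
      y m * 1ℚ - y n * 1ℚ                        ≡⟨ cong₂ (λ p q → y m * p - y n * q) (xy≡1 n) (xy≡1 m) ⟨
      y m * (x n * y n) - y n * (x m * y m)      ≡⟨ eq (x m) (y m) (x n) (y n) ⟩
      - (x m - x n) * (y m * y n)                ∎
    pad : ∀ u c → u * c ≡ c * (u + 0ℚ + 0ℚ)
    pad = solve-∀ ℚ-ring
    dom : ∀ m n → ∣ y m - y n ∣ ≤ (D * D) * (∣ x m - x n ∣ + 0ℚ + 0ℚ)
    dom m n = begin
      ∣ y m - y n ∣                      ≡⟨ cong ∣_∣ (y-diff m n) ⟩
      ∣ - (x m - x n) * (y m * y n) ∣    ≡⟨ ∣p*q∣≡∣p∣*∣q∣ (- (x m - x n)) (y m * y n) ⟩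
      ∣ - (x m - x n) ∣ * ∣ y m * y n ∣  ≡⟨ cong₂ _*_ (∣-p∣≡∣p∣ (x m - x n))
                                              (0≤p⇒∣p∣≡p (*-nonNeg (<⇒≤ (0<y m)) (<⇒≤ (0<y n)))) ⟩
      ∣ x m - x n ∣ * (y m * y n)        ≤⟨ *-monoˡ (0≤∣p∣ (x m - x n))
                                              (*-mono (<⇒≤ (0<y n)) (<⇒≤ 0<D) (y≤D m) (y≤D n)) ⟩
      ∣ x m - x n ∣ * (D * D)            ≡⟨ pad ∣ x m - x n ∣ (D * D) ⟩
      (D * D) * (∣ x m - x n ∣ + 0ℚ + 0ℚ) ∎

  shift-cauchy : ∀ {x} N → IsCauchy x → IsCauchy (λ n → x (N ℕ.+ n))
  shift-cauchy N cx = mkCauchy λ ε 0<ε → proj₁ (close cx ε 0<ε) , λ m n M≤m M≤n →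
    proj₂ (close cx ε 0<ε) (N ℕ.+ m) (N ℕ.+ n) (ℕ.≤-trans M≤m (ℕ.m≤n+m m N)) (ℕ.≤-trans M≤n (ℕ.m≤n+m n N))

-- The terms x₀ … x_{N-1} before the gap of 0 < x takes effect are skipped,
-- since they may vanish.
recip : (x : ℝ) → 0ᴿ <ᴿ x → ℝ
recip x (mk< ε 0<ε N ε≤x) = mkℝ (λ n → (1/ x′ n) {{>-nonZero (0<x′ n)}})
  (recip-cauchy 0<ε ε≤x′ (λ n → positive⁻¹ _ {{1/pos⇒pos (x′ n) {{positive (0<x′ n)}}}})
    (λ n → *-inverseʳ (x′ n) {{>-nonZero (0<x′ n)}}) (shift-cauchy N (cauchy x)))
  where
  x′ : ℕ → ℚ
  x′ n = seq x (N ℕ.+ n)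
  ε≤x′ : ∀ n → ε ≤ x′ n
  ε≤x′ n = subst (ε ≤_) (+-identityʳ (x′ n)) (ε≤x (N ℕ.+ n) (ℕ.m≤m+n N n))
  0<x′ : ∀ n → 0ℚ < x′ n
  0<x′ n = <-≤-trans 0<ε (ε≤x′ n)

-- ⌊√n⌋
isqrt : ℕ → ℕ
isqrt zero = 0
isqrt (suc n) with suc (isqrt n) ℕ.* suc (isqrt n) ℕ.≤? suc n
... | yes _ = suc (isqrt n)
... | no  _ = isqrt n

isqrt-≤ : ∀ n → isqrt n ℕ.* isqrt n ℕ.≤ n
isqrt-≤ zero = ℕ.z≤n
isqrt-≤ (suc n) with suc (isqrt n) ℕ.* suc (isqrt n) ℕ.≤? suc n
... | yes p = p
... | no  _ = ℕ.m≤n⇒m≤1+n (isqrt-≤ n)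

isqrt-> : ∀ n → n ℕ.< suc (isqrt n) ℕ.* suc (isqrt n)
isqrt-> zero = ℕ.s≤s ℕ.z≤n
isqrt-> (suc n) with suc (isqrt n) ℕ.* suc (isqrt n) ℕ.≤? suc n
... | no  p = ℕ.≰⇒> p
... | yes _ = ℕ.<-≤-trans (ℕ.s≤s (isqrt-> n)) (ℕ.*-mono-< {suc (isqrt n)} {suc (suc (isqrt n))} ℕ.≤-refl ℕ.≤-refl)

square-cancel-< : ∀ {m n} → m ℕ.* m ℕ.< n ℕ.* n → m ℕ.< n
square-cancel-< {m} {n} m²<n² with n ℕ.≤? m
... | yes n≤m = ⊥-elim (ℕ.<⇒≱ m²<n² (ℕ.*-mono-≤ n≤m n≤m))
... | no  n≰m = ℕ.≰⇒> n≰m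

-- ⌊(n + 1) √a⌋
√-approx : ℕ → ℕ → ℕ
√-approx a n = isqrt (a ℕ.* (suc n ℕ.* suc n))

√-approx-close : ∀ a m n → √-approx a m ℕ.* suc n ℕ.≤ suc (√-approx a n) ℕ.* suc m
√-approx-close a m n = ℕ.<⇒≤ (square-cancel-< (begin-strict
  (s ℕ.* k) ℕ.* (s ℕ.* k)             ≡⟨ eq s k ⟩
  (s ℕ.* s) ℕ.* (k ℕ.* k)             ≤⟨ ℕ.*-monoˡ-≤ (k ℕ.* k) (isqrt-≤ (a ℕ.* (j ℕ.* j))) ⟩
  (a ℕ.* (j ℕ.* j)) ℕ.* (k ℕ.* k)     ≡⟨ eq′ a (j ℕ.* j) (k ℕ.* k) ⟩
  (a ℕ.* (k ℕ.* k)) ℕ.* (j ℕ.* j)     <⟨ ℕ.*-monoˡ-< (j ℕ.* j) (isqrt-> (a ℕ.* (k ℕ.* k))) ⟩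
  (suc t ℕ.* suc t) ℕ.* (j ℕ.* j)     ≡⟨ eq (suc t) j ⟨
  (suc t ℕ.* j) ℕ.* (suc t ℕ.* j)     ∎))
  where
  open ℕ.≤-Reasoning
  s = √-approx a m
  t = √-approx a n
  j = suc m
  k = suc n
  eq : ∀ b c → (b ℕ.* c) ℕ.* (b ℕ.* c) ≡ (b ℕ.* b) ℕ.* (c ℕ.* c)
  eq b c = ℕ.[m*n]*[o*p]≡[m*o]*[n*p] b c b c
  eq′ : ∀ b c d → (b ℕ.* c) ℕ.* d ≡ (b ℕ.* d) ℕ.* c
  eq′ b c d = trans (ℕ.*-assoc b c d) (trans (cong (b ℕ.*_) (ℕ.*-comm c d)) (sym (ℕ.*-assoc b d c)))

fromℕ-* : ∀ m n → fromℕ (m ℕ.* n) ≡ fromℕ m * fromℕ n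
fromℕ-* zero n = sym (*-zeroˡ (fromℕ n))
fromℕ-* (suc m) n = begin
  fromℕ (n ℕ.+ m ℕ.* n)        ≡⟨ fromℕ-+ n (m ℕ.* n) ⟩
  fromℕ n + fromℕ (m ℕ.* n)    ≡⟨ cong (λ q → fromℕ n + q) (fromℕ-* m n) ⟩
  fromℕ n + fromℕ m * fromℕ n  ≡⟨ eq (fromℕ m) (fromℕ n) ⟩
  (fromℕ m + 1ℚ) * fromℕ n     ≡⟨ cong (_* fromℕ n) (fromℕ-suc m) ⟨
  fromℕ (suc m) * fromℕ n      ∎
  where
  open ≡-Reasoning
  eq : ∀ a b → b + a * b ≡ (a + 1ℚ) * b
  eq = solve-∀ ℚ-ring
  fromℕ-+ : ∀ j k → fromℕ (j ℕ.+ k) ≡ fromℕ j + fromℕ k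
  fromℕ-+ zero k = sym (+-identityˡ (fromℕ k))
  fromℕ-+ (suc j) k = begin
    fromℕ (suc (j ℕ.+ k))     ≡⟨ fromℕ-suc (j ℕ.+ k) ⟩
    fromℕ (j ℕ.+ k) + 1ℚ      ≡⟨ cong (_+ 1ℚ) (fromℕ-+ j k) ⟩
    fromℕ j + fromℕ k + 1ℚ    ≡⟨ eq₁ (fromℕ j) (fromℕ k) ⟩
    fromℕ j + 1ℚ + fromℕ k    ≡⟨ cong (_+ fromℕ k) (fromℕ-suc j) ⟨
    fromℕ (suc j) + fromℕ k   ∎
    where
    eq₁ : ∀ a b → a + b + 1ℚ ≡ a + 1ℚ + b
    eq₁ = solve-∀ ℚ-ring

module _ (a : ℕ) where
  private
    s : ℕ → ℚ
    s n = + √-approx a n / suc n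

    open ≤-Reasoning
    s≤ : ∀ m n → s m ≤ s n + suc⁻¹ n
    s≤ m n = begin
      s m                                           ≡⟨ /-split (√-approx a m) m ⟩
      fromℕ u * suc⁻¹ m                                 ≡⟨ *-identityʳ (fromℕ u * suc⁻¹ m) ⟨
      fromℕ u * suc⁻¹ m * 1ℚ                            ≡⟨ cong (fromℕ u * suc⁻¹ m *_) (suc⁻¹-inverse n) ⟨
      fromℕ u * suc⁻¹ m * (suc⁻¹ n * fromℕ (suc n))         ≡⟨ eq (fromℕ u) (suc⁻¹ m) (suc⁻¹ n) (fromℕ (suc n)) ⟩
      fromℕ u * fromℕ (suc n) * (suc⁻¹ m * suc⁻¹ n)         ≡⟨ cong (_* (suc⁻¹ m * suc⁻¹ n)) (fromℕ-* u (suc n)) ⟨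
      fromℕ (u ℕ.* suc n) * (suc⁻¹ m * suc⁻¹ n)
        ≤⟨ *-monoʳ (<⇒≤ (*-pos (suc⁻¹-pos m) (suc⁻¹-pos n))) (fromℕ-mono (√-approx-close a m n)) ⟩
      fromℕ (suc v ℕ.* suc m) * (suc⁻¹ m * suc⁻¹ n)         ≡⟨ cong (_* (suc⁻¹ m * suc⁻¹ n)) (fromℕ-* (suc v) (suc m)) ⟩
      fromℕ (suc v) * fromℕ (suc m) * (suc⁻¹ m * suc⁻¹ n)   ≡⟨ eq′ (fromℕ (suc v)) (fromℕ (suc m)) (suc⁻¹ m) (suc⁻¹ n) ⟩
      suc⁻¹ m * fromℕ (suc m) * (fromℕ (suc v) * suc⁻¹ n)   ≡⟨ cong₂ (λ p q → p * (q * suc⁻¹ n)) (suc⁻¹-inverse m) (fromℕ-suc v) ⟩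
      1ℚ * ((fromℕ v + 1ℚ) * suc⁻¹ n)                   ≡⟨ eq″ (fromℕ v) (suc⁻¹ n) ⟩
      fromℕ v * suc⁻¹ n + suc⁻¹ n                           ≡⟨ cong (_+ suc⁻¹ n) (/-split (√-approx a n) n) ⟨
      s n + suc⁻¹ n                                     ∎
      where
      u = √-approx a m
      v = √-approx a n
      eq : ∀ a b c d → a * b * (c * d) ≡ a * d * (b * c)
      eq = solve-∀ ℚ-ring
      eq′ : ∀ a b c d → a * b * (c * d) ≡ c * b * (a * d)
      eq′ = solve-∀ ℚ-ring
      eq″ : ∀ a b → 1ℚ * ((a + 1ℚ) * b) ≡ a * b + b
      eq″ = solve-∀ ℚ-ring

  abstract
    √-cauchy : IsCauchy s
    √-cauchy = mkCauchy λ ε 0<ε → N ε 0<ε , λ m n N≤m N≤n →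
        ∣-∣-< {s m} {s n} (less ε 0<ε m n N≤n) (less ε 0<ε n m N≤m)
      where
      module _ (ε : ℚ) (0<ε : 0ℚ < ε) where
        N = proj₁ (archimedean-< 0<ε 1ℚ)
        1<Nε = proj₂ (archimedean-< 0<ε 1ℚ)
        small : ∀ n → N ℕ.≤ n → suc⁻¹ n < ε
        small n N≤n = begin-strict
          suc⁻¹ n                        ≡⟨ *-identityʳ (suc⁻¹ n) ⟨
          suc⁻¹ n * 1ℚ                   <⟨ *-mono-<ˡ (suc⁻¹-pos n) 1<Nε ⟩
          suc⁻¹ n * (fromℕ (suc N) * ε)  ≤⟨ *-monoˡ (<⇒≤ (suc⁻¹-pos n)) (*-monoʳ (<⇒≤ 0<ε) (fromℕ-mono (ℕ.s≤s N≤n))) ⟩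
          suc⁻¹ n * (fromℕ (suc n) * ε)  ≡⟨ *-assoc (suc⁻¹ n) (fromℕ (suc n)) ε ⟨
          suc⁻¹ n * fromℕ (suc n) * ε    ≡⟨ cong (_* ε) (suc⁻¹-inverse n) ⟩
          1ℚ * ε                     ≡⟨ *-identityˡ ε ⟩
          ε                          ∎
        less : ∀ m n → N ℕ.≤ n → s m - s n < ε
        less m n N≤n = begin-strict
          s m - s n         ≤⟨ +-monoˡ-≤ (- s n) (s≤ m n) ⟩
          s n + suc⁻¹ n - s n   ≡⟨ eq (s n) (suc⁻¹ n) ⟩
          suc⁻¹ n               <⟨ small n N≤n ⟩
          ε                 ∎
          where
          eq : ∀ a b → a + b - a ≡ b
          eq = solve-∀ ℚ-ring

  √ : ℝ
  √ = mkℝ s √-cauchy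

√-pos : ∀ a → 0ᴿ <ᴿ √ (suc a)
√-pos a = mk< 1ℚ (positive⁻¹ 1ℚ) 0 λ n _ → subst (1ℚ ≤_) (sym (+-identityʳ _)) (begin
  1ℚ                                  ≡⟨ suc⁻¹-inverse n ⟨
  suc⁻¹ n * fromℕ (suc n)                 ≤⟨ *-monoˡ (<⇒≤ (suc⁻¹-pos n)) (fromℕ-mono (1≤ n)) ⟩
  suc⁻¹ n * fromℕ (√-approx (suc a) n)    ≡⟨ *-comm (suc⁻¹ n) _ ⟩
  fromℕ (√-approx (suc a) n) * suc⁻¹ n    ≡⟨ /-split (√-approx (suc a) n) n ⟨
  + √-approx (suc a) n / suc n        ∎)
  where
  open ≤-Reasoning
  1≤ : ∀ n → suc n ℕ.≤ √-approx (suc a) n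
  1≤ n = ℕ.s≤s⁻¹ (square-cancel-< (ℕ.≤-<-trans (ℕ.m≤m+n (suc n ℕ.* suc n) _) (isqrt-> (suc a ℕ.* (suc n ℕ.* suc n)))))

module Complexification (R : RawRing 0ℓ 0ℓ) where
  private module R = RawRing R

  infix  5 _+i_
  infixl 6 _⊕_
  infixl 7 _⊗_
  infix  8 ⊖_
  infix  4 _≋_

  record Complex : Set where
    constructor _+i_
    field
      re im : R.Carrier
  open Complex public

  record _≋_ (z w : Complex) : Set where
    constructor _+i_
    field
      re-≈ : re z R.≈ re w
      im-≈ : im z R.≈ im w

  _⊕_ _⊗_ : Complex → Complex → Complex
  z ⊕ w = (re z R.+ re w) +i (im z R.+ im w)
  z ⊗ w = (re z R.* re w R.+ R.- (im z R.* im w)) +i (re z R.* im w R.+ im z R.* re w)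

  ⊖_ conj : Complex → Complex
  ⊖ z    = (R.- re z) +i (R.- im z)
  conj z = re z +i (R.- im z)

  fromReal : R.Carrier → Complex
  fromReal x = x +i R.0#

  𝕚 : Complex
  𝕚 = R.0# +i R.1#

  rawRing : RawRing 0ℓ 0ℓ
  rawRing = record
    { Carrier = Complex ; _≈_ = _≋_ ; _+_ = _⊕_ ; _*_ = _⊗_ ; -_ = ⊖_
    ; 0# = fromReal R.0# ; 1# = fromReal R.1# }

module ℚ[i] = Complexification +-*-rawRing

module Exponential where
  open ℚ[i]

  infixl 7 _•_
  _•_ : ℚ → Complex → Complex
  q • z = (q * re z) +i (q * im z)

  -- zᵏ / k!
  expTerm : Complex → ℕ → Complex
  expTerm z zero    = fromReal 1ℚ
  expTerm z (suc k) = suc⁻¹ k • (z ⊗ expTerm z k)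

  -- Σ_{k ≤ n} zᵏ / k!
  expSum : Complex → ℕ → Complex
  expSum z zero    = expTerm z zero
  expSum z (suc n) = expSum z n ⊕ expTerm z (suc n)

  ∥_∥ : Complex → ℚ
  ∥ z ∥ = ∣ re z ∣ + ∣ im z ∣

  ∥∥-nonNeg : ∀ z → 0ℚ ≤ ∥ z ∥
  ∥∥-nonNeg z = +-nonNeg (0≤∣p∣ (re z)) (0≤∣p∣ (im z))

  module _ where
    open ≤-Reasoning

    interchange : ∀ a b c d → (a + b) + (c + d) ≡ (a + c) + (b + d)
    interchange = solve-∀ ℚ-ring

    ∥∥-⊕ : ∀ z w → ∥ z ⊕ w ∥ ≤ ∥ z ∥ + ∥ w ∥
    ∥∥-⊕ (a +i b) (c +i d) = begin
      ∣ a + c ∣ + ∣ b + d ∣                  ≤⟨ +-mono-≤ (∣p+q∣≤∣p∣+∣q∣ a c) (∣p+q∣≤∣p∣+∣q∣ b d) ⟩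
      (∣ a ∣ + ∣ c ∣) + (∣ b ∣ + ∣ d ∣)      ≡⟨ interchange (∣ a ∣) (∣ c ∣) (∣ b ∣) (∣ d ∣) ⟩
      (∣ a ∣ + ∣ b ∣) + (∣ c ∣ + ∣ d ∣)      ∎

    ∥∥-⊗ : ∀ z w → ∥ z ⊗ w ∥ ≤ ∥ z ∥ * ∥ w ∥
    ∥∥-⊗ (a +i b) (c +i d) = begin
      ∣ a * c - b * d ∣ + ∣ a * d + b * c ∣
        ≤⟨ +-mono-≤ (∣p-q∣≤∣p∣+∣q∣ (a * c) (b * d)) (∣p+q∣≤∣p∣+∣q∣ (a * d) (b * c)) ⟩
      (∣ a * c ∣ + ∣ b * d ∣) + (∣ a * d ∣ + ∣ b * c ∣)
        ≡⟨ cong₂ _+_ (cong₂ _+_ (∣p*q∣≡∣p∣*∣q∣ a c) (∣p*q∣≡∣p∣*∣q∣ b d))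
                     (cong₂ _+_ (∣p*q∣≡∣p∣*∣q∣ a d) (∣p*q∣≡∣p∣*∣q∣ b c)) ⟩
      (∣ a ∣ * ∣ c ∣ + ∣ b ∣ * ∣ d ∣) + (∣ a ∣ * ∣ d ∣ + ∣ b ∣ * ∣ c ∣)
        ≡⟨ eq (∣ a ∣) (∣ b ∣) (∣ c ∣) (∣ d ∣) ⟩
      (∣ a ∣ + ∣ b ∣) * (∣ c ∣ + ∣ d ∣) ∎
      where
      eq : ∀ a b c d → (a * c + b * d) + (a * d + b * c) ≡ (a + b) * (c + d)
      eq = solve-∀ ℚ-ring

    ∥∥-• : ∀ {q} → 0ℚ ≤ q → ∀ z → ∥ q • z ∥ ≡ q * ∥ z ∥
    ∥∥-• {q} 0≤q (a +i b) = begin-equality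
      ∣ q * a ∣ + ∣ q * b ∣             ≡⟨ cong₂ _+_ (∣p*q∣≡∣p∣*∣q∣ q a) (∣p*q∣≡∣p∣*∣q∣ q b) ⟩
      ∣ q ∣ * ∣ a ∣ + ∣ q ∣ * ∣ b ∣     ≡⟨ *-distribˡ-+ (∣ q ∣) (∣ a ∣) (∣ b ∣) ⟨
      ∣ q ∣ * (∣ a ∣ + ∣ b ∣)           ≡⟨ cong (_* (∣ a ∣ + ∣ b ∣)) (0≤p⇒∣p∣≡p 0≤q) ⟩
      q * (∣ a ∣ + ∣ b ∣)               ∎

    ∥∥-cong : ∀ {a b c d} → a ≡ c → b ≡ d → ∥ a +i b ∥ ≡ ∥ c +i d ∥
    ∥∥-cong refl refl = refl

    ∥∥-self : ∀ z → ∥ z ⊕ ⊖ z ∥ ≡ 0ℚ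
    ∥∥-self (a +i b) = ∥∥-cong {a - a} {b - b} {0ℚ} {0ℚ} (+-inverseʳ a) (+-inverseʳ b)

  -- The real exponential series at B, dominating expSum on ∥ z ∥ ≤ B.
  module _ (B : ℚ) (0≤B : 0ℚ ≤ B) where
    open ≤-Reasoning

    t : ℕ → ℚ
    t zero    = 1ℚ
    t (suc k) = suc⁻¹ k * (B * t k)

    -- derivative of t
    t′ : ℕ → ℚ
    t′ zero    = 0ℚ
    t′ (suc k) = t k

    e : ℕ → ℚ
    e zero    = t zero
    e (suc n) = e n + t (suc n)

    t-nonNeg : ∀ k → 0ℚ ≤ t k
    t-nonNeg zero    = nonNegative⁻¹ 1ℚ
    t-nonNeg (suc k) = *-nonNeg (<⇒≤ (suc⁻¹-pos k)) (*-nonNeg 0≤B (t-nonNeg k))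

    e-mono : ∀ {m n} → m ℕ.≤′ n → e m ≤ e n
    e-mono ℕ.≤′-refl           = ≤-refl
    e-mono (ℕ.≤′-step {n} m≤n) = ≤-trans (e-mono m≤n) (p≤p+q (t-nonNeg (suc n)))

    expTerm-bound : ∀ z → ∥ z ∥ ≤ B → ∀ k → ∥ expTerm z k ∥ ≤ t k
    expTerm-bound z z≤B zero    = ≤-refl
    expTerm-bound z z≤B (suc k) = begin
      ∥ suc⁻¹ k • (z ⊗ expTerm z k) ∥      ≡⟨ ∥∥-• (<⇒≤ (suc⁻¹-pos k)) (z ⊗ expTerm z k) ⟩
      suc⁻¹ k * ∥ z ⊗ expTerm z k ∥        ≤⟨ *-monoˡ (<⇒≤ (suc⁻¹-pos k)) (≤-trans (∥∥-⊗ z (expTerm z k))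
                                            (*-mono (∥∥-nonNeg (expTerm z k)) 0≤B z≤B (expTerm-bound z z≤B k))) ⟩
      suc⁻¹ k * (B * t k)                  ∎

    expSum-tail : ∀ z → ∥ z ∥ ≤ B → ∀ {m n} → m ℕ.≤′ n → ∥ expSum z n ⊕ ⊖ expSum z m ∥ ≤ e n - e m
    expSum-tail z z≤B {m} ℕ.≤′-refl = ≤-reflexive (trans (∥∥-self (expSum z m)) (sym (+-inverseʳ (e m))))
    expSum-tail z z≤B {m} (ℕ.≤′-step {n} m≤n) = begin
      ∥ (expSum z n ⊕ expTerm z (suc n)) ⊕ ⊖ expSum z m ∥
        ≡⟨ ∥∥-cong (eq (re (expSum z n)) (re (expTerm z (suc n))) (re (expSum z m)))
                   (eq (im (expSum z n)) (im (expTerm z (suc n))) (im (expSum z m))) ⟩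
      ∥ (expSum z n ⊕ ⊖ expSum z m) ⊕ expTerm z (suc n) ∥
        ≤⟨ ∥∥-⊕ (expSum z n ⊕ ⊖ expSum z m) (expTerm z (suc n)) ⟩
      ∥ expSum z n ⊕ ⊖ expSum z m ∥ + ∥ expTerm z (suc n) ∥
        ≤⟨ +-mono-≤ (expSum-tail z z≤B m≤n) (expTerm-bound z z≤B (suc n)) ⟩
      (e n - e m) + t (suc n)
        ≡⟨ eq (e n) (t (suc n)) (e m) ⟨
      e (suc n) - e m ∎
      where
      eq : ∀ a b c → (a + b) - c ≡ (a - c) + b
      eq = solve-∀ ℚ-ring

    t-step : ∀ k → suc⁻¹ k * (B * t′ k + t k) ≡ t k
    t-step k = begin-equality
      suc⁻¹ k * (B * t′ k + t k)           ≡⟨ cong (λ q → suc⁻¹ k * (q + t k)) (derivative k) ⟩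
      suc⁻¹ k * (fromℕ k * t k + t k)      ≡⟨ eq (suc⁻¹ k) (fromℕ k) (t k) ⟩
      suc⁻¹ k * (fromℕ k + 1ℚ) * t k       ≡⟨ cong (λ q → suc⁻¹ k * q * t k) (fromℕ-suc k) ⟨
      suc⁻¹ k * fromℕ (suc k) * t k        ≡⟨ cong (_* t k) (suc⁻¹-inverse k) ⟩
      1ℚ * t k                         ≡⟨ *-identityˡ (t k) ⟩
      t k                              ∎
      where
      eq : ∀ a b c → a * (b * c + c) ≡ a * (b + 1ℚ) * c
      eq = solve-∀ ℚ-ring
      eq′ : ∀ a b c → b * (a * c) ≡ a * b * c
      eq′ = solve-∀ ℚ-ring
      derivative : ∀ k → B * t′ k ≡ fromℕ k * t k
      derivative zero    = trans (*-zeroʳ B) (sym (*-zeroˡ 1ℚ))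
      derivative (suc k) = begin-equality
        B * t k                                  ≡⟨ *-identityˡ (B * t k) ⟨
        1ℚ * (B * t k)                           ≡⟨ cong (_* (B * t k)) (suc⁻¹-inverse k) ⟨
        suc⁻¹ k * fromℕ (suc k) * (B * t k)          ≡⟨ eq′ (suc⁻¹ k) (fromℕ (suc k)) (B * t k) ⟨
        fromℕ (suc k) * (suc⁻¹ k * (B * t k))        ∎

    module _ (z w : Complex) (z≤B : ∥ z ∥ ≤ B) (w≤B : ∥ w ∥ ≤ B) where
      δ : ℚ
      δ = ∥ z ⊕ ⊖ w ∥

      expTerm-lipschitz : ∀ k → ∥ expTerm z k ⊕ ⊖ expTerm w k ∥ ≤ δ * t′ k
      expTerm-lipschitz zero    = ≤-reflexive (trans (∥∥-self (fromReal 1ℚ)) (sym (*-zeroʳ δ)))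
      expTerm-lipschitz (suc k) = begin
        ∥ suc⁻¹ k • (z ⊗ T) ⊕ ⊖ (suc⁻¹ k • (w ⊗ U)) ∥
          ≡⟨ ∥∥-cong (eq-re (suc⁻¹ k) (re z) (im z) (re w) (im w) (re T) (im T) (re U) (im U))
                     (eq-im (suc⁻¹ k) (re z) (im z) (re w) (im w) (re T) (im T) (re U) (im U)) ⟩
        ∥ suc⁻¹ k • (z ⊗ (T ⊕ ⊖ U) ⊕ (z ⊕ ⊖ w) ⊗ U) ∥
          ≡⟨ ∥∥-• (<⇒≤ (suc⁻¹-pos k)) (z ⊗ (T ⊕ ⊖ U) ⊕ (z ⊕ ⊖ w) ⊗ U) ⟩
        suc⁻¹ k * ∥ z ⊗ (T ⊕ ⊖ U) ⊕ (z ⊕ ⊖ w) ⊗ U ∥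
          ≤⟨ *-monoˡ (<⇒≤ (suc⁻¹-pos k)) (≤-trans (∥∥-⊕ (z ⊗ (T ⊕ ⊖ U)) ((z ⊕ ⊖ w) ⊗ U))
               (+-mono-≤ (∥∥-⊗ z (T ⊕ ⊖ U)) (∥∥-⊗ (z ⊕ ⊖ w) U))) ⟩
        suc⁻¹ k * (∥ z ∥ * ∥ T ⊕ ⊖ U ∥ + δ * ∥ U ∥)
          ≤⟨ *-monoˡ (<⇒≤ (suc⁻¹-pos k)) (+-mono-≤
               (*-mono (∥∥-nonNeg (T ⊕ ⊖ U)) 0≤B z≤B (expTerm-lipschitz k))
               (*-monoˡ (∥∥-nonNeg (z ⊕ ⊖ w)) (expTerm-bound w w≤B k))) ⟩
        suc⁻¹ k * (B * (δ * t′ k) + δ * t k)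
          ≡⟨ eq (suc⁻¹ k) B δ (t′ k) (t k) ⟩
        δ * (suc⁻¹ k * (B * t′ k + t k))
          ≡⟨ cong (δ *_) (t-step k) ⟩
        δ * t k ∎
        where
        T = expTerm z k
        U = expTerm w k
        eq : ∀ c b d x y → c * (b * (d * x) + d * y) ≡ d * (c * (b * x + y))
        eq = solve-∀ ℚ-ring
        eq-re : ∀ c z₁ z₂ w₁ w₂ t₁ t₂ u₁ u₂ →
          c * (z₁ * t₁ + - (z₂ * t₂)) + - (c * (w₁ * u₁ + - (w₂ * u₂))) ≡
          c * ((z₁ * (t₁ + - u₁) + - (z₂ * (t₂ + - u₂))) + ((z₁ + - w₁) * u₁ + - ((z₂ + - w₂) * u₂)))
        eq-re = solve-∀ ℚ-ring
        eq-im : ∀ c z₁ z₂ w₁ w₂ t₁ t₂ u₁ u₂ →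
          c * (z₁ * t₂ + z₂ * t₁) + - (c * (w₁ * u₂ + w₂ * u₁)) ≡
          c * ((z₁ * (t₂ + - u₂) + z₂ * (t₁ + - u₁)) + ((z₁ + - w₁) * u₂ + (z₂ + - w₂) * u₁))
        eq-im = solve-∀ ℚ-ring

      expSum-lipschitz : ∀ n → ∥ expSum z n ⊕ ⊖ expSum w n ∥ ≤ δ * e n
      expSum-lipschitz n = ≤-trans (sharp n) (*-monoˡ (∥∥-nonNeg (z ⊕ ⊖ w)) (e′≤e n))
        where
        e′ : ℕ → ℚ
        e′ zero    = 0ℚ
        e′ (suc n) = e′ n + t n
        e≡ : ∀ n → e n ≡ e′ n + t n
        e≡ zero    = sym (+-identityˡ 1ℚ)
        e≡ (suc n) = cong (_+ t (suc n)) (e≡ n)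
        e′≤e : ∀ n → e′ n ≤ e n
        e′≤e n = subst (e′ n ≤_) (sym (e≡ n)) (p≤p+q (t-nonNeg n))
        eq : ∀ a b c d → (a + b) + - (c + d) ≡ (a + - c) + (b + - d)
        eq = solve-∀ ℚ-ring
        sharp : ∀ n → ∥ expSum z n ⊕ ⊖ expSum w n ∥ ≤ δ * e′ n
        sharp zero    = expTerm-lipschitz zero
        sharp (suc n) = begin
          ∥ (expSum z n ⊕ expTerm z (suc n)) ⊕ ⊖ (expSum w n ⊕ expTerm w (suc n)) ∥
            ≡⟨ ∥∥-cong (eq (re (expSum z n)) (re (expTerm z (suc n))) (re (expSum w n)) (re (expTerm w (suc n))))
                       (eq (im (expSum z n)) (im (expTerm z (suc n))) (im (expSum w n)) (im (expTerm w (suc n)))) ⟩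
          ∥ (expSum z n ⊕ ⊖ expSum w n) ⊕ (expTerm z (suc n) ⊕ ⊖ expTerm w (suc n)) ∥
            ≤⟨ ∥∥-⊕ (expSum z n ⊕ ⊖ expSum w n) (expTerm z (suc n) ⊕ ⊖ expTerm w (suc n)) ⟩
          ∥ expSum z n ⊕ ⊖ expSum w n ∥ + ∥ expTerm z (suc n) ⊕ ⊖ expTerm w (suc n) ∥
            ≤⟨ +-mono-≤ (sharp n) (expTerm-lipschitz (suc n)) ⟩
          δ * e′ n + δ * t n
            ≡⟨ *-distribˡ-+ δ (e′ n) (t n) ⟨
          δ * (e′ n + t n) ∎

    K : ℕ
    K = proj₁ (archimedean (B + B))

    t-halves : ∀ k → K ℕ.≤ k → t (suc k) + t (suc k) ≤ t k
    t-halves k K≤k = begin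
      suc⁻¹ k * (B * t k) + suc⁻¹ k * (B * t k)   ≡⟨ eq (suc⁻¹ k) B (t k) ⟩
      suc⁻¹ k * (B + B) * t k                 ≤⟨ *-monoʳ (t-nonNeg k) (*-monoˡ (<⇒≤ (suc⁻¹-pos k))
                                               (≤-trans (proj₂ (archimedean (B + B))) (fromℕ-mono (ℕ.m≤n⇒m≤1+n K≤k)))) ⟩
      suc⁻¹ k * fromℕ (suc k) * t k           ≡⟨ cong (_* t k) (suc⁻¹-inverse k) ⟩
      1ℚ * t k                            ≡⟨ *-identityˡ (t k) ⟩
      t k                                 ∎
      where
      eq : ∀ a b c → a * (b * c) + a * (b * c) ≡ a * (b + b) * c
      eq = solve-∀ ℚ-ring

    e+t-antitone : ∀ {m n} → K ℕ.≤ m → m ℕ.≤′ n → e n + t n ≤ e m + t m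
    e+t-antitone K≤m ℕ.≤′-refl = ≤-refl
    e+t-antitone {m} K≤m (ℕ.≤′-step {n} m≤n) = begin
      e n + t (suc n) + t (suc n)     ≡⟨ +-assoc (e n) (t (suc n)) (t (suc n)) ⟩
      e n + (t (suc n) + t (suc n))   ≤⟨ +-monoʳ-≤ (e n) (t-halves n (ℕ.≤-trans K≤m (ℕ.≤′⇒≤ m≤n))) ⟩
      e n + t n                       ≤⟨ e+t-antitone K≤m m≤n ⟩
      e m + t m                       ∎

    t-antitone : ∀ {m n} → K ℕ.≤ m → m ℕ.≤′ n → t n ≤ t m
    t-antitone K≤m ℕ.≤′-refl = ≤-refl
    t-antitone {m} K≤m (ℕ.≤′-step {n} m≤n) = ≤-trans
      (≤-trans (p≤p+q (t-nonNeg (suc n))) (t-halves n (ℕ.≤-trans K≤m (ℕ.≤′⇒≤ m≤n))))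
      (t-antitone K≤m m≤n)

    t-decay : ∀ j → fromℕ (suc j) * t (j ℕ.+ K) ≤ t K
    t-decay zero    = ≤-reflexive (*-identityˡ (t K))
    t-decay (suc j) = begin
      fromℕ (suc (suc j)) * t (suc (j ℕ.+ K))
        ≤⟨ *-monoʳ (t-nonNeg (suc (j ℕ.+ K))) (fromℕ-≤-double j) ⟩
      (fromℕ (suc j) + fromℕ (suc j)) * t (suc (j ℕ.+ K))
        ≡⟨ eq (fromℕ (suc j)) (t (suc (j ℕ.+ K))) ⟩
      fromℕ (suc j) * (t (suc (j ℕ.+ K)) + t (suc (j ℕ.+ K)))
        ≤⟨ *-monoˡ (fromℕ-nonNeg (suc j)) (t-halves (j ℕ.+ K) (ℕ.m≤n+m K j)) ⟩
      fromℕ (suc j) * t (j ℕ.+ K)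
        ≤⟨ t-decay j ⟩
      t K ∎
      where
      eq : ∀ a b → (a + a) * b ≡ a * (b + b)
      eq = solve-∀ ℚ-ring
      fromℕ-≤-double : ∀ j → fromℕ (suc (suc j)) ≤ fromℕ (suc j) + fromℕ (suc j)
      fromℕ-≤-double j = ≤-trans (≤-reflexive (fromℕ-suc (suc j)))
        (+-monoʳ-≤ (fromℕ (suc j)) (fromℕ-mono (ℕ.s≤s (ℕ.z≤n {j}))))

    e-cauchy : IsCauchy e
    e-cauchy = mkCauchy λ ε 0<ε → N ε 0<ε , λ m n N≤m N≤n →
        ∣-∣-< {e m} {e n} (less ε 0<ε m n N≤n) (less ε 0<ε n m N≤m)
      where
      module _ (ε : ℚ) (0<ε : 0ℚ < ε) where
        j = proj₁ (archimedean-< 0<ε (t K))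
        N = j ℕ.+ K
        K≤N : K ℕ.≤ N
        K≤N = ℕ.m≤n+m K j
        tN<ε : t N < ε
        tN<ε = *-cancelˡ-<-nonNeg (fromℕ (suc j)) {{nonNegative (fromℕ-nonNeg (suc j))}}
          (≤-<-trans (t-decay j) (proj₂ (archimedean-< 0<ε (t K))))
        less : ∀ m n → N ℕ.≤ n → e m - e n < ε
        less m n N≤n = split (ℕ.≤-total m n)
          where
          cancel : ∀ a b → a + b - a ≡ b
          cancel = solve-∀ ℚ-ring
          split : m ℕ.≤ n ⊎ n ℕ.≤ m → e m - e n < ε
          split (inj₁ m≤n) = begin-strict
            e m - e n  ≤⟨ +-monoˡ-≤ (- e n) (e-mono (ℕ.≤⇒≤′ m≤n)) ⟩
            e n - e n  ≡⟨ +-inverseʳ (e n) ⟩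
            0ℚ         <⟨ 0<ε ⟩
            ε          ∎
          split (inj₂ n≤m) = begin-strict
            e m - e n         ≤⟨ +-monoˡ-≤ (- e n) (≤-trans (p≤p+q {e m} (t-nonNeg m))
                                   (e+t-antitone (ℕ.≤-trans K≤N N≤n) (ℕ.≤⇒≤′ n≤m))) ⟩
            e n + t n - e n   ≡⟨ cancel (e n) (t n) ⟩
            t n               ≤⟨ t-antitone K≤N (ℕ.≤⇒≤′ N≤n) ⟩
            t N               <⟨ tN<ε ⟩
            ε                 ∎

  module _ {x y : ℕ → ℚ} (cx : IsCauchy x) (cy : IsCauchy y) where
    z : ℕ → Complex
    z n = x n +i y n
    Bx = proj₁ (bounded cx)
    By = proj₁ (bounded cy)
    Nx = proj₁ (proj₂ (proj₂ (bounded cx)))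
    Ny = proj₁ (proj₂ (proj₂ (bounded cy)))
    B = Bx + By
    0≤B : 0ℚ ≤ B
    0≤B = +-nonNeg (proj₁ (proj₂ (bounded cx))) (proj₁ (proj₂ (bounded cy)))
    z≤B : ∀ n → Nx ℕ.≤ n → Ny ℕ.≤ n → ∥ z n ∥ ≤ B
    z≤B n Nx≤n Ny≤n = +-mono-≤ (proj₂ (proj₂ (proj₂ (bounded cx))) n Nx≤n)
                               (proj₂ (proj₂ (proj₂ (bounded cy))) n Ny≤n)
    E = proj₁ (bounded (e-cauchy B 0≤B))
    0≤E = proj₁ (proj₂ (bounded (e-cauchy B 0≤B)))
    Ne = proj₁ (proj₂ (proj₂ (bounded (e-cauchy B 0≤B))))
    e≤E : ∀ n → Ne ℕ.≤ n → e B 0≤B n ≤ E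
    e≤E n Ne≤n = ≤-trans (p≤∣p∣ (e B 0≤B n)) (proj₂ (proj₂ (proj₂ (bounded (e-cauchy B 0≤B)))) n Ne≤n)
      where
      p≤∣p∣ : ∀ p → p ≤ ∣ p ∣
      p≤∣p∣ p = [ (λ 0≤p → ≤-reflexive (sym (0≤p⇒∣p∣≡p 0≤p))) , (λ p≤0 → ≤-trans p≤0 (0≤∣p∣ p)) ]′ (≤-total 0ℚ p)
    N = Nx ℕ.⊔ (Ny ℕ.⊔ Ne)
    C = E + 1ℚ
    0<C : 0ℚ < C
    0<C = +-mono-≤-< 0≤E (positive⁻¹ 1ℚ)

    expSum-close : ∀ m n → N ℕ.≤ m → m ℕ.≤ n →
      ∥ expSum (z m) m ⊕ ⊖ expSum (z n) n ∥ ≤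
      C * (∣ x m - x n ∣ + ∣ y m - y n ∣ + ∣ e B 0≤B m - e B 0≤B n ∣)
    expSum-close m n N≤m m≤n = begin
      ∥ Sm ⊕ ⊖ Sn ∥
        ≡⟨ ∥∥-cong (eq (re Sm) (re S′) (re Sn)) (eq (im Sm) (im S′) (im Sn)) ⟩
      ∥ (Sm ⊕ ⊖ S′) ⊕ ⊖ (Sn ⊕ ⊖ S′) ∥
        ≤⟨ ∥∥-⊕ (Sm ⊕ ⊖ S′) (⊖ (Sn ⊕ ⊖ S′)) ⟩
      ∥ Sm ⊕ ⊖ S′ ∥ + ∥ ⊖ (Sn ⊕ ⊖ S′) ∥
        ≡⟨ cong (λ q → ∥ Sm ⊕ ⊖ S′ ∥ + q) (cong₂ _+_ (∣-p∣≡∣p∣ (re (Sn ⊕ ⊖ S′))) (∣-p∣≡∣p∣ (im (Sn ⊕ ⊖ S′)))) ⟩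
      ∥ Sm ⊕ ⊖ S′ ∥ + ∥ Sn ⊕ ⊖ S′ ∥
        ≤⟨ +-mono-≤ (expSum-lipschitz B 0≤B (z m) (z n) zm≤B zn≤B m)
                    (expSum-tail B 0≤B (z n) zn≤B (ℕ.≤⇒≤′ m≤n)) ⟩
      d * e B 0≤B m + (e B 0≤B n - e B 0≤B m)
        ≡⟨ cong (λ q → d * e B 0≤B m + q) (trans (sym (0≤p⇒∣p∣≡p 0≤Δ)) (∣-∣-sym (e B 0≤B n) (e B 0≤B m))) ⟩
      d * e B 0≤B m + Δ
        ≤⟨ +-mono-≤ (*-monoˡ (∥∥-nonNeg (z m ⊕ ⊖ z n)) (≤-trans (e≤E m Ne≤m) (p≤p+q (nonNegative⁻¹ 1ℚ))))
                    (≤-trans (≤-reflexive (sym (*-identityˡ Δ)))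
                      (*-monoʳ (0≤∣p∣ (e B 0≤B m - e B 0≤B n)) (p≤q+p 0≤E))) ⟩
      d * C + C * Δ
        ≡⟨ eq′ d C Δ ⟩
      C * (d + Δ) ∎
      where
      open ≤-Reasoning
      Sm = expSum (z m) m
      Sn = expSum (z n) n
      S′ = expSum (z n) m
      d = ∥ z m ⊕ ⊖ z n ∥
      Δ = ∣ e B 0≤B m - e B 0≤B n ∣
      Nx≤m = ℕ.≤-trans (ℕ.m≤m⊔n Nx (Ny ℕ.⊔ Ne)) N≤m
      Ny≤m = ℕ.≤-trans (ℕ.≤-trans (ℕ.m≤m⊔n Ny Ne) (ℕ.m≤n⊔m Nx (Ny ℕ.⊔ Ne))) N≤m
      Ne≤m = ℕ.≤-trans (ℕ.≤-trans (ℕ.m≤n⊔m Ny Ne) (ℕ.m≤n⊔m Nx (Ny ℕ.⊔ Ne))) N≤m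
      zm≤B = z≤B m Nx≤m Ny≤m
      zn≤B = z≤B n (ℕ.≤-trans Nx≤m m≤n) (ℕ.≤-trans Ny≤m m≤n)
      0≤Δ : 0ℚ ≤ e B 0≤B n - e B 0≤B m
      0≤Δ = subst (_≤ e B 0≤B n - e B 0≤B m) (+-inverseʳ (e B 0≤B m))
              (+-monoˡ-≤ (- e B 0≤B m) (e-mono B 0≤B (ℕ.≤⇒≤′ m≤n)))
      eq : ∀ a b c → a + - c ≡ (a + - b) + - (c + - b)
      eq = solve-∀ ℚ-ring
      eq′ : ∀ a b c → a * b + b * c ≡ b * (a + c)
      eq′ = solve-∀ ℚ-ring

    abstract
      exp-re-cauchy : IsCauchy (λ n → re (expSum (z n) n))
      exp-re-cauchy = dominated N 0<C
        (λ m n N≤m m≤n → ≤-trans (p≤p+q (0≤∣p∣ (im (expSum (z m) m) - im (expSum (z n) n)))) (expSum-close m n N≤m m≤n))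
        cx cy (e-cauchy B 0≤B)

      exp-im-cauchy : IsCauchy (λ n → im (expSum (z n) n))
      exp-im-cauchy = dominated N 0<C
        (λ m n N≤m m≤n → ≤-trans (p≤q+p (0≤∣p∣ (re (expSum (z m) m) - re (expSum (z n) n)))) (expSum-close m n N≤m m≤n))
        cx cy (e-cauchy B 0≤B)

------------------------------------------------------------------------

module ℂ-ops = Complexification ℝ-rawRing
open ℂ-ops public using (re; im; _+i_; _≋_; _⊕_; _⊗_; ⊖_; conj; fromReal; 𝕚) renaming (Complex to ℂ)

ℂ-rawRing : RawRing 0ℓ 0ℓ
ℂ-rawRing = ℂ-ops.rawRing

open import Algebra.Definitions.RawSemiring (RawRing.rawSemiring ℂ-rawRing) public using (_^_; sum)

0ᶜ 1ᶜ : ℂ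
0ᶜ = fromReal 0ᴿ
1ᶜ = fromReal 1ᴿ

-- The limit of Σ_{k ≤ n} (zₙ)ᵏ / k!, where zₙ ∈ ℚ[i] converges to z.  It
-- agrees with Σ_k zᵏ / k! because the partial sums are Lipschitz on bounded
-- sets, uniformly in n (expSum-lipschitz).
exp : ℂ → ℂ
exp (x +i y) =
  mkℝ (λ n → ℚ[i].re (expSum (seq x n ℚ[i].+i seq y n) n)) (exp-re-cauchy (cauchy x) (cauchy y)) +i
  mkℝ (λ n → ℚ[i].im (expSum (seq x n ℚ[i].+i seq y n) n)) (exp-im-cauchy (cauchy x) (cauchy y))
  where open Exponential

cos : ℝ → ℝ
cos x = re (exp (𝕚 ⊗ fromReal x))

-- π is characterised by: π / 2 is the least positive zero of the cosine.
record IsPi (π : ℝ) : Set where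
  field
    π-positive : 0ᴿ <ᴿ π
    cos-zero   : cos (π *ᴿ fromℚ ½) ≈ᴿ 0ᴿ
    least      : ∀ x → 0ᴿ <ᴿ x → x <ᴿ π *ᴿ fromℚ ½ → ¬ (cos x ≈ᴿ 0ᴿ)

------------------------------------------------------------------------

ℂ^ : ℕ → Set
ℂ^ n = Vector ℂ n

Matrix : Set → ℕ → ℕ → Set
Matrix A m n = Vector (Vector A n) m

infix  4 _≋ᵛ_ _∼_
infixl 6 _⊕ᵛ_
infixl 7 _⊙_ _•_ _·_

_≋ᵛ_ : ∀ {n} → ℂ^ n → ℂ^ n → Set
u ≋ᵛ v = ∀ k → u k ≋ v k

0ᵛ : ∀ {n} → ℂ^ n
0ᵛ _ = 0ᶜ

_⊕ᵛ_ _⊙_ : ∀ {n} → ℂ^ n → ℂ^ n → ℂ^ n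
(u ⊕ᵛ v) k = u k ⊕ v k
(u ⊙ v)  k = u k ⊗ v k

_•_ : ∀ {n} → ℂ → ℂ^ n → ℂ^ n
(c • v) k = c ⊗ v k

⟨_,_⟩ : ∀ {n} → ℂ^ n → ℂ^ n → ℂ
⟨ u , v ⟩ = sum (λ k → conj (u k) ⊗ v k)

δ : ∀ {n} → Fin n → Fin n → ℂ
δ i j = if does (i Fin.≟ j) then 1ᶜ else 0ᶜ

_·_ : ∀ {l m n} → Matrix ℂ l m → Matrix ℂ m n → Matrix ℂ l n
(M · N) i k = sum (λ j → M i j ⊗ N j k)

permutationMatrix : ∀ {n} → Permutation′ n → Matrix ℂ n n
permutationMatrix σ i j = δ (σ ⟨$⟩ʳ i) j

column : ∀ {m n} → Matrix ℂ m n → Fin n → ℂ^ m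
column = transpose

linearCombination : ∀ {m n} → Vector ℂ m → Vector (ℂ^ n) m → ℂ^ n
linearCombination c b k = sum (λ i → c i ⊗ b i k)

record IsOrthonormalBasis {n} (b : Vector (ℂ^ n) n) : Set where
  field
    orthonormal : ∀ i j → ⟨ b i , b j ⟩ ≋ δ i j
    independent : ∀ c → linearCombination c b ≋ᵛ 0ᵛ → ∀ i → c i ≋ 0ᶜ
    spanning    : ∀ v → ∃[ c ] linearCombination c b ≋ᵛ v

IsUnit : ∀ {n} → ℂ^ n → Set
IsUnit u = ⟨ u , u ⟩ ≋ 1ᶜ

record IsQuantumLatinSquare {n} (Φ : Matrix (ℂ^ n) n n) : Set where
  field
    unit    : ∀ i j → IsUnit (Φ i j)
    rows    : ∀ i → IsOrthonormalBasis (λ j → Φ i j)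
    columns : ∀ j → IsOrthonormalBasis (λ i → Φ i j)

_∼_ : ∀ {n} → ℂ^ n → ℂ^ n → Set
u ∼ v = ∃[ α ] u ≋ᵛ exp (𝕚 ⊗ fromReal α) • v

-- The positions of the array, identified when their entries are phase
-- equivalent, are in bijection with Fin c.
HasCardinality : ∀ {n} → Matrix (ℂ^ n) n n → ℕ → Set
HasCardinality {n} Φ c =
  Σ[ class ∈ (Fin n × Fin n → Fin c) ] Congruent _≃ᵖ_ _≡_ class × Bijective _≃ᵖ_ _≡_ class
  where
  _≃ᵖ_ : Fin n × Fin n → Fin n × Fin n → Set
  (i , j) ≃ᵖ (k , l) = Φ i j ∼ Φ k l

------------------------------------------------------------------------

A B : Matrix (Fin 12) 6 6
A = (# 0 ∷ # 0 ∷ # 0  ∷ # 0  ∷ # 0  ∷ # 0 ∷ [])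
  ∷ (# 0 ∷ # 0 ∷ # 3  ∷ # 6  ∷ # 6  ∷ # 9 ∷ [])
  ∷ (# 0 ∷ # 3 ∷ # 9  ∷ # 1  ∷ # 7  ∷ # 6 ∷ [])
  ∷ (# 0 ∷ # 6 ∷ # 4  ∷ # 10 ∷ # 1  ∷ # 7 ∷ [])
  ∷ (# 0 ∷ # 6 ∷ # 10 ∷ # 7  ∷ # 4  ∷ # 1 ∷ [])
  ∷ (# 0 ∷ # 9 ∷ # 6  ∷ # 4  ∷ # 10 ∷ # 3 ∷ [])
  ∷ []
B = (# 0 ∷ # 0 ∷ # 0  ∷ # 0  ∷ # 0  ∷ # 0  ∷ [])
  ∷ (# 0 ∷ # 0 ∷ # 3  ∷ # 6  ∷ # 6  ∷ # 9  ∷ [])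
  ∷ (# 0 ∷ # 3 ∷ # 9  ∷ # 4  ∷ # 10 ∷ # 6  ∷ [])
  ∷ (# 0 ∷ # 6 ∷ # 1  ∷ # 10 ∷ # 7  ∷ # 4  ∷ [])
  ∷ (# 0 ∷ # 9 ∷ # 6  ∷ # 7  ∷ # 1  ∷ # 3  ∷ [])
  ∷ (# 0 ∷ # 6 ∷ # 7  ∷ # 1  ∷ # 4  ∷ # 10 ∷ [])
  ∷ []

module _ (θ : ℂ) where

  H : Matrix ℂ 6 6
  H r s = θ ^ toℕ (A r s)

  P : Matrix ℂ 6 6
  P = permutationMatrix (transposition (# 4) (# 5))

  K : Matrix ℂ 6 6
  K = P · transpose H

  Φ₃₅ : Matrix (ℂ^ 6) 6 6
  Φ₃₅ i j = fromReal (recip (√ 6) (√-pos 5)) • (column H i ⊙ column K j)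

{-# OPTIONS --safe #-}

-- With z = iπ/6, the addition formula for exp gives |θ| = 1 and θ³ = exp(iπ/2),
-- whose real part vanishes, so that θ⁶ = -1.  Now θ² + 1 = 2 θ cos(π/6), and
-- cos(π/6) ≠ 0 because π/2 is the least positive zero of the cosine; cancelling
-- this factor from θ⁶ + 1 leaves θ⁴ - θ² + 1 = 0.  From here on everything is
-- decided in ℚ[X]/(X⁴ - X² + 1) with exponents modulo 12: conj θ = θ¹¹, so inner
-- products of rows and columns of Φ₃₅ are sums of powers of θ.  All entries have
-- the same first component, so phase equivalent entries are equal.
module Submission where

open import Defs
open import Data.Fin using (toℕ)
open import Data.Integer.Base using (+_)
open import Data.Product.Base using (_×_)
open import Data.Rational.Base using (_/_)

open import Algebra.Bundles using (CommutativeRing)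
import Algebra.Consequences.Propositional as Consequences
import Algebra.Properties.Ring as RingProperties
open import Data.Bool.Base using (true; false; if_then_else_)
open import Data.Empty using (⊥-elim)
open import Data.Fin using (Fin; #_; zero; suc; fromℕ<; combine; punchOut)
open import Data.Fin.Permutation using (Permutation′; _⟨$⟩ʳ_) renaming (transpose to transposition)
import Data.Fin.Properties as Fin
open import Data.Maybe.Base using (Maybe; just; nothing)
open import Data.Nat.Base as ℕ using (ℕ; zero; suc)
open import Data.Nat.DivMod using (m≡m%n+[m/n]*n; m%n<n)
import Data.Nat.Properties as ℕ
open import Data.Product.Base using (∃-syntax; _,_; proj₁; proj₂)
open import Data.Product.Properties using (≡-dec)
open import Data.Sum.Base using (_⊎_; [_,_]′)
open import Data.Vec.Functional using (transpose)
open import Level using (0ℓ)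
open import Relation.Binary.PropositionalEquality hiding (setoid)
import Relation.Binary.Reasoning.Setoid as SetoidReasoning
open import Relation.Binary.Structures using (IsEquivalence)
open import Relation.Nullary.Decidable
  using (Dec; yes; no; does; from-yes; from-no; decidable-stable; _→-dec_; _⊎-dec_; ¬?)
open import Relation.Nullary.Negation using (¬_)
open import Tactic.RingSolver using (solve-∀)
open import Tactic.RingSolver.Core.AlmostCommutativeRing
  using (AlmostCommutativeRing; fromCommutativeRing)

-- Antidiagonal sums and the exponential series

-- Equality of reals cannot be decided by computation, and this shapes the analytic steps. `exp` is
-- a diagonal sequence, the n-th partial sum at the n-th approximation, so the addition formula
-- becomes a bound for each n: the error of a product of partial sums is dominated by that of the
-- real exponential series at bounds for the norms, hence by a difference e(2n) - e(n), which is
-- null. The characterisation of π yields only the negation of cos(π/6) = 0, not a lower bound on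
-- its absolute value, so cancelling this factor takes an argument of its own. On the algebraic
-- side, the map from ℚ[X]/(X⁴ - X² + 1) to ℂ is used in one direction: a finite check upstairs
-- gives an identity in ℂ. Inequality of entries comes from θ⁶ ≠ 1 and θ⁴ ≠ 1, since every
-- nontrivial twelfth root of unity has a power of order 2 or 3. That rows and columns span is
-- obtained by checking the Gram matrix of the transpose as well, in place of a dimension count.

module Antidiagonal (R : CommutativeRing 0ℓ 0ℓ) where
  open CommutativeRing R
    using (Carrier; _≈_; 0#; 1#; setoid; ring; +-assoc; +-comm; +-identityˡ; +-identityʳ; +-congˡ; +-congʳ;
           *-assoc; *-comm; *-identityˡ; *-congˡ; *-congʳ; distribˡ; distribʳ; zeroˡ; zeroʳ)
    renaming (_+_ to infixl 6 _⊹_; _*_ to infixl 7 _⋆_; -_ to infix 8 ─_; +-cong to ⊹-cong; *-cong to ⋆-cong;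
              refl to ≈-refl; sym to ≈-sym; trans to ≈-trans)
  open SetoidReasoning setoid
  open RingProperties ring using (-‿distribʳ-*)

  antidiag : (ℕ → ℕ → Carrier) → ℕ → Carrier
  antidiag f zero    = f 0 0
  antidiag f (suc n) = f 0 (suc n) ⊹ antidiag (λ i → f (suc i)) n

  antidiag-cong : ∀ {f g} n → (∀ i j → i ℕ.+ j ≡ n → f i j ≈ g i j) → antidiag f n ≈ antidiag g n
  antidiag-cong zero    f≈g = f≈g 0 0 refl
  antidiag-cong (suc n) f≈g =
    ⊹-cong (f≈g 0 (suc n) refl) (antidiag-cong n λ i j i+j≡n → f≈g (suc i) j (cong suc i+j≡n))

  antidiag-+ : ∀ f g n → antidiag (λ i j → f i j ⊹ g i j) n ≈ antidiag f n ⊹ antidiag g n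
  antidiag-+ f g zero    = ≈-refl
  antidiag-+ f g (suc n) =
    ≈-trans (+-congˡ (antidiag-+ (λ i → f (suc i)) (λ i → g (suc i)) n)) (eq _ _ _ _)
    where
    eq : ∀ a b c d → (a ⊹ b) ⊹ (c ⊹ d) ≈ (a ⊹ c) ⊹ (b ⊹ d)
    eq a b c d = begin
      (a ⊹ b) ⊹ (c ⊹ d) ≈⟨ +-assoc a b (c ⊹ d) ⟩
      a ⊹ (b ⊹ (c ⊹ d)) ≈⟨ +-congˡ (≈-sym (+-assoc b c d)) ⟩
      a ⊹ (b ⊹ c ⊹ d)   ≈⟨ +-congˡ (+-congʳ (+-comm b c)) ⟩
      a ⊹ (c ⊹ b ⊹ d)   ≈⟨ +-congˡ (+-assoc c b d) ⟩
      a ⊹ (c ⊹ (b ⊹ d)) ≈⟨ +-assoc a c (b ⊹ d) ⟨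
      (a ⊹ c) ⊹ (b ⊹ d) ∎

  antidiag-* : ∀ c f n → c ⋆ antidiag f n ≈ antidiag (λ i j → c ⋆ f i j) n
  antidiag-* c f zero    = ≈-refl
  antidiag-* c f (suc n) =
    ≈-trans (distribˡ c _ _) (+-congˡ (antidiag-* c (λ i → f (suc i)) n))

  -- The recursion of `antidiag` peels off the end i = 0; sums driven by the second index need the
  -- end j = 0.
  antidiag-last : ∀ f n → antidiag f (suc n) ≈ antidiag (λ i j → f i (suc j)) n ⊹ f (suc n) 0
  antidiag-last f zero    = ≈-refl
  antidiag-last f (suc n) =
    ≈-trans (+-congˡ (antidiag-last (λ i → f (suc i)) n)) (≈-sym (+-assoc _ _ _))

  -- The series is axiomatised over a ring because the same identities serve twice: in ℚ[i] for the
  -- partial sums of `exp`, and in ℚ for the majorant that bounds them.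
  module Series (ι inv : ℕ → Carrier) (ι-zero : ι 0 ≈ 0#) (ι-suc : ∀ k → ι (suc k) ≈ ι k ⊹ 1#)
    (inv-inverse : ∀ k → inv k ⋆ ι (suc k) ≈ 1#) where

    -- With ι k = k and inv k = 1 / (k + 1), term k is xᵏ / k!.
    record ExpSeries (x : Carrier) : Set where
      field
        term partial : ℕ → Carrier
        term-zero    : term 0 ≈ 1#
        term-suc     : ∀ k → term (suc k) ≈ inv k ⋆ (x ⋆ term k)
        partial-zero : partial 0 ≈ term 0
        partial-suc  : ∀ k → partial (suc k) ≈ partial k ⊹ term (suc k)

      term-suc′ : ∀ k → ι (suc k) ⋆ term (suc k) ≈ x ⋆ term k
      term-suc′ k = begin
        ι (suc k) ⋆ term (suc k)          ≈⟨ *-congˡ (term-suc k) ⟩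
        ι (suc k) ⋆ (inv k ⋆ (x ⋆ term k)) ≈⟨ *-assoc _ _ _ ⟨
        ι (suc k) ⋆ inv k ⋆ (x ⋆ term k)  ≈⟨ *-congʳ (≈-trans (*-comm _ _) (inv-inverse k)) ⟩
        1# ⋆ (x ⋆ term k)                 ≈⟨ *-identityˡ _ ⟩
        x ⋆ term k                        ∎
    open ExpSeries

    ι-+ : ∀ i j → ι (i ℕ.+ j) ≈ ι i ⊹ ι j
    ι-+ zero    j = ≈-sym (≈-trans (+-congʳ ι-zero) (+-identityˡ (ι j)))
    ι-+ (suc i) j = begin
      ι (suc (i ℕ.+ j))   ≈⟨ ι-suc (i ℕ.+ j) ⟩
      ι (i ℕ.+ j) ⊹ 1#    ≈⟨ +-congʳ (ι-+ i j) ⟩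
      ι i ⊹ ι j ⊹ 1#      ≈⟨ +-assoc _ _ _ ⟩
      ι i ⊹ (ι j ⊹ 1#)    ≈⟨ +-congˡ (+-comm _ _) ⟩
      ι i ⊹ (1# ⊹ ι j)    ≈⟨ +-assoc _ _ _ ⟨
      ι i ⊹ 1# ⊹ ι j      ≈⟨ +-congʳ (ι-suc i) ⟨
      ι (suc i) ⊹ ι j     ∎

    module _ {x y : Carrier} (X : ExpSeries x) (Y : ExpSeries y) (Z : ExpSeries (x ⊹ y)) where

      -- Dividing by factorials removes the binomial coefficients: both sides satisfy the recursion
      -- (n + 1) cₙ₊₁ = (x + y) cₙ, so induction suffices.
      binomial : ∀ n → antidiag (λ i j → term X i ⋆ term Y j) n ≈ term Z n
      binomial zero = begin
        term X 0 ⋆ term Y 0 ≈⟨ ⋆-cong (term-zero X) (term-zero Y) ⟩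
        1# ⋆ 1#             ≈⟨ *-identityˡ 1# ⟩
        1#                  ≈⟨ term-zero Z ⟨
        term Z 0            ∎
      binomial (suc n) = begin
        C (suc n)                                  ≈⟨ *-identityˡ _ ⟨
        1# ⋆ C (suc n)                             ≈⟨ *-congʳ (inv-inverse n) ⟨
        inv n ⋆ ι (suc n) ⋆ C (suc n)              ≈⟨ *-assoc _ _ _ ⟩
        inv n ⋆ (ι (suc n) ⋆ C (suc n))            ≈⟨ *-congˡ leibniz ⟩
        inv n ⋆ ((x ⊹ y) ⋆ C n)                    ≈⟨ *-congˡ (*-congˡ (binomial n)) ⟩
        inv n ⋆ ((x ⊹ y) ⋆ term Z n)               ≈⟨ term-suc Z n ⟨
        term Z (suc n)                             ∎
        where
        C : ℕ → Carrier
        C = antidiag (λ i j → term X i ⋆ term Y j)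
        weightedˡ weightedʳ : ℕ → ℕ → Carrier
        weightedˡ i j = (ι i ⋆ term X i) ⋆ term Y j
        weightedʳ i j = term X i ⋆ (ι j ⋆ term Y j)
        eqʳ : ∀ a b c → a ⋆ (b ⋆ c) ≈ b ⋆ (a ⋆ c)
        eqʳ a b c = ≈-trans (≈-sym (*-assoc a b c)) (≈-trans (*-congʳ (*-comm a b)) (*-assoc b a c))
        left : antidiag weightedˡ (suc n) ≈ x ⋆ C n
        left = begin
          (ι 0 ⋆ term X 0) ⋆ term Y (suc n) ⊹ antidiag (λ i → weightedˡ (suc i)) n
            ≈⟨ ⊹-cong (≈-trans (*-congʳ (≈-trans (*-congʳ ι-zero) (zeroˡ _))) (zeroˡ _))
                 (antidiag-cong n λ i j _ → ≈-trans (*-congʳ (term-suc′ X i)) (*-assoc _ _ _)) ⟩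
          0# ⊹ antidiag (λ i j → x ⋆ (term X i ⋆ term Y j)) n
            ≈⟨ +-identityˡ _ ⟩
          antidiag (λ i j → x ⋆ (term X i ⋆ term Y j)) n
            ≈⟨ antidiag-* x (λ i j → term X i ⋆ term Y j) n ⟨
          x ⋆ C n ∎
        right : antidiag weightedʳ (suc n) ≈ y ⋆ C n
        right = begin
          antidiag weightedʳ (suc n)
            ≈⟨ antidiag-last weightedʳ n ⟩
          antidiag (λ i j → weightedʳ i (suc j)) n ⊹ term X (suc n) ⋆ (ι 0 ⋆ term Y 0)
            ≈⟨ ⊹-cong (antidiag-cong n λ i j _ → ≈-trans (*-congˡ (term-suc′ Y j)) (eqʳ _ _ _))
                 (≈-trans (*-congˡ (≈-trans (*-congʳ ι-zero) (zeroˡ _))) (zeroʳ _)) ⟩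
          antidiag (λ i j → y ⋆ (term X i ⋆ term Y j)) n ⊹ 0#
            ≈⟨ +-identityʳ _ ⟩
          antidiag (λ i j → y ⋆ (term X i ⋆ term Y j)) n
            ≈⟨ antidiag-* y (λ i j → term X i ⋆ term Y j) n ⟨
          y ⋆ C n ∎
        weights : ∀ i j → i ℕ.+ j ≡ suc n →
          ι (suc n) ⋆ (term X i ⋆ term Y j) ≈ weightedˡ i j ⊹ weightedʳ i j
        weights i j i+j≡n rewrite sym i+j≡n = begin
          ι (i ℕ.+ j) ⋆ (term X i ⋆ term Y j)
            ≈⟨ *-congʳ (ι-+ i j) ⟩
          (ι i ⊹ ι j) ⋆ (term X i ⋆ term Y j)
            ≈⟨ distribʳ _ (ι i) (ι j) ⟩
          ι i ⋆ (term X i ⋆ term Y j) ⊹ ι j ⋆ (term X i ⋆ term Y j)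
            ≈⟨ ⊹-cong (≈-sym (*-assoc _ _ _)) (eqʳ _ _ _) ⟩
          weightedˡ i j ⊹ weightedʳ i j ∎
        -- Weighting the terms by k is a derivation, and k xᵏ / k! = x · xᵏ⁻¹ / (k - 1)!.
        leibniz : ι (suc n) ⋆ C (suc n) ≈ (x ⊹ y) ⋆ C n
        leibniz = begin
          ι (suc n) ⋆ C (suc n)
            ≈⟨ antidiag-* (ι (suc n)) (λ i j → term X i ⋆ term Y j) (suc n) ⟩
          antidiag (λ i j → ι (suc n) ⋆ (term X i ⋆ term Y j)) (suc n)
            ≈⟨ antidiag-cong (suc n) weights ⟩
          antidiag (λ i j → weightedˡ i j ⊹ weightedʳ i j) (suc n)
            ≈⟨ antidiag-+ weightedˡ weightedʳ (suc n) ⟩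
          antidiag weightedˡ (suc n) ⊹ antidiag weightedʳ (suc n)
            ≈⟨ ⊹-cong left right ⟩
          x ⋆ C n ⊹ y ⋆ C n
            ≈⟨ distribʳ _ x y ⟨
          (x ⊹ y) ⋆ C n ∎

      -- Expanding `partial Y j` turns the left side into the sum over all index pairs with i + j at
      -- most n, which regroups into the diagonals 0 to n of `binomial`.
      triangle : ∀ n → antidiag (λ i j → term X i ⋆ partial Y j) n ≈ partial Z n
      triangle zero = begin
        term X 0 ⋆ partial Y 0 ≈⟨ *-congˡ (partial-zero Y) ⟩
        term X 0 ⋆ term Y 0    ≈⟨ binomial 0 ⟩
        term Z 0               ≈⟨ partial-zero Z ⟨
        partial Z 0            ∎
      triangle (suc n) = begin
        antidiag (λ i j → term X i ⋆ partial Y j) (suc n)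
          ≈⟨ antidiag-last (λ i j → term X i ⋆ partial Y j) n ⟩
        antidiag (λ i j → term X i ⋆ partial Y (suc j)) n ⊹ term X (suc n) ⋆ partial Y 0
          ≈⟨ ⊹-cong (antidiag-cong n λ i j _ → ≈-trans (*-congˡ (partial-suc Y j)) (distribˡ _ _ _))
                    (*-congˡ (partial-zero Y)) ⟩
        antidiag (λ i j → term X i ⋆ partial Y j ⊹ term X i ⋆ term Y (suc j)) n ⊹ term X (suc n) ⋆ term Y 0
          ≈⟨ +-congʳ (antidiag-+ (λ i j → term X i ⋆ partial Y j) (λ i j → term X i ⋆ term Y (suc j)) n) ⟩
        antidiag (λ i j → term X i ⋆ partial Y j) n ⊹ antidiag (λ i j → term X i ⋆ term Y (suc j)) n
          ⊹ term X (suc n) ⋆ term Y 0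
          ≈⟨ +-assoc _ _ _ ⟩
        antidiag (λ i j → term X i ⋆ partial Y j) n ⊹ (antidiag (λ i j → term X i ⋆ term Y (suc j)) n
          ⊹ term X (suc n) ⋆ term Y 0)
          ≈⟨ ⊹-cong (triangle n) (≈-sym (antidiag-last (λ i j → term X i ⋆ term Y j) n)) ⟩
        partial Z n ⊹ antidiag (λ i j → term X i ⋆ term Y j) (suc n)
          ≈⟨ +-congˡ (binomial (suc n)) ⟩
        partial Z n ⊹ term Z (suc n)
          ≈⟨ partial-suc Z n ⟨
        partial Z (suc n) ∎

      rectangle : ∀ c n → antidiag (λ i _ → term X i ⋆ c) n ≈ partial X n ⋆ c
      rectangle c zero    = *-congʳ (≈-sym (partial-zero X))
      rectangle c (suc n) = begin
        antidiag (λ i _ → term X i ⋆ c) (suc n)           ≈⟨ antidiag-last (λ i _ → term X i ⋆ c) n ⟩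
        antidiag (λ i _ → term X i ⋆ c) n ⊹ term X (suc n) ⋆ c ≈⟨ +-congʳ (rectangle c n) ⟩
        partial X n ⋆ c ⊹ term X (suc n) ⋆ c              ≈⟨ distribʳ c _ _ ⟨
        (partial X n ⊹ term X (suc n)) ⋆ c                ≈⟨ *-congʳ (partial-suc X n) ⟨
        partial X (suc n) ⋆ c                             ∎

      -- The square of index pairs up to n minus the triangle: on the antidiagonal the inner
      -- difference collects the terms of Y with index above n - i and at most n. Keeping the
      -- difference inside the sum lets norms be taken term by term.
      product-error : ∀ n → antidiag (λ i j → term X i ⋆ (partial Y n ⊹ ─ partial Y j)) n ≈
                            partial X n ⋆ partial Y n ⊹ ─ partial Z n
      product-error n = begin
        antidiag (λ i j → term X i ⋆ (partial Y n ⊹ ─ partial Y j)) n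
          ≈⟨ antidiag-cong n (λ i j _ → ≈-trans (distribˡ _ _ _)
               (+-congˡ (≈-trans (≈-sym (-‿distribʳ-* _ _)) (-≈-1* _)))) ⟩
        antidiag (λ i j → term X i ⋆ partial Y n ⊹ ─ 1# ⋆ (term X i ⋆ partial Y j)) n
          ≈⟨ antidiag-+ _ _ n ⟩
        antidiag (λ i _ → term X i ⋆ partial Y n) n ⊹ antidiag (λ i j → ─ 1# ⋆ (term X i ⋆ partial Y j)) n
          ≈⟨ ⊹-cong (rectangle (partial Y n) n)
               (≈-trans (≈-sym (antidiag-* (─ 1#) _ n)) (≈-trans (*-congˡ (triangle n)) (≈-sym (-≈-1* _)))) ⟩
        partial X n ⋆ partial Y n ⊹ ─ partial Z n ∎
        where
        -≈-1* : ∀ a → ─ a ≈ ─ 1# ⋆ a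
        -≈-1* a = ≈-sym (RingProperties.-1*x≈-x ring a)

-- The commutative rings ℚ[i] and ℂ

open import Data.Rational.Base
  using (ℚ; 0ℚ; 1ℚ; ½; _+_; _*_; _-_; -_; _≤_; _<_; ∣_∣)
open import Data.Rational.Properties
open ℚ[i] using () renaming (Complex to ℚi; re to reℚ; im to imℚ)
open Exponential using (expTerm; expSum; ∥_∥; ∥∥-nonNeg; ∥∥-⊕; ∥∥-⊗)

record Null (a : ℕ → ℚ) : Set where
  constructor mkNull
  field
    small : ∀ ε → 0ℚ < ε → ∃[ N ] ∀ n → N ℕ.≤ n → ∣ a n ∣ < ε
open Null

Null-zero : Null (λ _ → 0ℚ)
Null-zero = mkNull λ ε 0<ε → 0 , λ _ _ → 0<ε

-- Two bounding sequences accommodate binary operations; unary uses fill the second one with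
-- `Null-zero`.
Null-dominated : ∀ {a b c} N₀ {C} → 0ℚ < C →
  (∀ n → N₀ ℕ.≤ n → ∣ a n ∣ ≤ C * (∣ b n ∣ + ∣ c n ∣)) → Null b → Null c → Null a
Null-dominated {a} {b} {c} N₀ {C} 0<C dom (mkNull nb) (mkNull nc) = mkNull λ ε 0<ε →
  let D , 0<D , CD≡1 = posInverse 0<C
      δ = ½ * (D * ε)
      0<δ = *-pos (positive⁻¹ ½) (*-pos 0<D 0<ε)
      N₁ , b<δ = nb δ 0<δ
      N₂ , c<δ = nc δ 0<δ
      Cδ≡ε : C * (δ + δ) ≡ ε
      Cδ≡ε = trans (eq C D ε) (trans (cong (_* ε) CD≡1) (*-identityˡ ε))
  in N₀ ℕ.⊔ (N₁ ℕ.⊔ N₂) , λ n N≤n →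
     let N₁₂≤n = ℕ.≤-trans (ℕ.m≤n⊔m N₀ _) N≤n in begin-strict
       ∣ a n ∣                  ≤⟨ dom n (ℕ.≤-trans (ℕ.m≤m⊔n N₀ _) N≤n) ⟩
       C * (∣ b n ∣ + ∣ c n ∣)  <⟨ *-mono-<ˡ 0<C (+-mono-<
                                     (b<δ n (ℕ.≤-trans (ℕ.m≤m⊔n N₁ N₂) N₁₂≤n))
                                     (c<δ n (ℕ.≤-trans (ℕ.m≤n⊔m N₁ N₂) N₁₂≤n))) ⟩
       C * (δ + δ)              ≡⟨ Cδ≡ε ⟩
       ε                        ∎
  where
  open ≤-Reasoning
  eq : ∀ c d e → c * (½ * (d * e) + ½ * (d * e)) ≡ (c * d) * e
  eq = solve-∀ ℚ-ring

pointwise-≈ : ∀ {x y} → (∀ n → seq x n ≡ seq y n) → x ≈ᴿ y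
pointwise-≈ {x} {y} eq = mk≈ λ ε 0<ε → 0 , λ n _ →
  subst (_< ε) (sym (trans (cong (λ q → ∣ q - seq y n ∣) (eq n)) (cong ∣_∣ (+-inverseʳ (seq y n))))) 0<ε

ℚi-ring : CommutativeRing 0ℓ 0ℓ
ℚi-ring = record
  { Carrier = ℚi ; _≈_ = _≡_ ; _+_ = ℚ[i]._⊕_ ; _*_ = ℚ[i]._⊗_ ; -_ = ℚ[i].⊖_
  ; 0# = ℚ[i].fromReal 0ℚ ; 1# = ℚ[i].fromReal 1ℚ
  ; isCommutativeRing = record
    { isRing = record
      { +-isAbelianGroup = record
        { isGroup = record
          { isMonoid = record
            { isSemigroup = record
              { isMagma = record { isEquivalence = isEquivalence ; ∙-cong = cong₂ ℚ[i]._⊕_ }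
              ; assoc = λ z w v → cong₂ ℚ[i]._+i_ (+-assoc (reℚ z) (reℚ w) (reℚ v)) (+-assoc (imℚ z) (imℚ w) (imℚ v)) }
            ; identity = Consequences.comm∧idˡ⇒id comm
                (λ z → cong₂ ℚ[i]._+i_ (+-identityˡ (reℚ z)) (+-identityˡ (imℚ z))) }
          ; inverse = Consequences.comm∧invˡ⇒inv comm
              (λ z → cong₂ ℚ[i]._+i_ (+-inverseˡ (reℚ z)) (+-inverseˡ (imℚ z)))
          ; ⁻¹-cong = cong ℚ[i].⊖_ }
        ; comm = comm }
      ; *-cong = cong₂ ℚ[i]._⊗_
      ; *-assoc = λ z w v → cong₂ ℚ[i]._+i_
          (assoc-re (reℚ z) (imℚ z) (reℚ w) (imℚ w) (reℚ v) (imℚ v))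
          (assoc-im (reℚ z) (imℚ z) (reℚ w) (imℚ w) (reℚ v) (imℚ v))
      ; *-identity = Consequences.comm∧idˡ⇒id *-comm′
          (λ z → cong₂ ℚ[i]._+i_ (idˡ-re (reℚ z) (imℚ z)) (idˡ-im (reℚ z) (imℚ z)))
      ; distrib = Consequences.comm∧distrˡ⇒distr (cong₂ ℚ[i]._⊕_) *-comm′
          (λ z w v → cong₂ ℚ[i]._+i_
            (distribˡ-re (reℚ z) (imℚ z) (reℚ w) (imℚ w) (reℚ v) (imℚ v))
            (distribˡ-im (reℚ z) (imℚ z) (reℚ w) (imℚ w) (reℚ v) (imℚ v))) }
    ; *-comm = *-comm′ } }
  where
  comm : ∀ z w → z ℚ[i].⊕ w ≡ w ℚ[i].⊕ z
  comm z w = cong₂ ℚ[i]._+i_ (+-comm (reℚ z) (reℚ w)) (+-comm (imℚ z) (imℚ w))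
  comm-re : ∀ a b c d → a * c + - (b * d) ≡ c * a + - (d * b)
  comm-re = solve-∀ ℚ-ring
  comm-im : ∀ a b c d → a * d + b * c ≡ c * b + d * a
  comm-im = solve-∀ ℚ-ring
  *-comm′ : ∀ z w → z ℚ[i].⊗ w ≡ w ℚ[i].⊗ z
  *-comm′ z w = cong₂ ℚ[i]._+i_ (comm-re (reℚ z) (imℚ z) (reℚ w) (imℚ w)) (comm-im (reℚ z) (imℚ z) (reℚ w) (imℚ w))
  assoc-re : ∀ a b c d e f →
    (a * c + - (b * d)) * e + - ((a * d + b * c) * f) ≡ a * (c * e + - (d * f)) + - (b * (c * f + d * e))
  assoc-re = solve-∀ ℚ-ring
  assoc-im : ∀ a b c d e f →
    (a * c + - (b * d)) * f + (a * d + b * c) * e ≡ a * (c * f + d * e) + b * (c * e + - (d * f))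
  assoc-im = solve-∀ ℚ-ring
  idˡ-re : ∀ a b → 1ℚ * a + - (0ℚ * b) ≡ a
  idˡ-re = solve-∀ ℚ-ring
  idˡ-im : ∀ a b → 1ℚ * b + 0ℚ * a ≡ b
  idˡ-im = solve-∀ ℚ-ring
  distribˡ-re : ∀ a b c d e f →
    a * (c + e) + - (b * (d + f)) ≡ (a * c + - (b * d)) + (a * e + - (b * f))
  distribˡ-re = solve-∀ ℚ-ring
  distribˡ-im : ∀ a b c d e f →
    a * (d + f) + b * (c + e) ≡ (a * d + b * c) + (a * f + b * e)
  distribˡ-im = solve-∀ ℚ-ring

ℚi-acr : AlmostCommutativeRing 0ℓ 0ℓ
ℚi-acr = fromCommutativeRing ℚi-ring isZero?
  where
  isZero? : ∀ z → Maybe (ℚ[i].fromReal 0ℚ ≡ z)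
  isZero? z with 0ℚ ≟ reℚ z | 0ℚ ≟ imℚ z
  ... | yes p | yes q = just (cong₂ ℚ[i]._+i_ p q)
  ... | _     | _     = nothing

open AlmostCommutativeRing ℚi-acr using () renaming (_+_ to infixl 6 _⊞_; _*_ to infixl 7 _⊠_; -_ to infix 8 ⊟_)

-- The operations of ℂ act termwise on these sequences by definition, so that
-- identities of ℚ[i] lift to ℂ.
_at_ : ℂ → ℕ → ℚi
z at n = seq (re z) n ℚ[i].+i seq (im z) n

infix 9 _at_

dist : ℂ → ℂ → ℕ → ℚ
dist z w n = ∥ z at n ⊞ ⊟ w at n ∥

dist-nonNeg : ∀ z w n → 0ℚ ≤ dist z w n
dist-nonNeg z w n = ∥∥-nonNeg (z at n ⊞ ⊟ w at n)

pointwise : ∀ {z w} → (∀ n → z at n ≡ w at n) → z ≋ w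
pointwise {z} {w} eq =
  ℂ-ops._+i_ {z} {w} (pointwise-≈ (λ n → cong reℚ (eq n))) (pointwise-≈ (λ n → cong imℚ (eq n)))

≋⇒Null : ∀ {z w} → z ≋ w → Null (dist z w)
≋⇒Null {z} {w} (mk≈ re-≈ ℂ-ops.+i mk≈ im-≈) = Null-dominated 0 (positive⁻¹ 1ℚ)
  (λ n _ → ≤-reflexive (trans (0≤p⇒∣p∣≡p (dist-nonNeg z w n)) (sym (*-identityˡ (dist z w n)))))
  (mkNull re-≈) (mkNull im-≈)

Null⇒≋ : ∀ {z w} → Null (dist z w) → z ≋ w
Null⇒≋ {z} {w} null = ℂ-ops._+i_ {z} {w}
  (mk≈ (small (below (λ n → ∥_∥-re (z at n ⊞ ⊟ w at n)))))
  (mk≈ (small (below (λ n → ∥_∥-im (z at n ⊞ ⊟ w at n)))))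
  where
  ∥_∥-re : ∀ u → ∣ reℚ u ∣ ≤ ∥ u ∥
  ∥ u ∥-re = p≤p+q (0≤∣p∣ (imℚ u))
  ∥_∥-im : ∀ u → ∣ imℚ u ∣ ≤ ∥ u ∥
  ∥ u ∥-im = p≤q+p (0≤∣p∣ (reℚ u))
  below : ∀ {a} → (∀ n → ∣ a n ∣ ≤ dist z w n) → Null a
  below a≤ = Null-dominated 0 (positive⁻¹ 1ℚ)
    (λ n _ → ≤-trans (a≤ n) (≤-reflexive (trans (sym (0≤p⇒∣p∣≡p (dist-nonNeg z w n))) (eq ∣ dist z w n ∣))))
    null Null-zero
    where
    eq : ∀ p → p ≡ 1ℚ * (p + 0ℚ)
    eq = solve-∀ ℚ-ring

squeeze : ∀ {z w b c} N₀ {C} → 0ℚ < C →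
  (∀ n → N₀ ℕ.≤ n → dist z w n ≤ C * (∣ b n ∣ + ∣ c n ∣)) → Null b → Null c → z ≋ w
squeeze {z} {w} N₀ 0<C dom nb nc = Null⇒≋ (Null-dominated N₀ 0<C
  (λ n N₀≤n → ≤-trans (≤-reflexive (0≤p⇒∣p∣≡p (dist-nonNeg z w n))) (dom n N₀≤n)) nb nc)

p≤∣p∣ : ∀ p → p ≤ ∣ p ∣
p≤∣p∣ p = [ (λ 0≤p → ≤-reflexive (sym (0≤p⇒∣p∣≡p 0≤p))) , (λ p≤0 → ≤-trans p≤0 (0≤∣p∣ p)) ]′ (≤-total 0ℚ p)

ℂ-bounded : ∀ z → ∃[ C ] 0ℚ ≤ C × (∃[ N ] ∀ n → N ℕ.≤ n → ∥ z at n ∥ ≤ C)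
ℂ-bounded z =
  let C , 0≤C , N , re≤ = bounded (cauchy (re z))
      C′ , 0≤C′ , N′ , im≤ = bounded (cauchy (im z))
  in C + C′ , +-nonNeg 0≤C 0≤C′ , N ℕ.⊔ N′ , λ n N≤n →
     +-mono-≤ (re≤ n (ℕ.≤-trans (ℕ.m≤m⊔n N N′) N≤n)) (im≤ n (ℕ.≤-trans (ℕ.m≤n⊔m N N′) N≤n))

≋-isEquivalence : IsEquivalence _≋_
≋-isEquivalence = record
  { refl = pointwise λ _ → refl
  ; sym = λ {z} {w} z≋w → squeeze 0 (positive⁻¹ 1ℚ)
      (λ n _ → ≤-trans (≤-reflexive (flip z w n)) (≤-trans (p≤∣p∣ _) (≤-reflexive (pad ∣ dist z w n ∣))))
      (≋⇒Null z≋w) Null-zero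
  ; trans = λ {z} {w} {v} z≋w w≋v → squeeze 0 (positive⁻¹ 1ℚ)
      (λ n _ → ≤-trans (≤-reflexive (cong ∥_∥ (split (z at n) (w at n) (v at n))))
        (≤-trans (∥∥-⊕ (z at n ⊞ ⊟ w at n) (w at n ⊞ ⊟ v at n))
        (≤-trans (+-mono-≤ (p≤∣p∣ (dist z w n)) (p≤∣p∣ (dist w v n))) (≤-reflexive (sym (*-identityˡ _))))))
      (≋⇒Null z≋w) (≋⇒Null w≋v)
  }
  where
  flip : ∀ z w n → dist w z n ≡ dist z w n
  flip z w n = cong₂ _+_ (∣-∣-sym (seq (re w) n) (seq (re z) n)) (∣-∣-sym (seq (im w) n) (seq (im z) n))
  pad : ∀ p → p ≡ 1ℚ * (p + 0ℚ)
  pad = solve-∀ ℚ-ring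
  split : ∀ z w v → z ⊞ ⊟ v ≡ (z ⊞ ⊟ w) ⊞ (w ⊞ ⊟ v)
  split = solve-∀ ℚi-acr

⊕-cong : ∀ {z w z′ w′} → z ≋ w → z′ ≋ w′ → z ⊕ z′ ≋ w ⊕ w′
⊕-cong {z} {w} {z′} {w′} z≋w z′≋w′ = squeeze 0 (positive⁻¹ 1ℚ)
  (λ n _ → ≤-trans (≤-reflexive (cong ∥_∥ (split (z at n) (w at n) (z′ at n) (w′ at n))))
    (≤-trans (∥∥-⊕ (z at n ⊞ ⊟ w at n) (z′ at n ⊞ ⊟ w′ at n))
    (≤-trans (+-mono-≤ (p≤∣p∣ (dist z w n)) (p≤∣p∣ (dist z′ w′ n))) (≤-reflexive (sym (*-identityˡ _))))))
  (≋⇒Null z≋w) (≋⇒Null z′≋w′)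
  where
  split : ∀ z w z′ w′ → (z ⊞ z′) ⊞ ⊟ (w ⊞ w′) ≡
                        (z ⊞ ⊟ w) ⊞ (z′ ⊞ ⊟ w′)
  split = solve-∀ ℚi-acr

⊗-cong : ∀ {z w z′ w′} → z ≋ w → z′ ≋ w′ → z ⊗ z′ ≋ w ⊗ w′
⊗-cong {z} {w} {z′} {w′} z≋w z′≋w′ =
  let C , 0≤C , N , z′≤C = ℂ-bounded z′
      D , 0≤D , M , w≤D = ℂ-bounded w
      -- The summand 1 makes the constant positive, as `squeeze` requires, even if both bounds are
      -- 0.
      E = C + D + 1ℚ
      C≤E = ≤-trans (p≤p+q {C} 0≤D) (p≤p+q (nonNegative⁻¹ 1ℚ))
      D≤E = ≤-trans (p≤q+p {D} 0≤C) (p≤p+q (nonNegative⁻¹ 1ℚ))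
  in squeeze (N ℕ.⊔ M) (+-mono-≤-< (+-nonNeg 0≤C 0≤D) (positive⁻¹ 1ℚ))
    (λ n N≤n → begin
      dist (z ⊗ z′) (w ⊗ w′) n
        ≡⟨ cong ∥_∥ (split (z at n) (w at n) (z′ at n) (w′ at n)) ⟩
      ∥ (z at n ⊞ ⊟ w at n) ⊠ z′ at n ⊞ w at n ⊠ (z′ at n ⊞ ⊟ w′ at n) ∥
        ≤⟨ ∥∥-⊕ ((z at n ⊞ ⊟ w at n) ⊠ z′ at n) (w at n ⊠ (z′ at n ⊞ ⊟ w′ at n)) ⟩
      ∥ (z at n ⊞ ⊟ w at n) ⊠ z′ at n ∥ + ∥ w at n ⊠ (z′ at n ⊞ ⊟ w′ at n) ∥
        ≤⟨ +-mono-≤ (∥∥-⊗ (z at n ⊞ ⊟ w at n) (z′ at n)) (∥∥-⊗ (w at n) (z′ at n ⊞ ⊟ w′ at n)) ⟩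
      dist z w n * ∥ z′ at n ∥ + ∥ w at n ∥ * dist z′ w′ n
        ≤⟨ +-mono-≤
             (*-mono (∥∥-nonNeg (z′ at n)) (0≤∣p∣ (dist z w n)) (p≤∣p∣ (dist z w n))
               (≤-trans (z′≤C n (ℕ.≤-trans (ℕ.m≤m⊔n N M) N≤n)) C≤E))
             (*-mono (dist-nonNeg z′ w′ n) (≤-trans 0≤D D≤E)
               (≤-trans (w≤D n (ℕ.≤-trans (ℕ.m≤n⊔m N M) N≤n)) D≤E) (p≤∣p∣ (dist z′ w′ n))) ⟩
      ∣ dist z w n ∣ * E + E * ∣ dist z′ w′ n ∣
        ≡⟨ factor (∣ dist z w n ∣) E (∣ dist z′ w′ n ∣) ⟩
      E * (∣ dist z w n ∣ + ∣ dist z′ w′ n ∣) ∎)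
    (≋⇒Null z≋w) (≋⇒Null z′≋w′)
  where
  open ≤-Reasoning
  split : ∀ z w z′ w′ → (z ⊠ z′) ⊞ ⊟ (w ⊠ w′) ≡
                        (z ⊞ ⊟ w) ⊠ z′ ⊞ w ⊠ (z′ ⊞ ⊟ w′)
  split = solve-∀ ℚi-acr
  factor : ∀ a e b → a * e + e * b ≡ e * (a + b)
  factor = solve-∀ ℚ-ring

module _ {z w : ℂ} (z≋w : z ≋ w) where
  private
    below : ∀ z′ w′ → (∀ n → dist z′ w′ n ≡ dist z w n) → z′ ≋ w′
    below z′ w′ eq = squeeze 0 (positive⁻¹ 1ℚ)
      (λ n _ → ≤-trans (≤-reflexive (eq n)) (≤-trans (p≤∣p∣ _) (≤-reflexive (pad ∣ dist z w n ∣))))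
      (≋⇒Null z≋w) Null-zero
      where
      pad : ∀ p → p ≡ 1ℚ * (p + 0ℚ)
      pad = solve-∀ ℚ-ring
    neg : ∀ p q → ∣ - p - - q ∣ ≡ ∣ p - q ∣
    neg p q = trans (cong ∣_∣ (eq p q)) (∣-p∣≡∣p∣ (p - q))
      where
      eq : ∀ p q → - p - - q ≡ - (p - q)
      eq = solve-∀ ℚ-ring

  ⊖-cong : ⊖ z ≋ ⊖ w
  ⊖-cong = below (⊖ z) (⊖ w) λ n →
    cong₂ _+_ (neg (seq (re z) n) (seq (re w) n)) (neg (seq (im z) n) (seq (im w) n))

  conj-cong : conj z ≋ conj w
  conj-cong = below (conj z) (conj w) λ n →
    cong (λ q → ∣ seq (re z) n - seq (re w) n ∣ + q) (neg (seq (im z) n) (seq (im w) n))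

private module Q = CommutativeRing ℚi-ring

ℂ-ring : CommutativeRing 0ℓ 0ℓ
ℂ-ring = record
  { Carrier = ℂ ; _≈_ = _≋_ ; _+_ = _⊕_ ; _*_ = _⊗_ ; -_ = ⊖_ ; 0# = 0ᶜ ; 1# = 1ᶜ
  ; isCommutativeRing = record
    { isRing = record
      { +-isAbelianGroup = record
        { isGroup = record
          { isMonoid = record
            { isSemigroup = record
              { isMagma = record { isEquivalence = ≋-isEquivalence ; ∙-cong = ⊕-cong }
              ; assoc = λ z w v → pointwise λ n → Q.+-assoc (z at n) (w at n) (v at n) }
            ; identity = (λ z → pointwise λ n → Q.+-identityˡ (z at n))
                       , (λ z → pointwise λ n → Q.+-identityʳ (z at n)) }
          ; inverse = (λ z → pointwise λ n → Q.-‿inverseˡ (z at n)) , (λ z → pointwise λ n → Q.-‿inverseʳ (z at n))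
          ; ⁻¹-cong = ⊖-cong }
        ; comm = λ z w → pointwise λ n → Q.+-comm (z at n) (w at n) }
      ; *-cong = ⊗-cong
      ; *-assoc = λ z w v → pointwise λ n → Q.*-assoc (z at n) (w at n) (v at n)
      ; *-identity = (λ z → pointwise λ n → Q.*-identityˡ (z at n)) , (λ z → pointwise λ n → Q.*-identityʳ (z at n))
      ; distrib = (λ z w v → pointwise λ n → Q.distribˡ (z at n) (w at n) (v at n))
                , (λ z w v → pointwise λ n → Q.distribʳ (z at n) (w at n) (v at n)) }
    ; *-comm = λ z w → pointwise λ n → Q.*-comm (z at n) (w at n) } }

-- Both sides are compared at the same n. On a ball containing both approximations the n-th partial
-- sum is Lipschitz with constant at most the n-th partial sum of the majorant, and these constants
-- are bounded because the majorant is Cauchy.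
exp-cong : ∀ {z w} → z ≋ w → exp z ≋ exp w
exp-cong {z} {w} z≋w =
  let C , 0≤C , N , z≤C = ℂ-bounded z
      D , 0≤D , M , w≤D = ℂ-bounded w
      E = C + D
      0≤E = +-nonNeg 0≤C 0≤D
      F , 0≤F , L , e≤F = bounded (Exponential.e-cauchy E 0≤E)
      N′ = (N ℕ.⊔ M) ℕ.⊔ L
  in squeeze N′ {F + 1ℚ} (+-mono-≤-< 0≤F (positive⁻¹ 1ℚ))
    (λ n N′≤n →
      let N⊔M≤n = ℕ.≤-trans (ℕ.m≤m⊔n (N ℕ.⊔ M) L) N′≤n in begin
      dist (exp z) (exp w) n
        ≤⟨ Exponential.expSum-lipschitz E 0≤E (z at n) (w at n)
             (≤-trans (z≤C n (ℕ.≤-trans (ℕ.m≤m⊔n N M) N⊔M≤n)) (p≤p+q 0≤D))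
             (≤-trans (w≤D n (ℕ.≤-trans (ℕ.m≤n⊔m N M) N⊔M≤n)) (p≤q+p 0≤C)) n ⟩
      dist z w n * Exponential.e E 0≤E n
        ≤⟨ *-monoˡ (dist-nonNeg z w n) (≤-trans (p≤∣p∣ (Exponential.e E 0≤E n))
             (≤-trans (e≤F n (ℕ.≤-trans (ℕ.m≤n⊔m (N ℕ.⊔ M) L) N′≤n)) (p≤p+q (nonNegative⁻¹ 1ℚ)))) ⟩
      dist z w n * (F + 1ℚ)
        ≤⟨ *-monoʳ (+-nonNeg 0≤F (nonNegative⁻¹ 1ℚ)) (p≤∣p∣ (dist z w n)) ⟩
      ∣ dist z w n ∣ * (F + 1ℚ)
        ≡⟨ pad (∣ dist z w n ∣) (F + 1ℚ) ⟩
      (F + 1ℚ) * (∣ dist z w n ∣ + 0ℚ) ∎)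
    (≋⇒Null z≋w) Null-zero
  where
  open ≤-Reasoning
  pad : ∀ a e → a * e ≡ e * (a + 0ℚ)
  pad = solve-∀ ℚ-ring

-- The addition formula for exp

module Antiℚ  = Antidiagonal +-*-commutativeRing
module Antiℚi = Antidiagonal ℚi-ring
open Antiℚ using (antidiag)
open Antiℚi using () renaming (antidiag to antidiagᶜ)

antidiag-mono : ∀ {f g} n → (∀ i j → i ℕ.+ j ≡ n → f i j ≤ g i j) → antidiag f n ≤ antidiag g n
antidiag-mono zero    f≤g = f≤g 0 0 refl
antidiag-mono (suc n) f≤g =
  +-mono-≤ (f≤g 0 (suc n) refl) (antidiag-mono n λ i j i+j≡n → f≤g (suc i) j (cong suc i+j≡n))

∥antidiag∥ : ∀ f n → ∥ antidiagᶜ f n ∥ ≤ antidiag (λ i j → ∥ f i j ∥) n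
∥antidiag∥ f zero    = ≤-refl
∥antidiag∥ f (suc n) = ≤-trans (∥∥-⊕ (f 0 (suc n)) (antidiagᶜ (λ i → f (suc i)) n))
  (+-monoʳ-≤ ∥ f 0 (suc n) ∥ (∥antidiag∥ (λ i → f (suc i)) n))

-- The left side is the part i ≤ n of the antidiagonal n + m; the terms left out are nonnegative.
antidiag-prefix : ∀ {f} → (∀ i j → 0ℚ ≤ f i j) → ∀ m n →
  antidiag (λ i j → f i (j ℕ.+ m)) n ≤ antidiag f (n ℕ.+ m)
antidiag-prefix 0≤f zero    zero    = ≤-refl
antidiag-prefix {f} 0≤f (suc m) zero = p≤p+q (nonNeg {λ i → f (suc i)} (λ i → 0≤f (suc i)) m)
  where
  nonNeg : ∀ {f} → (∀ i j → 0ℚ ≤ f i j) → ∀ n → 0ℚ ≤ antidiag f n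
  nonNeg 0≤f zero    = 0≤f 0 0
  nonNeg 0≤f (suc n) = +-nonNeg (0≤f 0 (suc n)) (nonNeg (λ i → 0≤f (suc i)) n)
antidiag-prefix {f} 0≤f m (suc n) =
  +-monoʳ-≤ (f 0 (suc n ℕ.+ m)) (antidiag-prefix {λ i → f (suc i)} (λ i → 0≤f (suc i)) m n)

module Sℚ = Antiℚ.Series fromℕ suc⁻¹ refl fromℕ-suc suc⁻¹-inverse
fromReal-suc⁻¹-inverse : ∀ k → ℚ[i].fromReal (suc⁻¹ k) ⊠ ℚ[i].fromReal (fromℕ (suc k)) ≡ ℚ[i].fromReal 1ℚ
fromReal-suc⁻¹-inverse k = cong₂ ℚ[i]._+i_
  (trans (eq (suc⁻¹ k) (fromℕ (suc k))) (suc⁻¹-inverse k)) (eq′ (suc⁻¹ k) (fromℕ (suc k)))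
  where
  eq : ∀ a b → a * b + - (0ℚ * 0ℚ) ≡ a * b
  eq = solve-∀ ℚ-ring
  eq′ : ∀ a b → a * 0ℚ + 0ℚ * b ≡ 0ℚ
  eq′ = solve-∀ ℚ-ring

module Sℚi = Antiℚi.Series (λ k → ℚ[i].fromReal (fromℕ k)) (λ k → ℚ[i].fromReal (suc⁻¹ k)) refl
  (λ k → cong (ℚ[i]._+i 0ℚ) (fromℕ-suc k)) fromReal-suc⁻¹-inverse

realSeries : ∀ B 0≤B → Sℚ.ExpSeries B
realSeries B 0≤B = record
  { term = Exponential.t B 0≤B ; partial = Exponential.e B 0≤B
  ; term-zero = refl ; term-suc = λ _ → refl ; partial-zero = refl ; partial-suc = λ _ → refl }

complexSeries : ∀ z → Sℚi.ExpSeries z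
complexSeries z = record
  { term = expTerm z ; partial = expSum z
  ; term-zero = refl ; term-suc = λ k → scalar (suc⁻¹ k) (z ⊠ expTerm z k)
  ; partial-zero = refl ; partial-suc = λ _ → refl }
  where
  scalar : ∀ q w → q Exponential.• w ≡ ℚ[i].fromReal q ⊠ w
  scalar q w = cong₂ ℚ[i]._+i_ (eq q (reℚ w) (imℚ w)) (eq′ q (reℚ w) (imℚ w))
    where
    eq : ∀ q a b → q * a ≡ q * a + - (0ℚ * b)
    eq = solve-∀ ℚ-ring
    eq′ : ∀ q a b → q * b ≡ q * b + 0ℚ * a
    eq′ = solve-∀ ℚ-ring

e-nonNeg : ∀ {C} 0≤C n → 0ℚ ≤ Exponential.e C 0≤C n
e-nonNeg 0≤C n = ≤-trans (nonNegative⁻¹ 1ℚ) (Exponential.e-mono _ 0≤C (ℕ.z≤′n {n}))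

module _ {B D : ℚ} (0≤B : 0ℚ ≤ B) (0≤D : 0ℚ ≤ D) where
  private
    0≤B+D = +-nonNeg 0≤B 0≤D
    tᴮ = Exponential.t B 0≤B
    eᴮ = Exponential.e B 0≤B
    eᴰ = Exponential.e D 0≤D
    eᴮᴰ = Exponential.e (B + D) 0≤B+D

  -- The square of index pairs up to n lies inside the triangle i + j ≤ 2n, and all terms are
  -- nonnegative.
  e-product-≤ : ∀ n → eᴮ n * eᴰ n ≤ eᴮᴰ (n ℕ.+ n)
  e-product-≤ n = begin
    eᴮ n * eᴰ n
      ≡⟨ Sℚ.rectangle (realSeries B 0≤B) (realSeries D 0≤D) (realSeries (B + D) 0≤B+D) (eᴰ n) n ⟨
    antidiag (λ i _ → tᴮ i * eᴰ n) n
      ≤⟨ antidiag-mono n (λ i j _ → *-monoˡ (Exponential.t-nonNeg B 0≤B i)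
           (Exponential.e-mono D 0≤D (ℕ.≤⇒≤′ (ℕ.m≤n+m n j)))) ⟩
    antidiag (λ i j → tᴮ i * eᴰ (j ℕ.+ n)) n
      ≤⟨ antidiag-prefix (λ i j → *-nonNeg (Exponential.t-nonNeg B 0≤B i) (e-nonNeg 0≤D j)) n n ⟩
    antidiag (λ i j → tᴮ i * eᴰ j) (n ℕ.+ n)
      ≡⟨ Sℚ.triangle (realSeries B 0≤B) (realSeries D 0≤D) (realSeries (B + D) 0≤B+D) (n ℕ.+ n) ⟩
    eᴮᴰ (n ℕ.+ n) ∎
    where open ≤-Reasoning

  -- `product-error` is read in both directions: in ℚ[i] it spreads the error over an antidiagonal,
  -- each summand is bounded by its counterpart for the majorants, and in ℚ it collects the bounds
  -- into a product minus a partial sum. The square then fits into the triangle of size 2n.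
  expSum-product : ∀ z w → ∥ z ∥ ≤ B → ∥ w ∥ ≤ D → ∀ n →
    ∥ expSum z n ⊠ expSum w n ⊞ ⊟ expSum (z ⊞ w) n ∥ ≤ eᴮᴰ (n ℕ.+ n) - eᴮᴰ n
  expSum-product z w z≤B w≤D n = begin
    ∥ expSum z n ⊠ expSum w n ⊞ ⊟ expSum (z ⊞ w) n ∥
      ≡⟨ cong ∥_∥ (Sℚi.product-error (complexSeries z) (complexSeries w) (complexSeries (z ⊞ w)) n) ⟨
    ∥ antidiagᶜ (λ i j → expTerm z i ⊠ (expSum w n ⊞ ⊟ expSum w j)) n ∥
      ≤⟨ ∥antidiag∥ (λ i j → expTerm z i ⊠ (expSum w n ⊞ ⊟ expSum w j)) n ⟩
    antidiag (λ i j → ∥ expTerm z i ⊠ (expSum w n ⊞ ⊟ expSum w j) ∥) n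
      ≤⟨ antidiag-mono n (λ i j i+j≡n → ≤-trans (∥∥-⊗ (expTerm z i) (expSum w n ⊞ ⊟ expSum w j))
           (*-mono (∥∥-nonNeg (expSum w n ⊞ ⊟ expSum w j)) (Exponential.t-nonNeg B 0≤B i)
             (Exponential.expTerm-bound B 0≤B z z≤B i)
             (Exponential.expSum-tail D 0≤D w w≤D (ℕ.≤⇒≤′ (subst (j ℕ.≤_) i+j≡n (ℕ.m≤n+m j i)))))) ⟩
    antidiag (λ i j → tᴮ i * (eᴰ n - eᴰ j)) n
      ≡⟨ Sℚ.product-error (realSeries B 0≤B) (realSeries D 0≤D) (realSeries (B + D) 0≤B+D) n ⟩
    eᴮ n * eᴰ n - eᴮᴰ n
      ≤⟨ +-monoˡ-≤ (- eᴮᴰ n) (e-product-≤ n) ⟩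
    eᴮᴰ (n ℕ.+ n) - eᴮᴰ n ∎
    where open ≤-Reasoning

-- Termwise operations make the n-th term of each side an expression in partial sums at `z at n` and
-- `w at n`, so `expSum-product` applies for each large n; its bound is null because the majorant is
-- Cauchy.
exp-⊕ : ∀ z w → exp z ⊗ exp w ≋ exp (z ⊕ w)
exp-⊕ z w =
  let C , 0≤C , N , z≤C = ℂ-bounded z
      D , 0≤D , M , w≤D = ℂ-bounded w
      e = Exponential.e (C + D) (+-nonNeg 0≤C 0≤D)
  in squeeze {b = λ n → e (n ℕ.+ n) - e n} (N ℕ.⊔ M) (positive⁻¹ 1ℚ)
    (λ n N≤n → ≤-trans
      (expSum-product 0≤C 0≤D (z at n) (w at n)
        (z≤C n (ℕ.≤-trans (ℕ.m≤m⊔n N M) N≤n)) (w≤D n (ℕ.≤-trans (ℕ.m≤n⊔m N M) N≤n)) n)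
      (≤-trans (p≤∣p∣ (e (n ℕ.+ n) - e n)) (≤-reflexive (pad ∣ e (n ℕ.+ n) - e n ∣))))
    (doubling (Exponential.e-cauchy (C + D) (+-nonNeg 0≤C 0≤D))) Null-zero
  where
  pad : ∀ p → p ≡ 1ℚ * (p + 0ℚ)
  pad = solve-∀ ℚ-ring
  doubling : ∀ {x} → IsCauchy x → Null (λ n → x (n ℕ.+ n) - x n)
  doubling (mkCauchy cx) = mkNull λ ε 0<ε → proj₁ (cx ε 0<ε) , λ n N≤n →
    proj₂ (cx ε 0<ε) (n ℕ.+ n) n (ℕ.≤-trans N≤n (ℕ.m≤m+n n n)) N≤n

exp-0 : exp 0ᶜ ≋ 1ᶜ
exp-0 = pointwise expSum-0
  where
  expTerm-0 : ∀ k → expTerm (0ᶜ at 0) (suc k) ≡ 0ᶜ at 0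
  expTerm-0 k = cong₂ ℚ[i]._+i_
    (eq (suc⁻¹ k) (reℚ (expTerm (0ᶜ at 0) k)) (imℚ (expTerm (0ᶜ at 0) k)))
    (eq′ (suc⁻¹ k) (reℚ (expTerm (0ᶜ at 0) k)) (imℚ (expTerm (0ᶜ at 0) k)))
    where
    eq : ∀ q a b → q * (0ℚ * a + - (0ℚ * b)) ≡ 0ℚ
    eq = solve-∀ ℚ-ring
    eq′ : ∀ q a b → q * (0ℚ * b + 0ℚ * a) ≡ 0ℚ
    eq′ = solve-∀ ℚ-ring
  expSum-0 : ∀ n → expSum (0ᶜ at 0) n ≡ 1ᶜ at 0
  expSum-0 zero    = refl
  expSum-0 (suc n) = cong₂ _⊞_ (expSum-0 n) (expTerm-0 n)

conj-exp : ∀ z → conj (exp z) ≋ exp (conj z)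
conj-exp z = pointwise λ n → expSum-conj (z at n) n
  where
  expTerm-conj : ∀ u k → ℚ[i].conj (expTerm u k) ≡ expTerm (ℚ[i].conj u) k
  expTerm-conj u zero    = refl
  expTerm-conj u (suc k) = trans
    (cong₂ ℚ[i]._+i_
      (eq (suc⁻¹ k) (reℚ u) (imℚ u) (reℚ (expTerm u k)) (imℚ (expTerm u k)))
      (eq′ (suc⁻¹ k) (reℚ u) (imℚ u) (reℚ (expTerm u k)) (imℚ (expTerm u k))))
    (cong (λ w → suc⁻¹ k Exponential.• (ℚ[i].conj u ⊠ w)) (expTerm-conj u k))
    where
    eq : ∀ q a b c d → q * (a * c + - (b * d)) ≡ q * (a * c + - (- b * - d))
    eq = solve-∀ ℚ-ring
    eq′ : ∀ q a b c d → - (q * (a * d + b * c)) ≡ q * (a * - d + - b * c)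
    eq′ = solve-∀ ℚ-ring
  expSum-conj : ∀ u n → ℚ[i].conj (expSum u n) ≡ expSum (ℚ[i].conj u) n
  expSum-conj u zero    = refl
  expSum-conj u (suc n) = trans
    (cong (reℚ (expSum u (suc n)) ℚ[i].+i_) (neg-distrib-+ (imℚ (expSum u n)) (imℚ (expTerm u (suc n)))))
    (cong₂ _⊞_ (expSum-conj u n) (expTerm-conj u (suc n)))

-- Embedded rationals, conjugation and cancellation of real factors

module C = CommutativeRing ℂ-ring
open import Algebra.Properties.CommutativeSemiring.Exp C.commutativeSemiring using (^-distrib-*)
open import Algebra.Properties.Semiring.Exp C.semiring using (^-homo-*; ^-assocʳ; ^-congˡ; ^-congʳ)
open import Algebra.Properties.Semiring.Sum C.semiring
  using (sum-cong-≋; sum-replicate-zero; ∑-comm; *-distribˡ-sum; *-distribʳ-sum)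

embed : ℚ → ℂ
embed q = fromReal (fromℚ q)

-- Testing at ε = 1 is enough to tell -1 from 1 and 0 from 3, which is how distinct powers of θ are
-- separated.
embed-separated : ∀ p q → embed p ≋ embed q → ∣ p - q ∣ < 1ℚ
embed-separated p q (mk≈ close ℂ-ops.+i _) =
  let N , p-q<1 = close 1ℚ (positive⁻¹ 1ℚ) in p-q<1 N ℕ.≤-refl

conj-⊗ : ∀ z w → conj (z ⊗ w) ≋ conj z ⊗ conj w
conj-⊗ z w = pointwise λ n → cong₂ ℚ[i]._+i_
  (eq (seq (re z) n) (seq (im z) n) (seq (re w) n) (seq (im w) n))
  (eq′ (seq (re z) n) (seq (im z) n) (seq (re w) n) (seq (im w) n))
  where
  eq : ∀ a b c d → a * c + - (b * d) ≡ a * c + - (- b * - d)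
  eq = solve-∀ ℚ-ring
  eq′ : ∀ a b c d → - (a * d + b * c) ≡ a * - d + - b * c
  eq′ = solve-∀ ℚ-ring

conj-^ : ∀ z n → conj (z ^ n) ≋ conj z ^ n
conj-^ z zero    = pointwise λ _ → refl
conj-^ z (suc n) = C.trans (conj-⊗ z (z ^ n)) (C.*-congˡ (conj-^ z n))

⊕-conj : ∀ z → z ⊕ conj z ≋ fromReal (re z) ⊕ fromReal (re z)
⊕-conj z = pointwise λ n → cong (seq (re z) n + seq (re z) n ℚ[i].+i_) (+-inverseʳ (seq (im z) n))

-- Only x ≠ 0 is known, not that x is apart from 0.  Comparing y with η = ε / 4 at
-- one late index, either y is below ε or y is bounded away from 0, and then x is null.
Null-cancel : ∀ {x y} → IsCauchy y → Null (λ n → x n * y n) → ¬ Null x → Null y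
Null-cancel {x} {y} (mkCauchy cy) nxy ¬nx = mkNull λ ε 0<ε →
  let η = + 1 / 4 * ε
      0<η = *-pos (positive⁻¹ (+ 1 / 4)) 0<ε
      N , y-close = cy η 0<η
  in decide ε 0<ε η 0<η (quarter ε) N (λ n N≤n → y-close n N N≤n ℕ.≤-refl)
  where
  quarter : ∀ ε → + 1 / 4 * ε + + 1 / 4 * ε + + 1 / 4 * ε + + 1 / 4 * ε ≡ ε
  quarter = solve-∀ ℚ-ring
  split : ∀ a b → a ≡ b + (a - b)
  split = solve-∀ ℚ-ring
  open ≤-Reasoning
  module _ (ε : ℚ) (0<ε : 0ℚ < ε) (η : ℚ) (0<η : 0ℚ < η) (4η≡ε : η + η + η + η ≡ ε)
    (N : ℕ) (y-close : ∀ n → N ℕ.≤ n → ∣ y n - y N ∣ < η) where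
    away : ¬ (∣ y N ∣ < η + η) → ∀ n → N ℕ.≤ n → η ≤ ∣ y n ∣
    away y≮2η n N≤n = +-cancelʳ-≤ η η ∣ y n ∣ (begin
      η + η                     ≤⟨ ≮⇒≥ y≮2η ⟩
      ∣ y N ∣                   ≡⟨ cong ∣_∣ (split (y N) (y n)) ⟩
      ∣ y n + (y N - y n) ∣     ≤⟨ ∣p+q∣≤∣p∣+∣q∣ (y n) (y N - y n) ⟩
      ∣ y n ∣ + ∣ y N - y n ∣   ≡⟨ cong (λ q → ∣ y n ∣ + q) (∣-∣-sym (y N) (y n)) ⟩
      ∣ y n ∣ + ∣ y n - y N ∣   ≤⟨ +-monoʳ-≤ ∣ y n ∣ (<⇒≤ (y-close n N≤n)) ⟩
      ∣ y n ∣ + η               ∎)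
      where
      +-cancelʳ-≤ : ∀ c p q → p + c ≤ q + c → p ≤ q
      +-cancelʳ-≤ c p q p+c≤q+c = subst₂ _≤_ (cancel p c) (cancel q c) (+-monoˡ-≤ (- c) p+c≤q+c)
        where
        cancel : ∀ p c → p + c - c ≡ p
        cancel = solve-∀ ℚ-ring
    x-null : ¬ (∣ y N ∣ < η + η) → Null x
    x-null y≮2η =
      let D , 0<D , ηD≡1 = posInverse 0<η in Null-dominated N 0<D
        (λ n N≤n → begin
          ∣ x n ∣                     ≡⟨ *-identityʳ ∣ x n ∣ ⟨
          ∣ x n ∣ * 1ℚ                ≡⟨ cong (∣ x n ∣ *_) ηD≡1 ⟨
          ∣ x n ∣ * (η * D)           ≤⟨ *-monoˡ (0≤∣p∣ (x n)) (*-monoʳ (<⇒≤ 0<D) (away y≮2η n N≤n)) ⟩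
          ∣ x n ∣ * (∣ y n ∣ * D)     ≡⟨ eq ∣ x n ∣ ∣ y n ∣ D ⟩
          D * (∣ x n ∣ * ∣ y n ∣ + 0ℚ) ≡⟨ cong (λ q → D * (q + 0ℚ)) (∣p*q∣≡∣p∣*∣q∣ (x n) (y n)) ⟨
          D * (∣ x n * y n ∣ + 0ℚ)    ∎)
        nxy Null-zero
      where
      eq : ∀ a b d → a * (b * d) ≡ d * (a * b + 0ℚ)
      eq = solve-∀ ℚ-ring
    decide : ∃[ M ] ∀ n → M ℕ.≤ n → ∣ y n ∣ < ε
    decide with ∣ y N ∣ <? η + η
    ... | no  y≮2η = ⊥-elim (¬nx (x-null y≮2η))
    ... | yes y<2η = N , λ n N≤n → begin-strict
      ∣ y n ∣                   ≡⟨ cong ∣_∣ (split (y n) (y N)) ⟩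
      ∣ y N + (y n - y N) ∣     ≤⟨ ∣p+q∣≤∣p∣+∣q∣ (y N) (y n - y N) ⟩
      ∣ y N ∣ + ∣ y n - y N ∣   <⟨ +-mono-< y<2η (y-close n N≤n) ⟩
      η + η + η                 ≤⟨ p≤p+q (<⇒≤ 0<η) ⟩
      η + η + η + η             ≡⟨ 4η≡ε ⟩
      ε                         ∎

Null-cong : ∀ {a b} → (∀ n → a n ≡ b n) → Null a → Null b
Null-cong a≡b (mkNull na) = mkNull λ ε 0<ε → proj₁ (na ε 0<ε) , λ n N≤n →
  subst (λ q → ∣ q ∣ < ε) (a≡b n) (proj₂ (na ε 0<ε) n N≤n)

-- A real factor multiplies the two components separately, so `Null-cancel` applies to each of them
-- with x as the factor that is not null.
fromReal-cancel : ∀ {x z} → ¬ (x ≈ᴿ 0ᴿ) → fromReal x ⊗ z ≋ 0ᶜ → z ≋ 0ᶜ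
fromReal-cancel {x} {z} x≉0 (mk≈ re-≈ ℂ-ops.+i mk≈ im-≈) = ℂ-ops._+i_ {z} {0ᶜ}
  (component (re z) (Null-cong (λ n → eq (seq x n) (seq (re z) n) (seq (im z) n)) (mkNull re-≈)))
  (component (im z) (Null-cong (λ n → eq′ (seq x n) (seq (im z) n) (seq (re z) n)) (mkNull im-≈)))
  where
  eq : ∀ a b c → (a * b + - (0ℚ * c)) - 0ℚ ≡ a * b
  eq = solve-∀ ℚ-ring
  eq′ : ∀ a b c → (a * b + 0ℚ * c) - 0ℚ ≡ a * b
  eq′ = solve-∀ ℚ-ring
  component : ∀ y → Null (λ n → seq x n * seq y n) → y ≈ᴿ 0ᴿ
  component y nxy = mk≈ (small (Null-cong (λ n → sym (+-identityʳ (seq y n)))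
    (Null-cancel (cauchy y) nxy
      λ nx → x≉0 (mk≈ (small (Null-cong (λ n → sym (+-identityʳ (seq x n))) nx))))))
    where open Null

-- Square roots and reciprocals

Null-suc⁻¹ : Null suc⁻¹
Null-suc⁻¹ = mkNull λ ε 0<ε →
  let N , 1<Nε = archimedean-< 0<ε 1ℚ in N , λ n N≤n → begin-strict
    ∣ suc⁻¹ n ∣                    ≡⟨ 0≤p⇒∣p∣≡p (<⇒≤ (suc⁻¹-pos n)) ⟩
    suc⁻¹ n                        ≡⟨ *-identityʳ (suc⁻¹ n) ⟨
    suc⁻¹ n * 1ℚ                   <⟨ *-mono-<ˡ (suc⁻¹-pos n) 1<Nε ⟩
    suc⁻¹ n * (fromℕ (suc N) * ε)  ≤⟨ *-monoˡ (<⇒≤ (suc⁻¹-pos n)) (*-monoʳ (<⇒≤ 0<ε) (fromℕ-mono (ℕ.s≤s N≤n))) ⟩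
    suc⁻¹ n * (fromℕ (suc n) * ε)  ≡⟨ *-assoc (suc⁻¹ n) (fromℕ (suc n)) ε ⟨
    suc⁻¹ n * fromℕ (suc n) * ε    ≡⟨ cong (_* ε) (suc⁻¹-inverse n) ⟩
    1ℚ * ε                         ≡⟨ *-identityˡ ε ⟩
    ε                              ∎
  where open ≤-Reasoning

-- With s the n-th approximation and h = 1 / (n + 1), rounding down gives s² ≤ a ≤ (s + h)². The
-- error is at most (2s + h) h, where s is bounded and h is null.
√-square : ∀ a → √ a *ᴿ √ a ≈ᴿ fromℚ (fromℕ a)
√-square a =
  let C , 0≤C , N , s≤C = bounded (√-cauchy a)
  in mk≈ (small (Null-dominated {c = λ _ → 0ℚ} N {C + C + 1ℚ}
    (+-mono-≤-< (+-nonNeg 0≤C 0≤C) (positive⁻¹ 1ℚ))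
    (λ n N≤n → begin
      ∣ s n * s n - fromℕ a ∣
        ≡⟨ ∣-∣-sym (s n * s n) (fromℕ a) ⟩
      ∣ fromℕ a - s n * s n ∣
        ≡⟨ 0≤p⇒∣p∣≡p (subst (_≤ fromℕ a - s n * s n) (+-inverseʳ (s n * s n)) (+-monoˡ-≤ (- (s n * s n)) (s²≤a n))) ⟩
      fromℕ a - s n * s n
        ≤⟨ +-monoˡ-≤ (- (s n * s n)) (a≤ n) ⟩
      (s n + suc⁻¹ n) * (s n + suc⁻¹ n) - s n * s n
        ≡⟨ expand (s n) (suc⁻¹ n) ⟩
      (s n + s n + suc⁻¹ n) * suc⁻¹ n
        ≤⟨ *-monoʳ (<⇒≤ (suc⁻¹-pos n)) (+-mono-≤ (+-mono-≤ (s≤ n (s≤C n N≤n)) (s≤ n (s≤C n N≤n))) (suc⁻¹≤1 n)) ⟩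
      (C + C + 1ℚ) * suc⁻¹ n
        ≡⟨ cong ((C + C + 1ℚ) *_) (trans (sym (0≤p⇒∣p∣≡p (<⇒≤ (suc⁻¹-pos n)))) (sym (+-identityʳ _))) ⟩
      (C + C + 1ℚ) * (∣ suc⁻¹ n ∣ + 0ℚ) ∎)
    Null-suc⁻¹ Null-zero))
  where
  open Null
  open ≤-Reasoning
  s : ℕ → ℚ
  s = seq (√ a)
  s≤ : ∀ {C} n → ∣ s n ∣ ≤ C → s n ≤ C
  s≤ n = ≤-trans (p≤∣p∣ (s n))
  suc⁻¹≤1 : ∀ n → suc⁻¹ n ≤ 1ℚ
  suc⁻¹≤1 n = begin
    suc⁻¹ n                  ≡⟨ *-identityʳ (suc⁻¹ n) ⟨
    suc⁻¹ n * fromℕ 1        ≤⟨ *-monoˡ (<⇒≤ (suc⁻¹-pos n)) (fromℕ-mono (ℕ.s≤s (ℕ.z≤n {n}))) ⟩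
    suc⁻¹ n * fromℕ (suc n)  ≡⟨ suc⁻¹-inverse n ⟩
    1ℚ                       ∎
  expand : ∀ p q → (p + q) * (p + q) - p * p ≡ (p + p + q) * q
  expand = solve-∀ ℚ-ring
  interleave : ∀ p q → (p * q) * (p * q) ≡ (p * p) * (q * q)
  interleave = solve-∀ ℚ-ring
  scale : ∀ n → fromℕ (a ℕ.* (suc n ℕ.* suc n)) * (suc⁻¹ n * suc⁻¹ n) ≡ fromℕ a
  scale n = begin-equality
    fromℕ (a ℕ.* (suc n ℕ.* suc n)) * (suc⁻¹ n * suc⁻¹ n)
      ≡⟨ cong (_* (suc⁻¹ n * suc⁻¹ n)) (trans (fromℕ-* a (suc n ℕ.* suc n)) (cong (fromℕ a *_) (fromℕ-* (suc n) (suc n)))) ⟩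
    fromℕ a * (fromℕ (suc n) * fromℕ (suc n)) * (suc⁻¹ n * suc⁻¹ n)
      ≡⟨ eq (fromℕ a) (fromℕ (suc n)) (suc⁻¹ n) ⟩
    fromℕ a * ((suc⁻¹ n * fromℕ (suc n)) * (suc⁻¹ n * fromℕ (suc n)))
      ≡⟨ cong (λ q → fromℕ a * (q * q)) (suc⁻¹-inverse n) ⟩
    fromℕ a * (1ℚ * 1ℚ)
      ≡⟨ *-identityʳ (fromℕ a) ⟩
    fromℕ a ∎
    where
    eq : ∀ p q r → p * (q * q) * (r * r) ≡ p * ((r * q) * (r * q))
    eq = solve-∀ ℚ-ring
  0≤i² : ∀ n → 0ℚ ≤ suc⁻¹ n * suc⁻¹ n
  0≤i² n = *-nonNeg (<⇒≤ (suc⁻¹-pos n)) (<⇒≤ (suc⁻¹-pos n))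
  s²≤a : ∀ n → s n * s n ≤ fromℕ a
  s²≤a n = begin
    s n * s n
      ≡⟨ cong₂ _*_ (/-split (√-approx a n) n) (/-split (√-approx a n) n) ⟩
    (fromℕ k * suc⁻¹ n) * (fromℕ k * suc⁻¹ n)
      ≡⟨ interleave (fromℕ k) (suc⁻¹ n) ⟩
    (fromℕ k * fromℕ k) * (suc⁻¹ n * suc⁻¹ n)
      ≡⟨ cong (_* (suc⁻¹ n * suc⁻¹ n)) (fromℕ-* k k) ⟨
    fromℕ (k ℕ.* k) * (suc⁻¹ n * suc⁻¹ n)
      ≤⟨ *-monoʳ (0≤i² n) (fromℕ-mono (isqrt-≤ (a ℕ.* (suc n ℕ.* suc n)))) ⟩
    fromℕ (a ℕ.* (suc n ℕ.* suc n)) * (suc⁻¹ n * suc⁻¹ n)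
      ≡⟨ scale n ⟩
    fromℕ a ∎
    where k = √-approx a n
  a≤ : ∀ n → fromℕ a ≤ (s n + suc⁻¹ n) * (s n + suc⁻¹ n)
  a≤ n = begin
    fromℕ a
      ≡⟨ scale n ⟨
    fromℕ (a ℕ.* (suc n ℕ.* suc n)) * (suc⁻¹ n * suc⁻¹ n)
      ≤⟨ *-monoʳ (0≤i² n) (fromℕ-mono (ℕ.<⇒≤ (isqrt-> (a ℕ.* (suc n ℕ.* suc n))))) ⟩
    fromℕ (suc k ℕ.* suc k) * (suc⁻¹ n * suc⁻¹ n)
      ≡⟨ cong (_* (suc⁻¹ n * suc⁻¹ n)) (fromℕ-* (suc k) (suc k)) ⟩
    (fromℕ (suc k) * fromℕ (suc k)) * (suc⁻¹ n * suc⁻¹ n)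
      ≡⟨ interleave (fromℕ (suc k)) (suc⁻¹ n) ⟨
    (fromℕ (suc k) * suc⁻¹ n) * (fromℕ (suc k) * suc⁻¹ n)
      ≡⟨ cong₂ _*_ step step ⟩
    (s n + suc⁻¹ n) * (s n + suc⁻¹ n) ∎
    where
    k = √-approx a n
    eq : ∀ p q → (p + 1ℚ) * q ≡ p * q + q
    eq = solve-∀ ℚ-ring
    step : fromℕ (suc k) * suc⁻¹ n ≡ s n + suc⁻¹ n
    step = trans (cong (_* suc⁻¹ n) (fromℕ-suc k))
      (trans (eq (fromℕ k) (suc⁻¹ n)) (cong (_+ suc⁻¹ n) (sym (/-split k n))))

-- `recip` skips the first M terms, so its n-th term inverts the term of x at M + n rather than at
-- n. The discrepancy is a bounded factor times the difference of these two terms, which is null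
-- since x is Cauchy.
recip-inverse : ∀ x (0<x : 0ᴿ <ᴿ x) → recip x 0<x *ᴿ x ≈ᴿ 1ᴿ
recip-inverse x 0<x@(mk< δ 0<δ M δ≤x) =
  let C , 0≤C , N , r≤C = bounded (cauchy (recip x 0<x))
  in mk≈ (small (Null-dominated {b = λ n → seq x n - seq x (M ℕ.+ n)} {λ _ → 0ℚ} N {C + 1ℚ}
    (+-mono-≤-< 0≤C (positive⁻¹ 1ℚ))
    (λ n N≤n → begin
      ∣ r n * seq x n - 1ℚ ∣                    ≡⟨ cong (λ q → ∣ r n * seq x n - q ∣) (r-inverse n) ⟨
      ∣ r n * seq x n - r n * seq x (M ℕ.+ n) ∣ ≡⟨ cong ∣_∣ (factor (r n) (seq x n) (seq x (M ℕ.+ n))) ⟩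
      ∣ r n * (seq x n - seq x (M ℕ.+ n)) ∣     ≡⟨ ∣p*q∣≡∣p∣*∣q∣ (r n) (seq x n - seq x (M ℕ.+ n)) ⟩
      ∣ r n ∣ * ∣ seq x n - seq x (M ℕ.+ n) ∣
        ≤⟨ *-monoʳ (0≤∣p∣ (seq x n - seq x (M ℕ.+ n))) (≤-trans (r≤C n N≤n) (p≤p+q (nonNegative⁻¹ 1ℚ))) ⟩
      (C + 1ℚ) * ∣ seq x n - seq x (M ℕ.+ n) ∣  ≡⟨ cong ((C + 1ℚ) *_) (+-identityʳ _) ⟨
      (C + 1ℚ) * (∣ seq x n - seq x (M ℕ.+ n) ∣ + 0ℚ) ∎)
    (shift (cauchy x)) Null-zero))
  where
  open Null
  open ≤-Reasoning
  r : ℕ → ℚ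
  r = seq (recip x 0<x)
  factor : ∀ p q q′ → p * q - p * q′ ≡ p * (q - q′)
  factor = solve-∀ ℚ-ring
  r-inverse : ∀ n → r n * seq x (M ℕ.+ n) ≡ 1ℚ
  r-inverse n = *-inverseˡ (seq x (M ℕ.+ n)) {{_}}
  shift : ∀ {y} → IsCauchy y → Null (λ n → y n - y (M ℕ.+ n))
  shift (mkCauchy cy) = mkNull λ ε 0<ε → proj₁ (cy ε 0<ε) , λ n N≤n →
    proj₂ (cy ε 0<ε) n (M ℕ.+ n) N≤n (ℕ.≤-trans N≤n (ℕ.m≤n+m n M))

fromReal-cong : ∀ {x y} → x ≈ᴿ y → fromReal x ≋ fromReal y
fromReal-cong {x} {y} x≈y = ℂ-ops._+i_ {fromReal x} {fromReal y} x≈y (pointwise-≈ λ _ → refl)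

fromReal-* : ∀ x y → fromReal (x *ᴿ y) ≋ fromReal x ⊗ fromReal y
fromReal-* x y = pointwise λ n → cong₂ ℚ[i]._+i_ (eq (seq x n) (seq y n)) (eq′ (seq x n) (seq y n))
  where
  eq : ∀ a b → a * b ≡ a * b + - (0ℚ * 0ℚ)
  eq = solve-∀ ℚ-ring
  eq′ : ∀ a b → 0ℚ ≡ a * 0ℚ + 0ℚ * b
  eq′ = solve-∀ ℚ-ring

recip-square : ∀ {x y} (0<x : 0ᴿ <ᴿ x) → x *ᴿ x ≈ᴿ y → let s = fromReal (recip x 0<x) in
  (s ⊗ s) ⊗ fromReal y ≋ 1ᶜ
recip-square {x} {y} 0<x x²≈y = begin
  (s ⊗ s) ⊗ fromReal y         ≈⟨ C.*-congˡ {s ⊗ s} (fromReal-cong x²≈y) ⟨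
  (s ⊗ s) ⊗ fromReal (x *ᴿ x)  ≈⟨ C.*-congˡ {s ⊗ s} (fromReal-* x x) ⟩
  (s ⊗ s) ⊗ (t ⊗ t)            ≈⟨ pointwise (λ n → eq (s at n) (t at n)) ⟩
  (s ⊗ t) ⊗ (s ⊗ t)            ≈⟨ C.*-cong st≋1 st≋1 ⟩
  1ᶜ ⊗ 1ᶜ                      ≈⟨ C.*-identityˡ 1ᶜ ⟩
  1ᶜ                           ∎
  where
  open SetoidReasoning C.setoid
  s t : ℂ
  s = fromReal (recip x 0<x)
  t = fromReal x
  st≋1 : s ⊗ t ≋ 1ᶜ
  st≋1 = C.trans (C.sym (fromReal-* (recip x 0<x) x)) (fromReal-cong (recip-inverse x 0<x))
  eq : ∀ s t → (s ⊠ s) ⊠ (t ⊠ t) ≡ (s ⊠ t) ⊠ (s ⊠ t)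
  eq = solve-∀ ℚi-acr

-- The primitive twelfth root of unity

exp-imaginary : ∀ x → conj (exp (fromReal x ⊗ 𝕚)) ⊗ exp (fromReal x ⊗ 𝕚) ≋ 1ᶜ
exp-imaginary x = begin
  conj (exp z) ⊗ exp z   ≈⟨ C.*-congʳ {exp z} (conj-exp z) ⟩
  exp (conj z) ⊗ exp z   ≈⟨ exp-⊕ (conj z) z ⟩
  exp (conj z ⊕ z)
    ≈⟨ exp-cong {conj z ⊕ z} {0ᶜ} (pointwise λ n → cong₂ ℚ[i]._+i_ (eq (seq x n)) (eq′ (seq x n))) ⟩
  exp 0ᶜ                 ≈⟨ exp-0 ⟩
  1ᶜ                     ∎
  where
  open SetoidReasoning C.setoid
  z : ℂ
  z = fromReal x ⊗ 𝕚
  eq : ∀ a → (a * 0ℚ + - (0ℚ * 1ℚ)) + (a * 0ℚ + - (0ℚ * 1ℚ)) ≡ 0ℚ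
  eq = solve-∀ ℚ-ring
  eq′ : ∀ a → - (a * 1ℚ + 0ℚ * 0ℚ) + (a * 1ℚ + 0ℚ * 0ℚ) ≡ 0ℚ
  eq′ = solve-∀ ℚ-ring

-- These two relations carry all information about θ into the algebraic part: the first makes
-- conjugation inversion on powers of θ, the second says that the twelfth cyclotomic polynomial
-- vanishes at θ.
record IsPrimitiveTwelfthRoot (θ : ℂ) : Set where
  field
    unimodular : conj θ ⊗ θ ≋ 1ᶜ
    cyclotomic : θ ^ 4 ⊕ ⊖ (θ ^ 2) ⊕ 1ᶜ ≋ 0ᶜ

cyclotomic-root : ∀ {θ} → conj θ ⊗ θ ≋ 1ᶜ → θ ^ 3 ⊗ θ ^ 3 ≋ ⊖ 1ᶜ → ¬ (re θ ≈ᴿ 0ᴿ) → IsPrimitiveTwelfthRoot θ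
cyclotomic-root {θ} θ̄θ≋1 θ⁶≋-1 re≉0 = record { unimodular = θ̄θ≋1 ; cyclotomic = q≋0 }
  where
  open SetoidReasoning C.setoid
  c q : ℂ
  c = fromReal (re θ)
  q = θ ^ 4 ⊕ ⊖ (θ ^ 2) ⊕ 1ᶜ
  -- This is (t + t̄) t q = t⁶ + 1 + (t̄ t - 1) q. The correction term carries unimodularity, so the
  -- identity holds for independent t and t̄ and can be checked in ℚ[i]; powers are spelled out as
  -- `_^_` unfolds them.
  factor : ∀ t t̄ → (t ⊞ t̄) ⊠ (t ⊠ (t ⊠ (t ⊠ (t ⊠ (t ⊠ ℚ[i].fromReal 1ℚ))) ⊞ ⊟ (t ⊠ (t ⊠ ℚ[i].fromReal 1ℚ)) ⊞ ℚ[i].fromReal 1ℚ)) ≡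
    ((t ⊠ (t ⊠ (t ⊠ ℚ[i].fromReal 1ℚ))) ⊠ (t ⊠ (t ⊠ (t ⊠ ℚ[i].fromReal 1ℚ))) ⊞ ℚ[i].fromReal 1ℚ)
      ⊞ (t̄ ⊠ t ⊞ ⊟ ℚ[i].fromReal 1ℚ) ⊠ (t ⊠ (t ⊠ (t ⊠ (t ⊠ ℚ[i].fromReal 1ℚ))) ⊞ ⊟ (t ⊠ (t ⊠ ℚ[i].fromReal 1ℚ)) ⊞ ℚ[i].fromReal 1ℚ)
  factor = solve-∀ ℚi-acr
  -- (θ² + 1) (θ⁴ - θ² + 1) = θ⁶ + 1, where θ² + 1 = 2 θ cos (π / 6)
  cyc : c ⊗ (θ ⊗ q ⊕ θ ⊗ q) ≋ 0ᶜ
  cyc = begin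
    c ⊗ (θ ⊗ q ⊕ θ ⊗ q)
      ≈⟨ pointwise (λ n → double (c at n) ((θ ⊗ q) at n)) ⟩
    (c ⊕ c) ⊗ (θ ⊗ q)
      ≈⟨ C.*-congʳ (⊕-conj θ) ⟨
    (θ ⊕ conj θ) ⊗ (θ ⊗ q)
      ≈⟨ pointwise (λ n → factor (θ at n) (conj θ at n)) ⟩
    (θ ^ 3 ⊗ θ ^ 3 ⊕ 1ᶜ) ⊕ (conj θ ⊗ θ ⊕ ⊖ 1ᶜ) ⊗ q
      ≈⟨ C.+-cong (C.+-congʳ θ⁶≋-1) (C.*-congʳ (C.+-congʳ θ̄θ≋1)) ⟩
    (⊖ 1ᶜ ⊕ 1ᶜ) ⊕ (1ᶜ ⊕ ⊖ 1ᶜ) ⊗ q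
      ≈⟨ C.+-cong (C.-‿inverseˡ 1ᶜ) (C.trans (C.*-congʳ (C.-‿inverseʳ 1ᶜ)) (C.zeroˡ q)) ⟩
    0ᶜ ⊕ 0ᶜ
      ≈⟨ C.+-identityˡ 0ᶜ ⟩
    0ᶜ ∎
    where
    double : ∀ a b → a ⊠ (b ⊞ b) ≡ (a ⊞ a) ⊠ b
    double = solve-∀ ℚi-acr
  q≋0 : q ≋ 0ᶜ
  q≋0 = begin
    q                                            ≈⟨ C.*-identityˡ q ⟨
    1ᶜ ⊗ q                                       ≈⟨ C.*-congʳ θ̄θ≋1 ⟨
    -- Multiplication by half of `conj θ` undoes the factor 2θ that remains after cos(π/6) is
    -- cancelled.
    (conj θ ⊗ θ) ⊗ q                             ≈⟨ pointwise (λ n → halve (conj θ at n) (θ at n) (q at n)) ⟩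
    embed ½ ⊗ conj θ ⊗ (θ ⊗ q ⊕ θ ⊗ q)
      ≈⟨ C.*-congˡ (fromReal-cancel {re θ} {θ ⊗ q ⊕ θ ⊗ q} re≉0 cyc) ⟩
    embed ½ ⊗ conj θ ⊗ 0ᶜ                        ≈⟨ C.zeroʳ _ ⟩
    0ᶜ                                           ∎
    where
    halve : ∀ t̄ t q → (t̄ ⊠ t) ⊠ q ≡ ℚ[i].fromReal ½ ⊠ t̄ ⊠ (t ⊠ q ⊞ t ⊠ q)
    halve = solve-∀ ℚi-acr

module _ {π : ℝ} (isPi : IsPi π) where
  open IsPi isPi
  private
    θ ω : ℂ
    θ = exp (fromReal (π *ᴿ fromℚ (+ 1 / 6)) ⊗ 𝕚)
    ω = exp (fromReal (π *ᴿ fromℚ ½) ⊗ 𝕚)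
    open SetoidReasoning C.setoid

    -- `cos` is defined with 𝕚 on the left, while θ has it on the right.
    exp-comm : ∀ x → exp (𝕚 ⊗ fromReal x) ≋ exp (fromReal x ⊗ 𝕚)
    exp-comm x = exp-cong {𝕚 ⊗ fromReal x} {fromReal x ⊗ 𝕚} (C.*-comm 𝕚 (fromReal x))

    θ³≋ω : θ ^ 3 ≋ ω
    θ³≋ω = begin
      θ ⊗ (θ ⊗ (θ ⊗ 1ᶜ))     ≈⟨ C.*-congˡ {θ} (C.*-congˡ {θ} (C.*-identityʳ θ)) ⟩
      θ ⊗ (θ ⊗ θ)            ≈⟨ C.*-congˡ {θ} (exp-⊕ z z) ⟩
      θ ⊗ exp (z ⊕ z)        ≈⟨ exp-⊕ z (z ⊕ z) ⟩
      exp (z ⊕ (z ⊕ z))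
        ≈⟨ exp-cong {z ⊕ (z ⊕ z)} (pointwise λ n → cong₂ ℚ[i]._+i_ (eq (seq π n)) (eq′ (seq π n))) ⟩
      ω                      ∎
      where
      z : ℂ
      z = fromReal (π *ᴿ fromℚ (+ 1 / 6)) ⊗ 𝕚
      eq : ∀ p → let a = (p * (+ 1 / 6)) * 0ℚ + - (0ℚ * 1ℚ) in a + (a + a) ≡ (p * ½) * 0ℚ + - (0ℚ * 1ℚ)
      eq = solve-∀ ℚ-ring
      eq′ : ∀ p → let a = (p * (+ 1 / 6)) * 1ℚ + 0ℚ * 0ℚ in a + (a + a) ≡ (p * ½) * 1ℚ + 0ℚ * 0ℚ
      eq′ = solve-∀ ℚ-ring

    -- Every z satisfies z² = 2 Re(z) z - |z|²; for ω the real part is cos(π/2) = 0 and the modulus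
    -- is 1.
    ω² : ω ⊗ ω ≋ ⊖ 1ᶜ
    ω² = begin
      ω ⊗ ω                                ≈⟨ pointwise (λ n → eq (ω at n) (conj ω at n)) ⟩
      (ω ⊕ conj ω) ⊗ ω ⊕ ⊖ (conj ω ⊗ ω)
        ≈⟨ C.+-cong (C.*-congʳ {ω} ω+ω̄) (C.-‿cong (exp-imaginary (π *ᴿ fromℚ ½))) ⟩
      0ᶜ ⊗ ω ⊕ ⊖ 1ᶜ                        ≈⟨ C.+-congʳ (C.zeroˡ ω) ⟩
      0ᶜ ⊕ ⊖ 1ᶜ                            ≈⟨ C.+-identityˡ (⊖ 1ᶜ) ⟩
      ⊖ 1ᶜ                                 ∎
      where
      eq : ∀ w w̄ → w ⊠ w ≡ (w ⊞ w̄) ⊠ w ⊞ ⊟ (w̄ ⊠ w)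
      eq = solve-∀ ℚi-acr
      re-ω : fromReal (re ω) ≋ 0ᶜ
      re-ω = C.trans
        (fromReal-cong {re ω} (ℂ-ops._≋_.re-≈ (C.sym (exp-comm (π *ᴿ fromℚ ½)))))
        (fromReal-cong {cos (π *ᴿ fromℚ ½)} {0ᴿ} cos-zero)
      ω+ω̄ : ω ⊕ conj ω ≋ 0ᶜ
      ω+ω̄ = begin
        ω ⊕ conj ω                        ≈⟨ ⊕-conj ω ⟩
        fromReal (re ω) ⊕ fromReal (re ω) ≈⟨ C.+-cong re-ω re-ω ⟩
        0ᶜ ⊕ 0ᶜ                           ≈⟨ C.+-identityˡ 0ᶜ ⟩
        0ᶜ                                ∎

    cos-π/6≉0 : ¬ (re θ ≈ᴿ 0ᴿ)
    cos-π/6≉0 cos≈0 = least (π *ᴿ fromℚ (+ 1 / 6)) 0<π/6 π/6<π/2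
      (ℂ-ops._≋_.re-≈ (C.trans (fromReal-cong {cos (π *ᴿ fromℚ (+ 1 / 6))} (ℂ-ops._≋_.re-≈ (exp-comm (π *ᴿ fromℚ (+ 1 / 6)))))
                       (fromReal-cong {re θ} {0ᴿ} cos≈0)))
      where
      -- Both inequalities compare rational multiples of π, so the gap witnessing 0 < π, times the
      -- difference q of the coefficients, is a gap for them.
      scaled : ∀ x y q → 0ℚ < q → (∀ n → seq π n * q ≡ seq y n - seq x n) → x <ᴿ y
      scaled x y q 0<q πq≡y-x = let mk< δ 0<δ N δ≤π = π-positive in
        mk< (δ * q) (*-pos 0<δ 0<q) N λ n N≤n →
          ≤-trans (*-monoʳ (<⇒≤ 0<q) (≤-trans (δ≤π n N≤n) (≤-reflexive (+-identityʳ (seq π n)))))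
            (≤-reflexive (πq≡y-x n))
      π/6<π/2 : π *ᴿ fromℚ (+ 1 / 6) <ᴿ π *ᴿ fromℚ ½
      π/6<π/2 = scaled _ _ (+ 1 / 3) (positive⁻¹ (+ 1 / 3)) (λ n → eq (seq π n))
        where
        eq : ∀ a → a * (+ 1 / 3) ≡ a * ½ - a * (+ 1 / 6)
        eq = solve-∀ ℚ-ring
      0<π/6 : 0ᴿ <ᴿ π *ᴿ fromℚ (+ 1 / 6)
      0<π/6 = scaled _ _ (+ 1 / 6) (positive⁻¹ (+ 1 / 6)) (λ n → eq (seq π n))
        where
        eq : ∀ a → a * (+ 1 / 6) ≡ a * (+ 1 / 6) - 0ℚ
        eq = solve-∀ ℚ-ring

  exp[iπ/6]-isPrimitive : IsPrimitiveTwelfthRoot (exp (fromReal (π *ᴿ fromℚ (+ 1 / 6)) ⊗ 𝕚))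
  exp[iπ/6]-isPrimitive = cyclotomic-root {θ} (exp-imaginary (π *ᴿ fromℚ (+ 1 / 6)))
    (C.trans (C.*-cong θ³≋ω θ³≋ω) ω²) cos-π/6≉0

-- Exponents modulo 12

-- An element (a , b , c , d) stands for a + bX + cX² + dX³ modulo X⁴ - X² + 1.
ℚ[ζ] : Set
ℚ[ζ] = ℚ × ℚ × ℚ × ℚ

infixl 6 _⊹_
_⊹_ : ℚ[ζ] → ℚ[ζ] → ℚ[ζ]
(a , b , c , d) ⊹ (a′ , b′ , c′ , d′) = a + a′ , b + b′ , c + c′ , d + d′

constant : ℚ → ℚ[ζ]
constant q = q , 0ℚ , 0ℚ , 0ℚ

-- Multiplication by X, where the overflow dX⁴ becomes dX² - d.
ζ* : ℚ[ζ] → ℚ[ζ]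
ζ* (a , b , c , d) = - d , a , b + d , c

ζ^ : ℕ → ℚ[ζ]
ζ^ zero    = constant 1ℚ
ζ^ (suc n) = ζ* (ζ^ n)

Σζ : ∀ {n} → (Fin n → ℚ[ζ]) → ℚ[ζ]
Σζ {zero}  f = constant 0ℚ
Σζ {suc n} f = f zero ⊹ Σζ (λ k → f (suc k))

Exponents : Set
Exponents = Fin 6 → Fin 6 → ℕ

-- Since conj θ = θ¹¹, this is the inner product of the vectors θ ^ x i and θ ^ x j.
gram : Exponents → Fin 6 → Fin 6 → ℚ[ζ]
gram x i j = Σζ (λ k → ζ^ ((11 ℕ.* x i k ℕ.+ x j k) ℕ.% 12))

-- The exponents of a Butson-type complex Hadamard matrix of order 6 over the twelfth roots of
-- unity: its Gram matrix is 6 times the identity, here as a formal identity in ℚ[ζ] that can be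
-- decided.
IsButson : Exponents → Set
IsButson x = ∀ i j → gram x i j ≡ (if does (i Fin.≟ j) then constant (fromℕ 6) else constant 0ℚ)

isButson? : ∀ x → Dec (IsButson x)
isButson? x = Fin.all? λ i → Fin.all? λ j → ≡-dec _≟_ (≡-dec _≟_ (≡-dec _≟_ _≟_)) (gram x i j) _

row-exponents column-exponents : Fin 6 → Exponents
row-exponents    i j k = toℕ (A k i) ℕ.+ toℕ (B k j)
column-exponents j i k = toℕ (A k i) ℕ.+ toℕ (B k j)

abstract
  rows-Butson : ∀ i → IsButson (row-exponents i)
  rows-Butson = from-yes (Fin.all? λ i → isButson? (row-exponents i))

  rows-Butsonᵀ : ∀ i → IsButson (transpose (row-exponents i))
  rows-Butsonᵀ = from-yes (Fin.all? λ i → isButson? (transpose (row-exponents i)))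

  columns-Butson : ∀ j → IsButson (column-exponents j)
  columns-Butson = from-yes (Fin.all? λ j → isButson? (column-exponents j))

  columns-Butsonᵀ : ∀ j → IsButson (transpose (column-exponents j))
  columns-Butsonᵀ = from-yes (Fin.all? λ j → isButson? (transpose (column-exponents j)))

  K-exponents : ∀ r s → A s (transposition (# 4) (# 5) ⟨$⟩ʳ r) ≡ B r s
  K-exponents = from-yes (Fin.all? λ r → Fin.all? λ s → A s (transposition (# 4) (# 5) ⟨$⟩ʳ r) Fin.≟ B r s)

-- Classes of positions and finite checks on exponents

Position : Set
Position = Fin 6 × Fin 6

exponent : Position → Fin 6 → ℕ
exponent (i , j) r = toℕ (A r i) ℕ.+ toℕ (B r j)

-- The entry at (4 , 1), whose index is 25, equals the one at (0 , 4).
class : Position → Fin 35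
class (i , j) with # 25 Fin.≟ combine i j
... | yes _     = # 4
... | no  25≢ij = punchOut 25≢ij

abstract
  exponent-0 : ∀ i j → exponent (i , j) zero ≡ 0
  exponent-0 = from-yes (Fin.all? λ i → Fin.all? λ j → exponent (i , j) zero ℕ.≟ 0)

  class-≡ : ∀ i j k l → class (i , j) ≡ class (k , l) →
    ∀ r → exponent (i , j) r ℕ.% 12 ≡ exponent (k , l) r ℕ.% 12
  class-≡ = from-yes (Fin.all? λ i → Fin.all? λ j → Fin.all? λ k → Fin.all? λ l →
    (class (i , j) Fin.≟ class (k , l)) →-dec
    Fin.all? λ r → exponent (i , j) r ℕ.% 12 ℕ.≟ exponent (k , l) r ℕ.% 12)

  -- Since 11 is -1 modulo 12, the expression is the difference of the two exponents; it is written
  -- in the form that `conj θ ≋ θ ^ 11` produces.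
  class-≢ : ∀ i j k l → ¬ (class (i , j) ≡ class (k , l)) →
    ∃[ r ] ¬ ((11 ℕ.* exponent (k , l) r ℕ.+ exponent (i , j) r) ℕ.% 12 ≡ 0)
  class-≢ = from-yes (Fin.all? λ i → Fin.all? λ j → Fin.all? λ k → Fin.all? λ l →
    ¬? (class (i , j) Fin.≟ class (k , l)) →-dec
    Fin.any? λ r → ¬? ((11 ℕ.* exponent (k , l) r ℕ.+ exponent (i , j) r) ℕ.% 12 ℕ.≟ 0))

  ζ^12≡1 : ζ^ 12 ≡ constant 1ℚ
  ζ^12≡1 = refl

  ζ^6≡-1 : ζ^ 6 ≡ constant (- 1ℚ)
  ζ^6≡-1 = refl

  1+ζ⁴+ζ⁸≡0 : ζ^ 0 ⊹ (ζ^ 4 ⊹ ζ^ 8) ≡ constant 0ℚ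
  1+ζ⁴+ζ⁸≡0 = refl

  2≮1 : ¬ (∣ - 1ℚ - 1ℚ ∣ < 1ℚ)
  2≮1 = from-no (∣ - 1ℚ - 1ℚ ∣ <? 1ℚ)

  3≮1 : ¬ (∣ 0ℚ - fromℕ 3 ∣ < 1ℚ)
  3≮1 = from-no (∣ 0ℚ - fromℕ 3 ∣ <? 1ℚ)

  class-surjective : ∀ c → ∃[ p ] class p ≡ c
  class-surjective c =
    let i , j , ij≡c = from-yes (Fin.all? λ c → Fin.any? λ i → Fin.any? λ j → class (i , j) Fin.≟ c) c
    in (i , j) , ij≡c

  -- A nontrivial twelfth root of unity has a power of order 2 or 3.
  torsion : ∀ d → ¬ (toℕ {12} d ≡ 0) →
    ∃[ m ] ((toℕ d ℕ.* toℕ {12} m) ℕ.% 12 ≡ 6 ⊎ (toℕ d ℕ.* toℕ {12} m) ℕ.% 12 ≡ 4)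
  torsion = from-yes (Fin.all? λ (d : Fin 12) → ¬? (toℕ d ℕ.≟ 0) →-dec Fin.any? λ (m : Fin 12) →
    ((toℕ d ℕ.* toℕ m) ℕ.% 12 ℕ.≟ 6) ⊎-dec ((toℕ d ℕ.* toℕ m) ℕ.% 12 ℕ.≟ 4))

-- Orthonormal bases

δ-sym : ∀ {n} (i j : Fin n) → δ i j ≡ δ j i
δ-sym zero    zero    = refl
δ-sym zero    (suc j) = refl
δ-sym (suc i) zero    = refl
δ-sym (suc i) (suc j) = δ-sym i j

δ-refl : ∀ {n} (i : Fin n) → δ i i ≡ 1ᶜ
δ-refl zero    = refl
δ-refl (suc i) = δ-refl i

sum-δ : ∀ {n} (i : Fin n) f → sum (λ j → δ i j ⊗ f j) ≋ f i
sum-δ {suc n} zero f = begin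
  1ᶜ ⊗ f zero ⊕ sum (λ j → 0ᶜ ⊗ f (suc j))
    ≈⟨ C.+-cong (C.*-identityˡ (f zero)) (sum-cong-≋ λ j → C.zeroˡ (f (suc j))) ⟩
  f zero ⊕ sum {n} (λ _ → 0ᶜ)                  ≈⟨ C.+-congˡ (sum-replicate-zero n) ⟩
  f zero ⊕ 0ᶜ                              ≈⟨ C.+-identityʳ (f zero) ⟩
  f zero                                   ∎
  where open SetoidReasoning C.setoid
sum-δ {suc n} (suc i) f = begin
  0ᶜ ⊗ f zero ⊕ sum (λ j → δ i j ⊗ f (suc j)) ≈⟨ C.+-cong (C.zeroˡ (f zero)) (sum-δ i (λ j → f (suc j))) ⟩
  0ᶜ ⊕ f (suc i)                              ≈⟨ C.+-identityˡ (f (suc i)) ⟩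
  f (suc i)                                   ∎
  where open SetoidReasoning C.setoid

Orthonormal : ∀ {m n} → (Fin m → ℂ^ n) → Set
Orthonormal b = ∀ i j → ⟨ b i , b j ⟩ ≋ δ i j

-- Orthonormality of the transpose is the completeness relation Σᵢ bᵢ bᵢ* = 1.
orthonormalBasis : ∀ {n} {b : Fin n → ℂ^ n} → Orthonormal b → Orthonormal (transpose b) → IsOrthonormalBasis b
orthonormalBasis {n} {b} rows columns = record
  { orthonormal = rows
  ; independent = λ c c·b≋0 i → begin
      c i                                            ≈⟨ sum-δ i c ⟨
      sum (λ j → δ i j ⊗ c j)                        ≈⟨ sum-cong-≋ (λ j → C.*-congʳ (rows i j)) ⟨
      sum (λ j → ⟨ b i , b j ⟩ ⊗ c j)
        ≈⟨ sum-cong-≋ (λ j → *-distribʳ-sum (c j) (λ k → conj (b i k) ⊗ b j k)) ⟩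
      sum (λ j → sum (λ k → conj (b i k) ⊗ b j k ⊗ c j)) ≈⟨ ∑-comm (λ j k → conj (b i k) ⊗ b j k ⊗ c j) ⟩
      sum (λ k → sum (λ j → conj (b i k) ⊗ b j k ⊗ c j))
        ≈⟨ sum-cong-≋ (λ k → sum-cong-≋ λ j → swap (conj (b i k)) (b j k) (c j)) ⟩
      sum (λ k → sum (λ j → conj (b i k) ⊗ (c j ⊗ b j k)))
        ≈⟨ sum-cong-≋ (λ k → *-distribˡ-sum (conj (b i k)) (λ j → c j ⊗ b j k)) ⟨
      sum (λ k → conj (b i k) ⊗ linearCombination c b k)
        ≈⟨ sum-cong-≋ (λ k → C.trans (C.*-congˡ (c·b≋0 k)) (C.zeroʳ (conj (b i k)))) ⟩
      sum {n} (λ _ → 0ᶜ)                             ≈⟨ sum-replicate-zero n ⟩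
      0ᶜ                                             ∎
  ; spanning = λ v → (λ i → ⟨ b i , v ⟩) , λ k → begin
      sum (λ i → ⟨ b i , v ⟩ ⊗ b i k)
        ≈⟨ sum-cong-≋ (λ i → *-distribʳ-sum (b i k) (λ l → conj (b i l) ⊗ v l)) ⟩
      sum (λ i → sum (λ l → conj (b i l) ⊗ v l ⊗ b i k)) ≈⟨ ∑-comm (λ i l → conj (b i l) ⊗ v l ⊗ b i k) ⟩
      sum (λ l → sum (λ i → conj (b i l) ⊗ v l ⊗ b i k))
        ≈⟨ sum-cong-≋ (λ l → sum-cong-≋ λ i → swap′ (conj (b i l)) (v l) (b i k)) ⟩
      sum (λ l → sum (λ i → conj (b i l) ⊗ b i k ⊗ v l))
        ≈⟨ sum-cong-≋ (λ l → *-distribʳ-sum (v l) (λ i → conj (b i l) ⊗ b i k)) ⟨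
      sum (λ l → sum (λ i → conj (b i l) ⊗ b i k) ⊗ v l)
        ≈⟨ sum-cong-≋ (λ l → C.*-congʳ (C.trans (columns l k) (C.reflexive (δ-sym l k)))) ⟩
      sum (λ l → δ k l ⊗ v l)                        ≈⟨ sum-δ k v ⟩
      v k                                            ∎
  }
  where
  open SetoidReasoning C.setoid
  swap : ∀ x y z → x ⊗ y ⊗ z ≋ x ⊗ (z ⊗ y)
  swap x y z = C.trans (C.*-assoc x y z) (C.*-congˡ (C.*-comm y z))
  swap′ : ∀ x y z → x ⊗ y ⊗ z ≋ x ⊗ z ⊗ y
  swap′ x y z = C.trans (swap x y z) (C.sym (C.*-assoc x z y))

-- Powers of θ and the evaluation of ℚ[ζ] in ℂ

1^ : ∀ n → 1ᶜ ^ n ≋ 1ᶜ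
1^ zero    = C.refl
1^ (suc n) = C.trans (C.*-identityˡ (1ᶜ ^ n)) (1^ n)

^-periodic : ∀ z m .{{_ : ℕ.NonZero m}} → z ^ m ≋ 1ᶜ → ∀ n → z ^ n ≋ z ^ (n ℕ.% m)
^-periodic z m zᵐ≋1 n = begin
  z ^ n
    ≈⟨ ^-congʳ z (trans (m≡m%n+[m/n]*n n m) (cong (n ℕ.% m ℕ.+_) (ℕ.*-comm (n ℕ./ m) m))) ⟩
  z ^ (n ℕ.% m ℕ.+ m ℕ.* (n ℕ./ m))        ≈⟨ ^-homo-* z (n ℕ.% m) (m ℕ.* (n ℕ./ m)) ⟩
  z ^ (n ℕ.% m) ⊗ z ^ (m ℕ.* (n ℕ./ m))    ≈⟨ C.*-congˡ (^-assocʳ z m (n ℕ./ m)) ⟨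
  z ^ (n ℕ.% m) ⊗ (z ^ m) ^ (n ℕ./ m)      ≈⟨ C.*-congˡ (C.trans (^-congˡ (n ℕ./ m) zᵐ≋1) (1^ (n ℕ./ m))) ⟩
  z ^ (n ℕ.% m) ⊗ 1ᶜ                       ≈⟨ C.*-identityʳ (z ^ (n ℕ.% m)) ⟩
  z ^ (n ℕ.% m)                            ∎
  where open SetoidReasoning C.setoid

conj-^-power : ∀ z m → conj z ≋ z ^ m → ∀ n → conj (z ^ n) ≋ z ^ (m ℕ.* n)
conj-^-power z m z̄≋zᵐ n = C.trans (conj-^ z n) (C.trans (^-congˡ n z̄≋zᵐ) (^-assocʳ z m n))

module _ {θ : ℂ} (root : IsPrimitiveTwelfthRoot θ) where
  open IsPrimitiveTwelfthRoot root
  open SetoidReasoning C.setoid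

  -- Evaluation is transported along constants, sums and multiplication by X; products of entries
  -- are already single powers of θ.
  eval : ℚ[ζ] → ℂ
  eval (a , b , c , d) = embed a ⊕ embed b ⊗ θ ⊕ embed c ⊗ θ ^ 2 ⊕ embed d ⊗ θ ^ 3

  eval-⊹ : ∀ u v → eval (u ⊹ v) ≋ eval u ⊕ eval v
  eval-⊹ (a , b , c , d) (a′ , b′ , c′ , d′) = pointwise λ n →
    eq (θ at n) (embed a at n) (embed b at n) (embed c at n) (embed d at n)
       (embed a′ at n) (embed b′ at n) (embed c′ at n) (embed d′ at n)
    where
    eq : ∀ t a b c d a′ b′ c′ d′ →
      (a ⊞ a′) ⊞ (b ⊞ b′) ⊠ t ⊞ (c ⊞ c′) ⊠ (t ⊠ (t ⊠ ℚ[i].fromReal 1ℚ)) ⊞ (d ⊞ d′) ⊠ (t ⊠ (t ⊠ (t ⊠ ℚ[i].fromReal 1ℚ))) ≡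
      (a ⊞ b ⊠ t ⊞ c ⊠ (t ⊠ (t ⊠ ℚ[i].fromReal 1ℚ)) ⊞ d ⊠ (t ⊠ (t ⊠ (t ⊠ ℚ[i].fromReal 1ℚ)))) ⊞
      (a′ ⊞ b′ ⊠ t ⊞ c′ ⊠ (t ⊠ (t ⊠ ℚ[i].fromReal 1ℚ)) ⊞ d′ ⊠ (t ⊠ (t ⊠ (t ⊠ ℚ[i].fromReal 1ℚ))))
    eq = solve-∀ ℚi-acr

  eval-constant : ∀ q → eval (constant q) ≋ embed q
  eval-constant q = pointwise λ n → eq (θ at n) (embed q at n)
    where
    eq : ∀ t a → a ⊞ ℚ[i].fromReal 0ℚ ⊠ t ⊞ ℚ[i].fromReal 0ℚ ⊠ (t ⊠ (t ⊠ ℚ[i].fromReal 1ℚ)) ⊞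
      ℚ[i].fromReal 0ℚ ⊠ (t ⊠ (t ⊠ (t ⊠ ℚ[i].fromReal 1ℚ))) ≡ a
    eq = solve-∀ ℚi-acr

  -- The two sides differ by d times the cyclotomic relation, where d is the leading coefficient of
  -- v.
  eval-ζ* : ∀ v → θ ⊗ eval v ≋ eval (ζ* v)
  eval-ζ* v@(a , b , c , d) = begin
    θ ⊗ eval v
      ≈⟨ pointwise (λ n → eq (θ at n) (embed a at n) (embed b at n) (embed c at n) (embed d at n)) ⟩
    eval (ζ* v) ⊕ embed d ⊗ (θ ^ 4 ⊕ ⊖ (θ ^ 2) ⊕ 1ᶜ)
      ≈⟨ C.+-congˡ (C.trans (C.*-congˡ cyclotomic) (C.zeroʳ (embed d))) ⟩
    eval (ζ* v) ⊕ 0ᶜ                                  ≈⟨ C.+-identityʳ (eval (ζ* v)) ⟩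
    eval (ζ* v)                                       ∎
    where
    eq : ∀ t a b c d →
      t ⊠ (a ⊞ b ⊠ t ⊞ c ⊠ (t ⊠ (t ⊠ ℚ[i].fromReal 1ℚ)) ⊞ d ⊠ (t ⊠ (t ⊠ (t ⊠ ℚ[i].fromReal 1ℚ)))) ≡
      (⊟ d ⊞ a ⊠ t ⊞ (b ⊞ d) ⊠ (t ⊠ (t ⊠ ℚ[i].fromReal 1ℚ)) ⊞ c ⊠ (t ⊠ (t ⊠ (t ⊠ ℚ[i].fromReal 1ℚ)))) ⊞
      d ⊠ (t ⊠ (t ⊠ (t ⊠ (t ⊠ ℚ[i].fromReal 1ℚ))) ⊞ ⊟ (t ⊠ (t ⊠ ℚ[i].fromReal 1ℚ)) ⊞ ℚ[i].fromReal 1ℚ)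
    eq = solve-∀ ℚi-acr

  ^-eval : ∀ n → θ ^ n ≋ eval (ζ^ n)
  ^-eval zero    = C.sym (eval-constant 1ℚ)
  ^-eval (suc n) = C.trans (C.*-congˡ {θ} (^-eval n)) (eval-ζ* (ζ^ n))

  sum-eval : ∀ {n} (f : Fin n → ℚ[ζ]) → sum (λ k → eval (f k)) ≋ eval (Σζ f)
  sum-eval {zero}  f = C.sym (eval-constant 0ℚ)
  sum-eval {suc n} f = C.trans (C.+-congˡ (sum-eval (λ k → f (suc k)))) (C.sym (eval-⊹ (f zero) (Σζ (λ k → f (suc k)))))

  θ¹²≋1 : θ ^ 12 ≋ 1ᶜ
  θ¹²≋1 = C.trans (^-eval 12) (C.trans (C.reflexive (cong eval ζ^12≡1)) (eval-constant 1ℚ))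

  ^-% : ∀ n → θ ^ n ≋ θ ^ (n ℕ.% 12)
  ^-% = ^-periodic θ 12 θ¹²≋1

  conj-θ : conj θ ≋ θ ^ 11
  conj-θ = begin
    conj θ                ≈⟨ C.*-identityʳ (conj θ) ⟨
    conj θ ⊗ 1ᶜ           ≈⟨ C.*-congˡ {conj θ} θ¹²≋1 ⟨
    conj θ ⊗ (θ ⊗ θ ^ 11) ≈⟨ C.*-assoc (conj θ) θ (θ ^ 11) ⟨
    conj θ ⊗ θ ⊗ θ ^ 11   ≈⟨ C.*-congʳ {θ ^ 11} unimodular ⟩
    1ᶜ ⊗ θ ^ 11           ≈⟨ C.*-identityˡ (θ ^ 11) ⟩
    θ ^ 11                ∎

  conj-θ^ : ∀ n → conj (θ ^ n) ≋ θ ^ (11 ℕ.* n)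
  conj-θ^ = conj-^-power θ 11 conj-θ

  θ⁶≉1 : ¬ (θ ^ 6 ≋ 1ᶜ)
  θ⁶≉1 θ⁶≋1 = 2≮1 (embed-separated (- 1ℚ) 1ℚ (begin
    embed (- 1ℚ)            ≈⟨ eval-constant (- 1ℚ) ⟨
    eval (constant (- 1ℚ))  ≈⟨ C.reflexive (cong eval ζ^6≡-1) ⟨
    eval (ζ^ 6)             ≈⟨ ^-eval 6 ⟨
    θ ^ 6                   ≈⟨ θ⁶≋1 ⟩
    1ᶜ                      ∎))

  -- In 1 + θ⁴ + θ⁸ = 0 all three summands would be 1, giving 0 = 3.
  θ⁴≉1 : ¬ (θ ^ 4 ≋ 1ᶜ)
  θ⁴≉1 θ⁴≋1 = 3≮1 (embed-separated 0ℚ (fromℕ 3) (begin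
    embed 0ℚ                                  ≈⟨ eval-constant 0ℚ ⟨
    eval (constant 0ℚ)                        ≈⟨ C.reflexive (cong eval 1+ζ⁴+ζ⁸≡0) ⟨
    eval (ζ^ 0 ⊹ (ζ^ 4 ⊹ ζ^ 8))               ≈⟨ eval-⊹ (ζ^ 0) (ζ^ 4 ⊹ ζ^ 8) ⟩
    eval (ζ^ 0) ⊕ eval (ζ^ 4 ⊹ ζ^ 8)          ≈⟨ C.+-congˡ {eval (ζ^ 0)} (eval-⊹ (ζ^ 4) (ζ^ 8)) ⟩
    eval (ζ^ 0) ⊕ (eval (ζ^ 4) ⊕ eval (ζ^ 8)) ≈⟨ C.+-cong (^-eval 0) (C.+-cong (^-eval 4) (^-eval 8)) ⟨
    1ᶜ ⊕ (θ ^ 4 ⊕ θ ^ 8)                      ≈⟨ C.+-congˡ {1ᶜ} (C.+-cong θ⁴≋1 (power≋1 4 2 θ⁴≋1)) ⟩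
    1ᶜ ⊕ (1ᶜ ⊕ 1ᶜ)                            ≈⟨ pointwise (λ _ → refl) ⟩
    embed (fromℕ 3)                           ∎))
    where
    power≋1 : ∀ m n → θ ^ m ≋ 1ᶜ → θ ^ (m ℕ.* n) ≋ 1ᶜ
    power≋1 m n θᵐ≋1 = C.trans (C.sym (^-assocʳ θ m n)) (C.trans (^-congˡ n θᵐ≋1) (1^ n))

  -- Otherwise the residue of n is nonzero and `torsion` supplies a power equal to θ⁶ or θ⁴, neither
  -- of which is 1. The argument by contradiction is sound because the conclusion is a decidable
  -- equality of naturals.
  θ^≋1 : ∀ n → θ ^ n ≋ 1ᶜ → n ℕ.% 12 ≡ 0
  θ^≋1 n θⁿ≋1 = decidable-stable (n ℕ.% 12 ℕ.≟ 0) λ n≢0 →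
    let toℕ-d = Fin.toℕ-fromℕ< (m%n<n n 12)
    in nontrivial (fromℕ< (m%n<n n 12)) (λ d≡0 → n≢0 (trans (sym toℕ-d) d≡0))
         (C.trans (^-congʳ θ toℕ-d) (C.trans (C.sym (^-% n)) θⁿ≋1))
    where
    nontrivial : ∀ d → ¬ (toℕ {12} d ≡ 0) → ¬ (θ ^ toℕ d ≋ 1ᶜ)
    nontrivial d d≢0 θᵈ≋1 =
      let m , order = torsion d d≢0
      in [ (λ ≡6 → θ⁶≉1 (C.trans (^-congʳ θ (sym ≡6)) (θᵈᵐ≋1 m)))
         , (λ ≡4 → θ⁴≉1 (C.trans (^-congʳ θ (sym ≡4)) (θᵈᵐ≋1 m))) ]′ order
      where
      θᵈᵐ≋1 : ∀ m → θ ^ ((toℕ d ℕ.* toℕ m) ℕ.% 12) ≋ 1ᶜ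
      θᵈᵐ≋1 m = begin
        θ ^ ((toℕ d ℕ.* toℕ m) ℕ.% 12)  ≈⟨ ^-% (toℕ d ℕ.* toℕ m) ⟨
        θ ^ (toℕ d ℕ.* toℕ m)           ≈⟨ ^-assocʳ θ (toℕ d) (toℕ m) ⟨
        (θ ^ toℕ d) ^ toℕ m             ≈⟨ ^-congˡ (toℕ m) θᵈ≋1 ⟩
        1ᶜ ^ toℕ m                      ≈⟨ 1^ (toℕ m) ⟩
        1ᶜ                              ∎

  θ^-injective : ∀ m n → θ ^ m ≋ θ ^ n → (11 ℕ.* n ℕ.+ m) ℕ.% 12 ≡ 0
  θ^-injective m n θᵐ≋θⁿ = θ^≋1 (11 ℕ.* n ℕ.+ m) (begin
    θ ^ (11 ℕ.* n ℕ.+ m)     ≈⟨ ^-homo-* θ (11 ℕ.* n) m ⟩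
    θ ^ (11 ℕ.* n) ⊗ θ ^ m   ≈⟨ C.*-cong (conj-θ^ n) (C.sym θᵐ≋θⁿ) ⟨
    conj (θ ^ n) ⊗ θ ^ n     ≈⟨ C.*-congʳ {θ ^ n} (conj-^ θ n) ⟩
    conj θ ^ n ⊗ θ ^ n       ≈⟨ ^-distrib-* (conj θ) θ n ⟨
    (conj θ ⊗ θ) ^ n         ≈⟨ ^-congˡ n unimodular ⟩
    1ᶜ ^ n                   ≈⟨ 1^ n ⟩
    1ᶜ                       ∎)

  module _ {s : ℂ} (s-real : conj s ≋ s) (s²6≋1 : (s ⊗ s) ⊗ embed (fromℕ 6) ≋ 1ᶜ)
    {b : Fin 6 → ℂ^ 6} (x : Exponents) (b≋ : ∀ i k → b i k ≋ s ⊗ θ ^ x i k) where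

    private
      term : ∀ a c → conj (s ⊗ θ ^ a) ⊗ (s ⊗ θ ^ c) ≋ (s ⊗ s) ⊗ eval (ζ^ ((11 ℕ.* a ℕ.+ c) ℕ.% 12))
      term a c = begin
        conj (s ⊗ θ ^ a) ⊗ (s ⊗ θ ^ c)
          ≈⟨ C.*-congʳ (C.trans (conj-⊗ s (θ ^ a)) (C.*-cong s-real (conj-θ^ a))) ⟩
        (s ⊗ θ ^ (11 ℕ.* a)) ⊗ (s ⊗ θ ^ c)
          ≈⟨ pointwise (λ n → eq (s at n) ((θ ^ (11 ℕ.* a)) at n) ((θ ^ c) at n)) ⟩
        (s ⊗ s) ⊗ (θ ^ (11 ℕ.* a) ⊗ θ ^ c)       ≈⟨ C.*-congˡ (^-homo-* θ (11 ℕ.* a) c) ⟨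
        (s ⊗ s) ⊗ θ ^ (11 ℕ.* a ℕ.+ c)           ≈⟨ C.*-congˡ (^-% (11 ℕ.* a ℕ.+ c)) ⟩
        (s ⊗ s) ⊗ θ ^ ((11 ℕ.* a ℕ.+ c) ℕ.% 12)  ≈⟨ C.*-congˡ (^-eval ((11 ℕ.* a ℕ.+ c) ℕ.% 12)) ⟩
        (s ⊗ s) ⊗ eval (ζ^ ((11 ℕ.* a ℕ.+ c) ℕ.% 12)) ∎
        where
        eq : ∀ s p q → (s ⊠ p) ⊠ (s ⊠ q) ≡ (s ⊠ s) ⊠ (p ⊠ q)
        eq = solve-∀ ℚi-acr

    -- Conjugation turns each inner product into s² times a sum of powers of θ, which is the value
    -- of `gram`; the diagonal value 6 is normalised by 6 s² = 1.
    Butson⇒orthonormal : IsButson x → Orthonormal b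
    Butson⇒orthonormal butson i j = begin
      sum (λ k → conj (b i k) ⊗ b j k)
        ≈⟨ sum-cong-≋ (λ k → C.trans (C.*-cong (conj-cong (b≋ i k)) (b≋ j k)) (term (x i k) (x j k))) ⟩
      sum (λ k → (s ⊗ s) ⊗ eval (ζ^ ((11 ℕ.* x i k ℕ.+ x j k) ℕ.% 12)))
        ≈⟨ *-distribˡ-sum (s ⊗ s) (λ k → eval (ζ^ ((11 ℕ.* x i k ℕ.+ x j k) ℕ.% 12))) ⟨
      (s ⊗ s) ⊗ sum (λ k → eval (ζ^ ((11 ℕ.* x i k ℕ.+ x j k) ℕ.% 12)))
        ≈⟨ C.*-congˡ (sum-eval (λ k → ζ^ ((11 ℕ.* x i k ℕ.+ x j k) ℕ.% 12))) ⟩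
      (s ⊗ s) ⊗ eval (gram x i j)
        ≈⟨ C.*-congˡ (C.reflexive (cong eval (butson i j))) ⟩
      (s ⊗ s) ⊗ eval (if does (i Fin.≟ j) then constant (fromℕ 6) else constant 0ℚ)
        ≈⟨ normalise (does (i Fin.≟ j)) ⟩
      δ i j ∎
      where
      normalise : ∀ d → (s ⊗ s) ⊗ eval (if d then constant (fromℕ 6) else constant 0ℚ) ≋ (if d then 1ᶜ else 0ᶜ)
      normalise true  = C.trans (C.*-congˡ (eval-constant (fromℕ 6))) s²6≋1
      normalise false = C.trans (C.*-congˡ (eval-constant 0ℚ)) (C.zeroʳ (s ⊗ s))

-- The quantum Latin square and its phase classes

module _ {θ s : ℂ} (root : IsPrimitiveTwelfthRoot θ) (s-real : conj s ≋ s) (s²6≋1 : (s ⊗ s) ⊗ embed (fromℕ 6) ≋ 1ᶜ)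
  {Φ : Matrix (ℂ^ 6) 6 6} (Φ≋ : ∀ i j k → Φ i j k ≋ s ⊗ θ ^ exponent (i , j) k) where
  open SetoidReasoning C.setoid

  private
    orthonormal : (x : Exponents) (b : Fin 6 → ℂ^ 6) → (∀ i k → b i k ≋ s ⊗ θ ^ x i k) →
      IsButson x → Orthonormal b
    orthonormal x b b≋ = Butson⇒orthonormal root s-real s²6≋1 {b} x b≋

    row-orthonormal : ∀ i → Orthonormal (λ j → Φ i j)
    row-orthonormal i = orthonormal (row-exponents i) (λ j → Φ i j) (λ j k → Φ≋ i j k) (rows-Butson i)

  Φ-isQuantumLatinSquare : IsQuantumLatinSquare Φ
  Φ-isQuantumLatinSquare = record
    { unit    = λ i j → subst (⟨ Φ i j , Φ i j ⟩ ≋_) (δ-refl j) (row-orthonormal i j j)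
    ; rows    = λ i → orthonormalBasis {b = λ j → Φ i j} (row-orthonormal i)
        (orthonormal (transpose (row-exponents i)) (transpose (λ j → Φ i j)) (λ k j → Φ≋ i j k) (rows-Butsonᵀ i))
    ; columns = λ j → orthonormalBasis {b = λ i → Φ i j}
        (orthonormal (column-exponents j) (λ i → Φ i j) (λ i k → Φ≋ i j k) (columns-Butson j))
        (orthonormal (transpose (column-exponents j)) (transpose (λ i → Φ i j)) (λ k i → Φ≋ i j k) (columns-Butsonᵀ j))
    }

  -- The relation 6 s² = 1 makes 6 s an inverse of s.
  s-cancel : ∀ {z w} → s ⊗ z ≋ s ⊗ w → z ≋ w
  s-cancel {z} {w} sz≋sw = begin
    z                                   ≈⟨ clear z ⟩
    (s ⊗ embed (fromℕ 6)) ⊗ (s ⊗ z)     ≈⟨ C.*-congˡ sz≋sw ⟩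
    (s ⊗ embed (fromℕ 6)) ⊗ (s ⊗ w)     ≈⟨ clear w ⟨
    w                                   ∎
    where
    clear : ∀ z → z ≋ (s ⊗ embed (fromℕ 6)) ⊗ (s ⊗ z)
    clear z = begin
      z                                 ≈⟨ C.*-identityˡ z ⟨
      1ᶜ ⊗ z                            ≈⟨ C.*-congʳ s²6≋1 ⟨
      (s ⊗ s) ⊗ embed (fromℕ 6) ⊗ z     ≈⟨ pointwise (λ n → eq (s at n) (embed (fromℕ 6) at n) (z at n)) ⟩
      (s ⊗ embed (fromℕ 6)) ⊗ (s ⊗ z)   ∎
      where
      eq : ∀ s q z → (s ⊠ s) ⊠ q ⊠ z ≡ (s ⊠ q) ⊠ (s ⊠ z)
      eq = solve-∀ ℚi-acr

  -- The first components all equal s, which forces the phase to be 1.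
  phase⇒exponents : ∀ p q E → Φ (proj₁ p) (proj₂ p) ≋ᵛ E • Φ (proj₁ q) (proj₂ q) →
    ∀ r → (11 ℕ.* exponent q r ℕ.+ exponent p r) ℕ.% 12 ≡ 0
  phase⇒exponents p q E u≋Ev r = θ^-injective root (exponent p r) (exponent q r) (begin
    θ ^ exponent p r        ≈⟨ powers r ⟩
    E ⊗ θ ^ exponent q r    ≈⟨ C.*-congʳ {θ ^ exponent q r} E≋1 ⟩
    1ᶜ ⊗ θ ^ exponent q r   ≈⟨ C.*-identityˡ (θ ^ exponent q r) ⟩
    θ ^ exponent q r        ∎)
    where
    powers : ∀ r → θ ^ exponent p r ≋ E ⊗ θ ^ exponent q r
    powers r = s-cancel {θ ^ exponent p r} {E ⊗ θ ^ exponent q r} (begin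
      s ⊗ θ ^ exponent p r              ≈⟨ Φ≋ (proj₁ p) (proj₂ p) r ⟨
      Φ (proj₁ p) (proj₂ p) r           ≈⟨ u≋Ev r ⟩
      E ⊗ Φ (proj₁ q) (proj₂ q) r       ≈⟨ C.*-congˡ {E} (Φ≋ (proj₁ q) (proj₂ q) r) ⟩
      E ⊗ (s ⊗ θ ^ exponent q r)        ≈⟨ C.*-assoc E s (θ ^ exponent q r) ⟨
      E ⊗ s ⊗ θ ^ exponent q r          ≈⟨ C.*-congʳ {θ ^ exponent q r} (C.*-comm E s) ⟩
      s ⊗ E ⊗ θ ^ exponent q r          ≈⟨ C.*-assoc s E (θ ^ exponent q r) ⟩
      s ⊗ (E ⊗ θ ^ exponent q r)        ∎)
    first≋1 : ∀ p → θ ^ exponent p zero ≋ 1ᶜ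
    first≋1 p = C.reflexive (cong (θ ^_) (exponent-0 (proj₁ p) (proj₂ p)))
    E≋1 : E ≋ 1ᶜ
    E≋1 = begin
      E                        ≈⟨ C.*-identityʳ E ⟨
      E ⊗ 1ᶜ                   ≈⟨ C.*-congˡ {E} {θ ^ exponent q zero} {1ᶜ} (first≋1 q) ⟨
      E ⊗ θ ^ exponent q zero  ≈⟨ powers zero ⟨
      θ ^ exponent p zero      ≈⟨ first≋1 p ⟩
      1ᶜ                       ∎

  Φ-hasCardinality : HasCardinality (Φ) 35
  Φ-hasCardinality = class , congruent , injective , surjective
    where
    -- Different classes would give a component where the exponents differ modulo 12, whereas phase
    -- equivalence makes them agree everywhere. Equality in `Fin 35` is decidable, so this
    -- contradiction proves it.
    congruent : ∀ {p q} → Φ (proj₁ p) (proj₂ p) ∼ Φ (proj₁ q) (proj₂ q) → class p ≡ class q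
    congruent {i , j} {k , l} p∼q = decidable-stable (class (i , j) Fin.≟ class (k , l)) λ p≢q →
      let r , r≢0 = class-≢ i j k l p≢q in
      r≢0 (phase⇒exponents (i , j) (k , l) (exp (𝕚 ⊗ fromReal (proj₁ p∼q))) (proj₂ p∼q) r)
    injective : ∀ {p q} → class p ≡ class q → Φ (proj₁ p) (proj₂ p) ∼ Φ (proj₁ q) (proj₂ q)
    -- Exponents in one class agree modulo 12, so the vectors are equal and the angle 0 witnesses
    -- phase equivalence.
    injective {i , j} {k , l} p≡q = 0ᴿ , λ r → begin
      Φ i j r                                 ≈⟨ Φ≋ i j r ⟩
      s ⊗ θ ^ exponent (i , j) r                  ≈⟨ C.*-congˡ (^-% root (exponent (i , j) r)) ⟩
      s ⊗ θ ^ (exponent (i , j) r ℕ.% 12)         ≈⟨ C.*-congˡ (^-congʳ θ (class-≡ i j k l p≡q r)) ⟩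
      s ⊗ θ ^ (exponent (k , l) r ℕ.% 12)         ≈⟨ C.*-congˡ (^-% root (exponent (k , l) r)) ⟨
      s ⊗ θ ^ exponent (k , l) r                  ≈⟨ Φ≋ k l r ⟨
      Φ k l r                                 ≈⟨ C.*-identityˡ (Φ k l r) ⟨
      1ᶜ ⊗ Φ k l r                            ≈⟨ C.*-congʳ {Φ k l r} phase-0 ⟨
      exp (𝕚 ⊗ fromReal 0ᴿ) ⊗ Φ k l r         ∎
      where
      phase-0 : exp (𝕚 ⊗ fromReal 0ᴿ) ≋ 1ᶜ
      phase-0 = C.trans (exp-cong (C.zeroʳ 𝕚)) exp-0
    surjective : ∀ c → ∃[ p ] (∀ {q} → Φ (proj₁ q) (proj₂ q) ∼ Φ (proj₁ p) (proj₂ p) → class q ≡ c)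
    -- Surjectivity for setoids asks that every position equivalent to the preimage be sent to c,
    -- hence the appeal to `congruent`.
    surjective c = let p , p≡c = class-surjective c in p , λ {q} q∼p → trans (congruent {q} {p} q∼p) p≡c

-- The matrix K and the array Φ₃₅ in terms of exponents

permutationMatrix-· : ∀ {m n} (σ : Permutation′ m) (M : Matrix ℂ m n) r t →
  (permutationMatrix σ · M) r t ≋ M (σ ⟨$⟩ʳ r) t
permutationMatrix-· σ M r t = sum-δ (σ ⟨$⟩ʳ r) (λ j → M j t)

K≋ : ∀ θ r t → K θ r t ≋ θ ^ toℕ (B r t)
K≋ θ r t = C.trans {K θ r t} (permutationMatrix-· (transposition (# 4) (# 5)) (transpose (H θ)) r t)
  (^-congʳ θ (cong toℕ (K-exponents r t)))

Φ₃₅≋ : ∀ θ i j k → Φ₃₅ θ i j k ≋ fromReal (recip (√ 6) (√-pos 5)) ⊗ θ ^ exponent (i , j) k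
Φ₃₅≋ θ i j k = C.*-congˡ {fromReal (recip (√ 6) (√-pos 5))}
  (C.trans (C.*-congˡ {θ ^ toℕ (A k i)} (K≋ θ k j)) (C.sym (^-homo-* θ (toℕ (A k i)) (toℕ (B k j)))))

conj-fromReal : ∀ x → conj (fromReal x) ≋ fromReal x
conj-fromReal x = pointwise λ _ → refl

s₃₅ : ℂ
s₃₅ = fromReal (recip (√ 6) (√-pos 5))

s₃₅²6≋1 : (s₃₅ ⊗ s₃₅) ⊗ embed (fromℕ 6) ≋ 1ᶜ
s₃₅²6≋1 = recip-square {√ 6} {fromℚ (fromℕ 6)} (√-pos 5) (√-square 6)

Φ₃₅-isQuantumLatinSquare : ∀ {θ} → IsPrimitiveTwelfthRoot θ → IsQuantumLatinSquare (Φ₃₅ θ)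
Φ₃₅-isQuantumLatinSquare {θ} root =
  Φ-isQuantumLatinSquare {θ} {s₃₅} root (conj-fromReal (recip (√ 6) (√-pos 5))) s₃₅²6≋1 {Φ₃₅ θ} (Φ₃₅≋ θ)

Φ₃₅-hasCardinality : ∀ {θ} → IsPrimitiveTwelfthRoot θ → HasCardinality (Φ₃₅ θ) 35
Φ₃₅-hasCardinality {θ} root =
  Φ-hasCardinality {θ} {s₃₅} root (conj-fromReal (recip (√ 6) (√-pos 5))) s₃₅²6≋1 {Φ₃₅ θ} (Φ₃₅≋ θ)

Φ₃₅-theorem : ∀ {θ} → IsPrimitiveTwelfthRoot θ →
  (∀ r s → K θ r s ≋ θ ^ toℕ (B r s)) × IsQuantumLatinSquare (Φ₃₅ θ) × HasCardinality (Φ₃₅ θ) 35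
Φ₃₅-theorem {θ} root =
  K≋ θ , Φ₃₅-isQuantumLatinSquare root , Φ₃₅-hasCardinality root

theorem7 : (π : ℝ) → IsPi π →
    let θ = exp (fromReal (π *ᴿ fromℚ (+ 1 / 6)) ⊗ 𝕚) in
    (∀ r s → K θ r s ≋ θ ^ toℕ (B r s)) ×
    IsQuantumLatinSquare (Φ₃₅ θ) ×
    HasCardinality (Φ₃₅ θ) 35
theorem7 π isPi = Φ₃₅-theorem (exp[iπ/6]-isPrimitive isPi)
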